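{- Let $k,\ell$ be positive integers with $\ell<k\leq 2\ell+1$. Then \[ \widehat{\mathscr{M}}_{(k,\ell)}(N)=\Big(\frac{1}{k+\ell}+o(1)\Big)N\qquad (N\to\infty). \]
   Context: For positive integers $k>\ell$, a set $S$ of positive integers is restricted $(k,\ell)$-sum-free if for any $k$ pairwise distinct elements $a_1,\dots,a_k\in S$ and any $\ell$ pairwise distinct elements $b_1,\dots,b_\ell\in S$ one has $a_1+\dots+a_k\neq b_1+\dots+b_\ell$. Let $\widehat{\mathscr{M}}_{(k,\ell)}(N)=\inf_{A}\max\{|S|: S\subseteq A,\ S \text{ restricted } (k,\ell)\text{ -sum-free}\}$, the infimum over all sets $A$ of $N$ positive integers. -}

module Defs where

open import Data.Nat using (ℕ; _+_; _*_; _≤_; _<_)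
open import Data.List using (List; length)
open import Data.Nat.ListAction using (sum)
open import Data.List.Relation.Unary.All using (All)
open import Data.List.Relation.Unary.Unique.Propositional using (Unique)
open import Data.List.Membership.Propositional using (_∈_)
open import Data.Product using (Σ; _×_)
open import Relation.Binary.PropositionalEquality using (_≡_; _≢_)

NSetOfPositives : ℕ → List ℕ → Set
NSetOfPositives N A = Unique A × All (λ a → 1 ≤ a) A × length A ≡ N

SubsetOf : List ℕ → List ℕ → Set
SubsetOf S A = Unique S × All (λ s → s ∈ A) S

DistinctElems : ℕ → List ℕ → List ℕ → Set
DistinctElems m S as = Unique as × All (λ a → a ∈ S) as × length as ≡ m

RestrictedSumFree : ℕ → ℕ → List ℕ → Set
RestrictedSumFree k ℓ S =
  (as bs : List ℕ) → DistinctElems k S as → DistinctElems ℓ S bs → sum as ≢ sum bs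

-- Mhat_(k,ℓ)(N) ≥ m : every N-set A contains a restricted sum-free S with |S| ≥ m
-- (expressed here with a rational lower bound: |S|·(k+ℓ)·q + N·(k+ℓ) ≥ N·q,
--  i.e. |S| ≥ (1/(k+ℓ) - 1/q) N).
MhatLower : ℕ → ℕ → ℕ → ℕ → Set
MhatLower k ℓ q N =
  (A : List ℕ) → NSetOfPositives N A →
  Σ (List ℕ) λ S → SubsetOf S A × RestrictedSumFree k ℓ S ×
    N * q ≤ length S * (k + ℓ) * q + N * (k + ℓ)

-- Mhat_(k,ℓ)(N) ≤ (1/(k+ℓ) + 1/q) N : some N-set A all of whose restricted
-- sum-free subsets S satisfy |S|·(k+ℓ)·q ≤ N·q + N·(k+ℓ).
MhatUpper : ℕ → ℕ → ℕ → ℕ → Set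
MhatUpper k ℓ q N =
  Σ (List ℕ) λ A → NSetOfPositives N A ×
    ((S : List ℕ) → SubsetOf S A → RestrictedSumFree k ℓ S →
      length S * (k + ℓ) * q ≤ N * q + N * (k + ℓ))

{-# OPTIONS --safe #-}

-- Lower bound (Erdős): multiply A by x modulo M = (k² − ℓ²)·∏A and keep the elements falling in
-- [ℓ∏A, k∏A). A k-fold and an ℓ-fold sum of residues in this window are never congruent modulo M,
-- and on average over x the window catches a proportion 1/(k+ℓ) of A.
--
-- Upper bound: let F be an almost multiplicatively invariant set. If S ⊆ F is denser than
-- 1/(k+ℓ), then some dilate B = {j : xj ∈ S} has density d > 1/(k+ℓ) on the multiples of M
-- for many moduli M, each dividing the next. Write the equation as y' = y + x₂ + … + x_k − z₂ − … − z_ℓ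
-- with all xᵢ, zᵢ multiples of M taken from distinct blocks, so that y and y' lie in the same class
-- modulo M. Either the signed sumset of these k+ℓ−1 pieces has density nearly (k+ℓ−1)d, which
-- leaves no room for y', or it nearly contains a progression of bounded difference tM. In the
-- latter case y' avoids a class modulo tM, so B is denser on some other class modulo tM. The density
-- therefore increases at every modulus, a contradiction after boundedly many of them.
--
-- The dichotomy for a sumset A + B comes from replacing (A, B) by (A ∪ (A+s), B ∩ (B−s)) or by
-- (A ∩ (A−s), B ∪ (B+s)), which both shrink A + B. By convexity one of the two increases
-- L(|A|+|B|) + |A|² + |B|², unless B is nearly invariant under s.

module Submission where

open import Defs
open import Data.Bool as Bool using (Bool; true; false; _∧_; _∨_; not)
open import Data.Bool.Properties using (∧-comm; ∧-zeroʳ)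
open import Data.Empty using (⊥; ⊥-elim)
open import Data.List
  using (List; []; _∷_; _++_; length; map; filter; take; upTo; deduplicate; cartesianProductWith)
open import Data.List.Membership.Propositional using (_∈_)
open import Data.List.Membership.Propositional.Properties
  using (∈-∃++; ∈-++⁻; ∈-++⁺ˡ; ∈-++⁺ʳ; ∈-map⁺; ∈-map⁻; ∈-filter⁺; ∈-filter⁻; ∈-upTo⁺; ∈-upTo⁻;
         ∈-cartesianProductWith⁺; ∈-cartesianProductWith⁻; ∈-deduplicate⁺; ∈-deduplicate⁻; ∈-length)
open import Data.List.Properties
  using (length-++; length-map; length-take; length-upTo; length-deduplicate)
open import Data.List.Relation.Binary.Pointwise using (Pointwise; []; _∷_; Pointwise-length)
open import Data.List.Relation.Unary.All as All using (All; []; _∷_)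
open import Data.List.Relation.Unary.All.Properties as Allₚ using ()
open import Data.List.Relation.Unary.AllPairs using ([]; _∷_)
open import Data.List.Relation.Unary.Any using (here; there)
open import Data.List.Relation.Unary.Unique.Propositional using (Unique)
open import Data.List.Relation.Unary.Unique.Propositional.Properties as Unique using ()
open import Data.Nat
open import Data.Nat.DivMod using (m≡m%n+[m/n]*n; m%n<n; [m+kn]%n≡m%n; m<n⇒m%n≡m)
open import Data.Nat.Divisibility using (_∣_; divides; m∣m*n; ∣-trans; m≤n⇒m!∣n!)
open import Data.Nat.ListAction using (sum; product)
open import Data.Nat.ListAction.Properties using (∈⇒∣product; product≢0)
open import Data.Nat.Properties
open import Data.Nat.Tactic.RingSolver using (solve-∀)
open import Data.Product using (Σ; ∃; _×_; _,_; proj₁; proj₂)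
open import Data.Sum using (_⊎_; inj₁; inj₂)
open import Function using (_∘_; case_of_)
open import Relation.Binary.PropositionalEquality hiding (J)
open import Relation.Nullary using (¬_; Dec; yes; no; does; ¬?; _×-dec_)
open import Relation.Nullary.Decidable using (dec-true; dec-false)
open import Relation.Unary using (Decidable)
open import Data.List.Membership.DecPropositional _≟_ using (_∈?_)
open import Data.List.Relation.Unary.Unique.DecPropositional.Properties _≟_ using (deduplicate-!)

-- Sums and counts over initial segments

-- The progression difference t produced by the dichotomy depends on B, hence on the dilation x,
-- whereas averaging over x must compare all dilates on the same moduli. The moduli are therefore
-- fixed in advance as 1, `F`, `F`², ... with `F` = (4P)!, a multiple of every admissible t (t < `R`
-- = 4P). A dense class modulo tM then contains an equally dense class modulo `M * F`. Densities are
-- fractions with two fixed denominators: `P` for the blocks that supply the summands xᵢ and zᵢ, and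
-- `Q` for the cell that holds y and y'. One increment is a step of 1/`Q`, so at most `Q` + 1 levels
-- can be good. Among `T` = P(Q + 1) levels these raise the average density by at most 1/`P`. At
-- scale u the increment lives on progressions of length u, the sumset yields progressions of length
-- P u, blocks have length P⁹ u and cells P¹¹ u. Each length is large enough to make the errors of
-- the shorter ones negligible.

sumTo : ℕ → (ℕ → ℕ) → ℕ
sumTo zero    f = 0
sumTo (suc n) f = sumTo n f + f n

sumTo-cong : ∀ n {f g : ℕ → ℕ} → (∀ i → i < n → f i ≡ g i) → sumTo n f ≡ sumTo n g
sumTo-cong zero    h = refl
sumTo-cong (suc n) h = cong₂ _+_ (sumTo-cong n (λ i i<n → h i (m<n⇒m<1+n i<n))) (h n ≤-refl)

sumTo-mono : ∀ n {f g : ℕ → ℕ} → (∀ i → i < n → f i ≤ g i) → sumTo n f ≤ sumTo n g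
sumTo-mono zero    h = z≤n
sumTo-mono (suc n) h = +-mono-≤ (sumTo-mono n (λ i i<n → h i (m<n⇒m<1+n i<n))) (h n ≤-refl)

sumTo-+ : ∀ n (f g : ℕ → ℕ) → sumTo n (λ i → f i + g i) ≡ sumTo n f + sumTo n g
sumTo-+ zero    f g = refl
sumTo-+ (suc n) f g rewrite sumTo-+ n f g = interchange (sumTo n f) (sumTo n g) (f n) (g n)
  where
  interchange : ∀ a b c d → a + b + (c + d) ≡ a + c + (b + d)
  interchange = solve-∀

sumTo-*ˡ : ∀ n c (f : ℕ → ℕ) → sumTo n (λ i → c * f i) ≡ c * sumTo n f
sumTo-*ˡ zero    c f = sym (*-zeroʳ c)
sumTo-*ˡ (suc n) c f rewrite sumTo-*ˡ n c f = sym (*-distribˡ-+ c (sumTo n f) (f n))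

sumTo-const : ∀ n c → sumTo n (λ _ → c) ≡ n * c
sumTo-const zero    c = refl
sumTo-const (suc n) c rewrite sumTo-const n c = +-comm (n * c) c

sumTo-≤const : ∀ n {f : ℕ → ℕ} c → (∀ i → i < n → f i ≤ c) → sumTo n f ≤ n * c
sumTo-≤const n c h = ≤-trans (sumTo-mono n h) (≤-reflexive (sumTo-const n c))

sumTo-≥const : ∀ n {f : ℕ → ℕ} c → (∀ i → i < n → c ≤ f i) → n * c ≤ sumTo n f
sumTo-≥const n c h = ≤-trans (≤-reflexive (sym (sumTo-const n c))) (sumTo-mono n h)

sumTo-swap : ∀ m n (f : ℕ → ℕ → ℕ) →
  sumTo m (λ i → sumTo n (λ j → f i j)) ≡ sumTo n (λ j → sumTo m (λ i → f i j))
sumTo-swap zero    n f = sym (trans (sumTo-const n 0) (*-zeroʳ n))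
sumTo-swap (suc m) n f rewrite sumTo-swap m n f =
  sym (sumTo-+ n (λ j → sumTo m (λ i → f i j)) (f m))

sumTo-split : ∀ m n (f : ℕ → ℕ) → sumTo (m + n) f ≡ sumTo m f + sumTo n (λ i → f (m + i))
sumTo-split m zero    f rewrite +-identityʳ m = sym (+-identityʳ _)
sumTo-split m (suc n) f rewrite +-suc m n | sumTo-split m n f =
  +-assoc (sumTo m f) _ _

sumTo-blocks : ∀ m n (f : ℕ → ℕ) →
  sumTo (m * n) f ≡ sumTo m (λ i → sumTo n (λ j → f (i * n + j)))
sumTo-blocks zero    n f = refl
sumTo-blocks (suc m) n f = trans (cong (λ z → sumTo z f) (+-comm n (m * n)))
  (trans (sumTo-split (m * n) n f) (cong₂ _+_ (sumTo-blocks m n f) refl))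

sumTo-classes : ∀ h n (f : ℕ → ℕ) →
  sumTo (h * n) f ≡ sumTo h (λ c → sumTo n (λ i → f (c + h * i)))
sumTo-classes h n f = trans (cong (λ z → sumTo z f) (*-comm h n))
  (trans (sumTo-blocks n h f)
  (trans (sumTo-swap n h (λ i j → f (i * h + j)))
         (sumTo-cong h λ c _ → sumTo-cong n λ i _ →
            cong f (trans (+-comm (i * h) c) (cong (c +_) (*-comm i h))))))

sumTo-≤-length : ∀ {m n} (f : ℕ → ℕ) → m ≤ n → sumTo m f ≤ sumTo n f
sumTo-≤-length {m} f m≤n with m≤n⇒∃[o]m+o≡n m≤n
... | d , refl rewrite sumTo-split m d f = m≤m+n _ _

sumTo-pigeon : ∀ n {f g : ℕ → ℕ} → sumTo n f < sumTo n g → ∃ λ i → i < n × f i < g i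
sumTo-pigeon (suc n) {f} {g} lt with f n <? g n
... | yes p = n , ≤-refl , p
... | no ¬p with sumTo-pigeon n {f} {g}
                   (+-cancelʳ-< (f n) _ _ (<-≤-trans lt (+-monoʳ-≤ (sumTo n g) (≮⇒≥ ¬p))))
...   | i , i<n , q = i , m<n⇒m<1+n i<n , q

sumTo-average : ∀ n {f : ℕ → ℕ} c → 0 < n → n * c ≤ sumTo n f → ∃ λ i → i < n × c ≤ f i
sumTo-average n {f} c 0<n le
  -- Adding 1 to every `f i` creates the strict inequality that the pigeonhole needs.
  with sumTo-pigeon n {λ _ → c} {λ i → suc (f i)}
         (<-≤-trans (subst (_< n + sumTo n f) (sym (sumTo-const n c)) (+-mono-<-≤ 0<n le))
            (≤-reflexive (sym (trans (sumTo-+ n (λ _ → 1) f)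
               (cong₂ _+_ (trans (sumTo-const n 1) (*-identityʳ n)) refl)))))
... | i , i<n , s≤s q = i , i<n , q

𝟙 : Bool → ℕ
𝟙 true  = 1
𝟙 false = 0

𝟙≤1 : ∀ b → 𝟙 b ≤ 1
𝟙≤1 true  = ≤-refl
𝟙≤1 false = z≤n

Subset : Set
Subset = ℕ → Bool

cnt : Subset → ℕ → ℕ
cnt A n = sumTo n (λ i → 𝟙 (A i))

cnt≤ : ∀ A n → cnt A n ≤ n
cnt≤ A n = ≤-trans (sumTo-≤const n 1 (λ i _ → 𝟙≤1 (A i))) (≤-reflexive (*-identityʳ n))

cnt-mono : ∀ n {A B : Subset} → (∀ i → i < n → A i ≡ true → B i ≡ true) → cnt A n ≤ cnt B n
cnt-mono n {A} {B} h = sumTo-mono n λ i i<n → go (A i) (B i) (h i i<n)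
  where
  go : ∀ a b → (a ≡ true → b ≡ true) → 𝟙 a ≤ 𝟙 b
  go true  b k rewrite k refl = ≤-refl
  go false b k = z≤n

cnt-member : ∀ n {A : Subset} → 1 ≤ cnt A n → ∃ λ i → i < n × A i ≡ true
cnt-member n {A} le with sumTo-pigeon n {λ _ → 0} {λ i → 𝟙 (A i)}
    (subst (_< cnt A n) (sym (trans (sumTo-const n 0) (*-zeroʳ n))) le)
... | i , i<n , p = i , i<n , go (A i) p
  where
  go : ∀ b → 0 < 𝟙 b → b ≡ true
  go true _ = refl

member-cnt : ∀ n {A : Subset} i → i < n → A i ≡ true → 1 ≤ cnt A n
member-cnt (suc n) {A} i i<n p with i ≟ n
... | yes refl rewrite p = m≤n+m 1 (cnt A n)
... | no  i≢n = ≤-trans (member-cnt n i (≤∧≢⇒< (s≤s⁻¹ i<n) i≢n) p) (m≤m+n _ _)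

cnt-disjoint : ∀ n {A B : Subset} → (∀ i → i < n → A i ≡ true → B i ≡ true → ⊥) →
  cnt A n + cnt B n ≤ n
cnt-disjoint n {A} {B} h = subst (_≤ n) (sumTo-+ n (λ i → 𝟙 (A i)) (λ i → 𝟙 (B i)))
  (≤-trans (sumTo-≤const n 1 λ i i<n → go (A i) (B i) (h i i<n)) (≤-reflexive (*-identityʳ n)))
  where
  go : ∀ a b → (a ≡ true → b ≡ true → ⊥) → 𝟙 a + 𝟙 b ≤ 1
  go true  true  k = ⊥-elim (k refl refl)
  go true  false k = ≤-refl
  go false b     k = 𝟙≤1 b

bounded-search : ∀ n {P : ℕ → Set} → (∀ i → Dec (P i)) →
  (∃ λ i → i < n × P i) ⊎ (∀ i → i < n → ¬ P i)
bounded-search zero    P? = inj₂ λ i ()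
bounded-search (suc n) P? with P? n | bounded-search n P?
... | yes p | _ = inj₁ (n , ≤-refl , p)
... | no ¬p | inj₁ (i , i<n , p) = inj₁ (i , m<n⇒m<1+n i<n , p)
... | no ¬p | inj₂ h = inj₂ λ i i<1+n → case i ≟ n of λ where
        (yes refl) → ¬p
        (no i≢n)   → h i (≤∧≢⇒< (s≤s⁻¹ i<1+n) i≢n)

-- Sumsets

Supp : ℕ → Subset → Set
Supp u A = ∀ i → A i ≡ true → i < u

Supp-mono : ∀ {u u' A} → u ≤ u' → Supp u A → Supp u' A
Supp-mono u≤u' h i p = <-≤-trans (h i p) u≤u'

Supp-false : ∀ {u A} → Supp u A → ∀ i → u ≤ i → A i ≡ false
Supp-false {A = A} h i u≤i with A i in eq
... | false = refl
... | true  = ⊥-elim (<⇒≱ (h i eq) u≤i)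

cnt-Supp : ∀ {u W A} → Supp u A → u ≤ W → cnt A W ≡ cnt A u
cnt-Supp {u} {A = A} h u≤W with m≤n⇒∃[o]m+o≡n u≤W
... | d , refl = trans (sumTo-split u d _)
  (trans (cong (cnt A u +_)
     (trans (sumTo-cong d λ i _ → cong 𝟙 (Supp-false {A = A} h (u + i) (m≤m+n u i)))
            (trans (sumTo-const d 0) (*-zeroʳ d))))
   (+-identityʳ _))

-- Defined by recursion so that positions below `s` are empty; `A (i ∸ s)` would copy `A 0` to all
-- of them.
shift : ℕ → Subset → Subset
shift zero    A i       = A i
shift (suc s) A zero    = false
shift (suc s) A (suc i) = shift s A i

shift-+ : ∀ s A i → shift s A (s + i) ≡ A i
shift-+ zero    A i = refl
shift-+ (suc s) A i = shift-+ s A i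

shift-< : ∀ s A i → i < s → shift s A i ≡ false
shift-< (suc s) A zero    _ = refl
shift-< (suc s) A (suc i) (s≤s p) = shift-< s A i p

shift-true : ∀ s A i → shift s A i ≡ true → ∃ λ j → i ≡ s + j × A j ≡ true
shift-true zero    A i p = i , refl , p
shift-true (suc s) A (suc i) p with shift-true s A i p
... | j , refl , q = j , refl , q

cnt-shift : ∀ s A n → cnt (shift s A) (s + n) ≡ cnt A n
cnt-shift s A n = trans (sumTo-split s n _)
  (cong₂ _+_ (trans (sumTo-cong s λ i i<s → cong 𝟙 (shift-< s A i i<s))
                    (trans (sumTo-const s 0) (*-zeroʳ s)))
             (sumTo-cong n λ i _ → cong 𝟙 (shift-+ s A i)))

cnt-shift-Supp : ∀ {u W} s A → Supp u A → s + u ≤ W → cnt (shift s A) W ≡ cnt A W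
cnt-shift-Supp {u} s A h le with m≤n⇒∃[o]m+o≡n le
... | d , refl = trans (cong (cnt (shift s A)) (+-assoc s u d))
  (trans (cnt-shift s A (u + d))
  (trans (cnt-Supp h (m≤m+n u d))
         (sym (cnt-Supp h (≤-trans (m≤n+m u s) (m≤m+n (s + u) d))))))

-- These are A ∪ (A + s), A ∩ (A - s) and A ∖ (A - s). In a wide enough window the first two have
-- sizes |A| + |lost| and |A| - |lost|.
spread kept lost : ℕ → Subset → Subset
spread s A i = A i ∨ shift s A i
kept s A i = A i ∧ A (i + s)
lost s A i = A i ∧ not (A (i + s))

∧-true : ∀ {a b} → a ∧ b ≡ true → a ≡ true × b ≡ true
∧-true {true} {true} _ = refl , refl

kept-Supp : ∀ {u} s {A} → Supp u A → Supp u (kept s A)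
kept-Supp s h i p = h i (proj₁ (∧-true p))

spread-Supp : ∀ {u} s {A} → Supp u A → Supp (u + s) (spread s A)
spread-Supp {u} s {A} h i p with A i in eq
... | true  = <-≤-trans (h i eq) (m≤m+n u s)
... | false with shift-true s A i p
...   | j , refl , q = subst (_< u + s) (+-comm j s) (+-monoˡ-< s (h j q))

kept+lost : ∀ s A n → cnt (kept s A) n + cnt (lost s A) n ≡ cnt A n
kept+lost s A n = trans (sym (sumTo-+ n _ _)) (sumTo-cong n λ i _ → go (A i) (A (i + s)))
  where
  go : ∀ a b → 𝟙 (a ∧ b) + 𝟙 (a ∧ not b) ≡ 𝟙 a
  go true  true  = refl
  go true  false = refl
  go false b     = refl

-- Inclusion-exclusion for A and A + s, whose intersection is `kept s A` translated by s.
spread+kept : ∀ {u W} s A → Supp u A → u + s ≤ W →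
  cnt (spread s A) W + cnt (kept s A) W ≡ cnt A W + cnt A W
spread+kept {u} {W} s A h le = begin
  cnt (spread s A) W + cnt (kept s A) W
    ≡⟨ cong (cnt (spread s A) W +_) (sym (cnt-shift-Supp s (kept s A) (kept-Supp s h) le')) ⟩
  cnt (spread s A) W + cnt (shift s (kept s A)) W
    ≡⟨ cong (cnt (spread s A) W +_) (sumTo-cong W λ i _ → cong 𝟙 (meet i)) ⟩
  cnt (spread s A) W + cnt (λ i → A i ∧ shift s A i) W
    ≡⟨ sumTo-+ W _ _ ⟨
  sumTo W (λ i → 𝟙 (A i ∨ shift s A i) + 𝟙 (A i ∧ shift s A i))
    ≡⟨ sumTo-cong W (λ i _ → modular (A i) (shift s A i)) ⟩
  sumTo W (λ i → 𝟙 (A i) + 𝟙 (shift s A i))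
    ≡⟨ sumTo-+ W _ _ ⟩
  cnt A W + cnt (shift s A) W
    ≡⟨ cong (cnt A W +_) (cnt-shift-Supp s A h le') ⟩
  cnt A W + cnt A W ∎
  where
  open ≡-Reasoning
  le' : s + u ≤ W
  le' = subst (_≤ W) (+-comm u s) le
  modular : ∀ a b → 𝟙 (a ∨ b) + 𝟙 (a ∧ b) ≡ 𝟙 a + 𝟙 b
  modular true  true  = refl
  modular true  false = refl
  modular false b     = +-identityʳ _
  meet : ∀ i → shift s (kept s A) i ≡ A i ∧ shift s A i
  meet i with i <? s
  ... | yes i<s rewrite shift-< s (kept s A) i i<s | shift-< s A i i<s = sym (∧-zeroʳ (A i))
  ... | no  i≮s with m≤n⇒∃[o]m+o≡n (≮⇒≥ i≮s)
  ...   | j , refl rewrite shift-+ s (kept s A) j | shift-+ s A j | +-comm j s = ∧-comm (A j) (A (s + j))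

-- If i is in A and i + s + s' is not, then either A is left already at i + s, or i + s belongs to A
-- and is lost under s'. The second kind is counted at its intermediate position.
lost-+ : ∀ {u W} s s' A → Supp u A → u + s ≤ W →
  cnt (lost (s + s') A) W ≤ cnt (lost s A) W + cnt (lost s' A) W
lost-+ {u} {W} s s' A h le with m≤n⇒∃[o]m+o≡n le
... | d , refl = begin
  cnt (lost (s + s') A) W'
    ≤⟨ sumTo-mono W' (λ i _ → subst (λ z → 𝟙 (A i ∧ not (A z)) ≤ 𝟙 (lost s A i) + 𝟙 (lost s' A (s + i)))
         (reassoc i s s') (go (A i) (A (i + s)) (A (s + i)) (A (s + i + s')) (cong A (+-comm i s)))) ⟩
  sumTo W' (λ i → 𝟙 (lost s A i) + 𝟙 (lost s' A (s + i)))
    ≡⟨ sumTo-+ W' _ _ ⟩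
  cnt (lost s A) W' + sumTo W' (λ i → 𝟙 (lost s' A (s + i)))
    ≤⟨ +-monoʳ-≤ (cnt (lost s A) W') (m≤n+m _ (cnt (lost s' A) s)) ⟩
  cnt (lost s A) W' + (cnt (lost s' A) s + sumTo W' (λ i → 𝟙 (lost s' A (s + i))))
    ≡⟨ cong (cnt (lost s A) W' +_) (sumTo-split s W' _) ⟨
  cnt (lost s A) W' + cnt (lost s' A) (s + W')
    ≡⟨ cong (cnt (lost s A) W' +_)
         (trans (cnt-Supp lost-Supp (≤-trans (≤-trans (m≤m+n u s) (m≤m+n (u + s) d)) (m≤n+m W' s)))
                (sym (cnt-Supp lost-Supp (≤-trans (m≤m+n u s) (m≤m+n (u + s) d))))) ⟩
  cnt (lost s A) W' + cnt (lost s' A) W' ∎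
  where
  open ≤-Reasoning
  W' = u + s + d
  lost-Supp : Supp u (lost s' A)
  lost-Supp i p = h i (proj₁ (∧-true p))
  reassoc : ∀ i s s' → s + i + s' ≡ i + (s + s')
  reassoc = solve-∀
  go : ∀ a b b' c → b ≡ b' → 𝟙 (a ∧ not c) ≤ 𝟙 (a ∧ not b) + 𝟙 (b' ∧ not c)
  go true  true  _ true  refl = z≤n
  go true  true  _ false refl = ≤-refl
  go true  false _ true  refl = z≤n
  go true  false _ false refl = ≤-refl
  go false b     _ c     refl = z≤n

infixl 6 _⊕_

⟦_⟧ : Subset → ℕ → Set
⟦ A ⟧ x = A x ≡ true

_⊕_ : (ℕ → Set) → Subset → ℕ → Set
(P ⊕ X) x = ∃ λ y → ∃ λ z → P y × X z ≡ true × y + z ≡ x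

⊕-mono : ∀ {P Q : ℕ → Set} {X} c → (∀ x → P x → Q (x + c)) → ∀ x → (P ⊕ X) x → (Q ⊕ X) (x + c)
⊕-mono c h _ (y , z , p , q , refl) = y + c , z , h y p , q , rearrange y c z
  where
  rearrange : ∀ y c z → y + c + z ≡ y + z + c
  rearrange = solve-∀

⊕-swap : ∀ {A B} x → (⟦ A ⟧ ⊕ B) x → (⟦ B ⟧ ⊕ A) x
⊕-swap x (y , z , p , q , eq) = z , y , q , p , trans (+-comm z y) eq

-- A summand a + s from the spread part hands its s over to the other summand: b + s is in B because
-- b was kept.
spread⊕kept : ∀ s {A B} x → (⟦ spread s A ⟧ ⊕ kept s B) x → (⟦ A ⟧ ⊕ B) x
spread⊕kept s {A} {B} x (y , z , p , q , eq) with A y in Ay | ∧-true {B z} q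
... | true  | Bz , _ = y , z , Ay , Bz , eq
... | false | _ , Bz+s with shift-true s A y p
...   | j , refl , Aj = j , z + s , Aj , Bz+s , trans (rearrange j z s) eq
  where
  rearrange : ∀ j z s → j + (z + s) ≡ s + j + z
  rearrange = solve-∀

Sums : (ℕ → Set) → List Subset → ℕ → Set
Sums P []       = P
Sums P (X ∷ Xs) = Sums (P ⊕ X) Xs

Sums-mono : ∀ Xs {P Q : ℕ → Set} c → (∀ x → P x → Q (x + c)) → ∀ x → Sums P Xs x → Sums Q Xs (x + c)
Sums-mono []       c h = h
Sums-mono (X ∷ Xs) c h = Sums-mono Xs c (⊕-mono {X = X} c h)

Sums-++ : ∀ Xs Ys {P : ℕ → Set} x → Sums P (Xs ++ Ys) x → Sums (Sums P Xs) Ys x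
Sums-++ []       Ys x p = p
Sums-++ (X ∷ Xs) Ys x p = Sums-++ Xs Ys x p

Sums-shift : ∀ {W} Xs → All (λ X → 1 ≤ cnt X W) Xs →
  ∃ λ c → ∀ {P : ℕ → Set} x → P x → Sums P Xs (x + c)
Sums-shift [] [] = 0 , λ {P} x p → subst P (sym (+-identityʳ x)) p
Sums-shift {W} (X ∷ Xs) (1≤X ∷ 1≤Xs) with cnt-member W 1≤X | Sums-shift {W} Xs 1≤Xs
... | z , _ , Xz | c , into = z + c , λ {P} x p →
  subst (Sums (P ⊕ X) Xs) (+-assoc x z c) (into {P ⊕ X} (x + z) (x , z , p , Xz , refl))

Sums-bound : ∀ {u} Xs → All (Supp u) Xs → ∀ {P : ℕ → Set} b → (∀ y → P y → y < b) →
  ∀ x → Sums P Xs x → x < b + length Xs * u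
Sums-bound [] [] b h x p = <-≤-trans (h x p) (m≤m+n b 0)
Sums-bound {u} (X ∷ Xs) (hX ∷ hXs) {P} b h x p =
  <-≤-trans (Sums-bound Xs hXs (b + u) bounded x p) (≤-reflexive (+-assoc b u _))
  where
  bounded : ∀ y → (P ⊕ X) y → y < b + u
  bounded _ (y , z , py , Xz , refl) = +-mono-< (h y py) (hX z Xz)

-- No two elements of B are closer than R, so B, B + 1, ..., B + (R - 1) are pairwise disjoint in an
-- interval of length W + R.
separated : ∀ {u W} R B → Supp u B → u ≤ W →
  (∀ s → 1 ≤ s → s < R → cnt (kept s B) W ≡ 0) → R * cnt B W ≤ W + R
separated {u} {W} R B h u≤W none = begin
  R * cnt B W
    ≡⟨ sumTo-const R (cnt B W) ⟨
  sumTo R (λ _ → cnt B W)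
    ≡⟨ sumTo-cong R (λ s s<R → sym (sizes s s<R)) ⟩
  sumTo R (λ s → cnt (shift s B) (W + R))
    ≡⟨ sumTo-swap R (W + R) _ ⟩
  sumTo (W + R) (λ i → sumTo R (λ s → 𝟙 (shift s B i)))
    ≤⟨ sumTo-≤const (W + R) 1 (λ i _ → atMostOne i R ≤-refl) ⟩
  (W + R) * 1
    ≡⟨ *-identityʳ _ ⟩
  W + R ∎
  where
  open ≤-Reasoning
  sizes : ∀ s → s < R → cnt (shift s B) (W + R) ≡ cnt B W
  sizes s s<R = trans (cnt-shift-Supp s B h (subst (_≤ W + R) (+-comm u s) (+-mono-≤ u≤W (<⇒≤ s<R))))
    (trans (cnt-Supp h (≤-trans u≤W (m≤m+n W R))) (sym (cnt-Supp h u≤W)))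
  clash : ∀ i s s' → s < s' → s' < R → shift s B i ≡ true → shift s' B i ≡ true → ⊥
  clash i s s' s<s' s'<R p p' with shift-true s B i p | shift-true s' B i p' | m≤n⇒∃[o]m+o≡n s<s'
  ... | j , refl , q | j' , eq , q' | d , refl
    with +-cancelˡ-≡ s j (suc d + j') (trans eq (trans (cong (_+ j') (sym (+-suc s d))) (+-assoc s (suc d) j')))
  ... | refl = <⇒≢ (member-cnt W j' (<-≤-trans (h j' q') u≤W)
                      (subst (λ b → b ∧ B (j' + suc d) ≡ true) (sym q')
                        (subst (λ z → B z ≡ true) (+-comm (suc d) j') q)))
                 (sym (none (suc d) (s≤s z≤n) (≤-<-trans (subst (_≤ suc s + d) refl (s≤s (m≤n+m d s))) s'<R)))
  zeros : ∀ i n → (∀ s → s < n → shift s B i ≡ true → ⊥) → sumTo n (λ s → 𝟙 (shift s B i)) ≡ 0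
  zeros i n none' = trans (sumTo-cong n λ s s<n → cong 𝟙 (false? s s<n)) (trans (sumTo-const n 0) (*-zeroʳ n))
    where
    false? : ∀ s → s < n → shift s B i ≡ false
    false? s s<n with shift s B i in eq
    ... | false = refl
    ... | true  = ⊥-elim (none' s s<n eq)
  atMostOne : ∀ i n → n ≤ R → sumTo n (λ s → 𝟙 (shift s B i)) ≤ 1
  atMostOne i zero    _ = z≤n
  atMostOne i (suc n) n<R with shift n B i in eq
  ... | false rewrite +-identityʳ (sumTo n (λ s → 𝟙 (shift s B i))) = atMostOne i n (<⇒≤ n<R)
  ... | true rewrite zeros i n (λ s s<n p → clash i s n s<n n<R p eq) = ≤-refl

-- The dichotomy for sums of two and of several sets

module Pair (W L v H R J : ℕ) (1≤v : 1 ≤ v) (2≤H : 2 ≤ H) (1≤J : 1 ≤ J)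
            (gap : W + R < R * (H * v)) where

  size : Subset → ℕ
  size A = cnt A W

  -- The squares provide the convexity that drives the process. The weight `L`, large compared with
  -- `W`, makes the linear term dominate, so that a bound on Φ at the end is a bound on the original
  -- a + b.
  Φ : ℕ → ℕ → ℕ
  Φ a b = L * (a + b) + (a * a + b * b)

  MostlyAP : (ℕ → Set) → Set
  MostlyAP P = ∃ λ t → ∃ λ c → ∃ λ h → 1 ≤ t × t < R ×
    (∀ j → h j ≡ true → P (c + t * j)) × H * J ≤ H * cnt h J + J

  Φ-sym : ∀ a b → Φ a b ≡ Φ b a
  Φ-sym a b = cong₂ _+_ (cong (L *_) (+-comm a b)) (+-comm (a * a) (b * b))

  -- With a = f + g and b = f' + g', the two moves lead to (a + g, b - g') and (a - g, b + g'). The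
  -- linear changes cancel in the sum, and the parallelogram law leaves 2g² + 2g'².
  Φ-parallelogram : ∀ L f g f' g' →
    (L * ((f + (g + g)) + f') + ((f + (g + g)) * (f + (g + g)) + f' * f')) +
    (L * (f + (f' + (g' + g'))) + (f * f + (f' + (g' + g')) * (f' + (g' + g'))))
    ≡ ((L * ((f + g) + (f' + g')) + ((f + g) * (f + g) + (f' + g') * (f' + g'))) + g' * g')
    + ((L * ((f + g) + (f' + g')) + ((f + g) * (f + g) + (f' + g') * (f' + g'))) + g' * g') + (g * g + g * g)
  Φ-parallelogram = solve-∀

  Φ-gain : ∀ f g f' g' → v ≤ g' →
    Φ (f + g) (f' + g') + v * v ≤ Φ (f + (g + g)) f' ⊎
    Φ (f + g) (f' + g') + v * v ≤ Φ f (f' + (g' + g'))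
  Φ-gain f g f' g' v≤g' with (Φ (f + g) (f' + g') + v * v) ≤? Φ (f + (g + g)) f'
  ... | yes p = inj₁ p
  ... | no ¬p = inj₂ (+-cancelˡ-≤ Z _ _ (begin
      Z + Z
        ≤⟨ +-mono-≤ (+-monoʳ-≤ Φ₀ (*-mono-≤ v≤g' v≤g')) (+-monoʳ-≤ Φ₀ (*-mono-≤ v≤g' v≤g')) ⟩
      (Φ₀ + g' * g') + (Φ₀ + g' * g')
        ≤⟨ m≤m+n _ _ ⟩
      (Φ₀ + g' * g') + (Φ₀ + g' * g') + (g * g + g * g)
        ≡⟨ Φ-parallelogram L f g f' g' ⟨
      Φ (f + (g + g)) f' + Φ f (f' + (g' + g'))
        ≤⟨ +-monoˡ-≤ _ (<⇒≤ (≰⇒> ¬p)) ⟩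
      Z + Φ f (f' + (g' + g')) ∎))
    where
    open ≤-Reasoning
    Φ₀ = Φ (f + g) (f' + g')
    Z = Φ₀ + v * v

  -- The case of empty `kept s A`: shrinking A would empty the sumset, so only the move that
  -- enlarges A remains. It doubles A, which outweighs any loss in B because b ≤ a; the pair is kept
  -- ordered for this purpose.
  Φ-gain₀ : ∀ a f' g' → v ≤ g' → f' + g' ≤ a → Φ a (f' + g') + v * v ≤ Φ (a + a) f'
  Φ-gain₀ a f' g' v≤g' b≤a = begin
    L * (a + b) + (a * a + b * b) + v * v
      ≤⟨ +-mono-≤ (+-mono-≤ (*-monoʳ-≤ L (+-monoʳ-≤ a b≤a)) (+-monoʳ-≤ (a * a) (*-mono-≤ b≤a b≤a))) (*-mono-≤ v≤a v≤a) ⟩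
    L * (a + a) + (a * a + a * a) + a * a
      ≤⟨ m≤m+n _ (L * f' + (a * a + f' * f')) ⟩
    L * (a + a) + (a * a + a * a) + a * a + (L * f' + (a * a + f' * f'))
      ≡⟨ rearrange L a f' ⟩
    Φ (a + a) f' ∎
    where
    open ≤-Reasoning
    b = f' + g'
    v≤a = ≤-trans v≤g' (≤-trans (m≤n+m g' f') b≤a)
    rearrange : ∀ L a f' → L * (a + a) + (a * a + a * a) + a * a + (L * f' + (a * a + f' * f'))
      ≡ L * (a + a + f') + ((a + a) * (a + a) + f' * f')
    rearrange = solve-∀

  spread-size : ∀ {u} s A → Supp u A → u + s ≤ W →
    size (spread s A) ≡ size (kept s A) + (size (lost s A) + size (lost s A))
  spread-size s A h le = +-cancelʳ-≡ (size (kept s A)) _ _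
    (trans (spread+kept s A h le) (trans (cong₂ _+_ (sym (kept+lost s A W)) (sym (kept+lost s A W)))
      (rearrange (size (kept s A)) (size (lost s A)))))
    where
    rearrange : ∀ f g → (f + g) + (f + g) ≡ f + (g + g) + f
    rearrange = solve-∀

  -- If every s for which B meets B − s satisfies |B ∖ (B − s)| < v, then these s are closed under
  -- addition, so all multiples of one of them nearly fix B.
  stuck : ∀ {u} B → Supp u B → u + J * R ≤ W → H * v ≤ size B →
    (∀ s → s < suc (J * R) → ¬ (1 ≤ s × 1 ≤ size (kept s B) × v ≤ size (lost s B))) →
    MostlyAP ⟦ B ⟧
  stuck {u} B h le big none = t , c + t , hits , 1≤t , t<R , hits-B , few
    where
    open ≤-Reasoning
    u≤W : u ≤ W
    u≤W = ≤-trans (m≤m+n u _) le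
    period : ∃ λ t → t < R × (1 ≤ t × 1 ≤ size (kept t B))
    -- If B met none of its translates by 1 ≤ s < R, `separated` would give R |B| ≤ W + R, which
    -- `gap` excludes for |B| ≥ H v.
    period with bounded-search R {λ s → 1 ≤ s × 1 ≤ size (kept s B)}
                  (λ s → (1 ≤? s) ×-dec (1 ≤? size (kept s B)))
    ... | inj₁ p = p
    ... | inj₂ q = ⊥-elim (<⇒≱ gap (≤-trans (*-monoʳ-≤ R big)
            (separated R B h u≤W λ s 1≤s s<R → n<1⇒n≡0 (≰⇒> λ p → q s s<R (1≤s , p)))))
    t = proj₁ period
    t<R = proj₁ (proj₂ period)
    1≤t = proj₁ (proj₂ (proj₂ period))
    tight : ∀ s → s ≤ J * R → 1 ≤ s → 1 ≤ size (kept s B) → size (lost s B) < v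
    tight s s≤ 1≤s p = ≰⇒> λ q → none s (s≤s s≤) (1≤s , p , q)
    inRange : ∀ j → j < J → suc j * t ≤ J * R
    inRange j j<J = *-mono-≤ j<J (<⇒≤ t<R)
    multiples : ∀ j → j < J → size (lost (suc j * t) B) < v
    multiples zero    j<J = subst (λ z → size (lost z B) < v) (sym (+-identityʳ t))
      (tight t (subst (_≤ J * R) (+-identityʳ t) (inRange 0 j<J)) 1≤t (proj₂ (proj₂ (proj₂ period))))
    -- Two losses below v add up to less than 2v ≤ H v ≤ |B|, so B still meets this translate, and
    -- `none` brings the loss back below v.
    multiples (suc j) j<J = tight (t + suc j * t) (inRange (suc j) j<J)
      (≤-trans 1≤t (m≤m+n t _)) (n≢0⇒n>0 λ z → <⇒≱ small (begin
        H * v ≤⟨ big ⟩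
        size B ≡⟨ kept+lost (t + suc j * t) B W ⟨
        size (kept (t + suc j * t) B) + size (lost (t + suc j * t) B) ≡⟨ cong (_+ size (lost (t + suc j * t) B)) z ⟩
        size (lost (t + suc j * t) B) ∎))
      where
      small : size (lost (t + suc j * t) B) < H * v
      small = begin-strict
        size (lost (t + suc j * t) B) ≤⟨ lost-+ t (suc j * t) B h (≤-trans (+-monoʳ-≤ u (≤-trans (m≤m+n t _) (inRange (suc j) j<J))) le) ⟩
        size (lost t B) + size (lost (suc j * t) B)
          <⟨ +-mono-<-≤ (subst (λ z → size (lost z B) < v) (+-identityʳ t) (multiples 0 1≤J))
                        (<⇒≤ (multiples j (<⇒≤ j<J))) ⟩
        v + v ≡⟨ cong (v +_) (sym (+-identityʳ v)) ⟩
        2 * v ≤⟨ *-monoˡ-≤ v 2≤H ⟩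
        H * v ∎
    miss : ℕ → ℕ
    miss i = sumTo J (λ j → 𝟙 (B i ∧ not (B (i + suc j * t))))
    total : sumTo W miss ≤ J * v
    total = begin
      sumTo W miss ≡⟨ sumTo-swap W J _ ⟩
      sumTo J (λ j → size (lost (suc j * t) B)) ≤⟨ sumTo-≤const J v (λ j j<J → <⇒≤ (multiples j j<J)) ⟩
      J * v ∎
    seed : ∃ λ i → i < W × H * miss i < suc J * 𝟙 (B i)
    -- The factor J + 1 instead of J makes the averaging strict. Strictness forces c ∈ B and still
    -- leaves H · miss c ≤ J.
    seed = sumTo-pigeon W (begin-strict
      sumTo W (λ i → H * miss i) ≡⟨ sumTo-*ˡ W H miss ⟩
      H * sumTo W miss ≤⟨ *-monoʳ-≤ H total ⟩
      H * (J * v) ≡⟨ rearrange H J v ⟩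
      J * (H * v) <⟨ m<n+m (J * (H * v)) (*-mono-≤ (≤-trans (s≤s z≤n) 2≤H) 1≤v) ⟩
      suc J * (H * v) ≤⟨ *-monoʳ-≤ (suc J) big ⟩
      suc J * size B ≡⟨ sumTo-*ˡ W (suc J) _ ⟨
      sumTo W (λ i → suc J * 𝟙 (B i)) ∎)
      where
      rearrange : ∀ H J v → H * (J * v) ≡ J * (H * v)
      rearrange = solve-∀
    c = proj₁ seed
    Bc : B c ≡ true
    Bc = positive (B c) (proj₂ (proj₂ seed))
      where
      positive : ∀ b {m} → m < suc J * 𝟙 b → b ≡ true
      positive true  _ = refl
      positive false {m} p = ⊥-elim (n≮0 (subst (m <_) (*-zeroʳ (suc J)) p))
    hits : Subset
    hits j = B (c + suc j * t)
    hits-B : ∀ j → hits j ≡ true → B (c + t + t * j) ≡ true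
    hits-B j = subst (λ z → B z ≡ true) (rearrange c j t)
      where
      rearrange : ∀ c j t → c + (t + j * t) ≡ c + t + t * j
      rearrange = solve-∀
    few : H * J ≤ H * cnt hits J + J
    few = begin
      H * J ≡⟨ cong (H *_) (trans (sym (*-identityʳ J)) (sym (sumTo-const J 1))) ⟩
      H * sumTo J (λ _ → 1) ≡⟨ cong (H *_) (sumTo-cong J (λ j _ → sym (split (B c) (hits j) Bc))) ⟩
      H * sumTo J (λ j → 𝟙 (hits j) + 𝟙 (B c ∧ not (hits j))) ≡⟨ cong (H *_) (sumTo-+ J _ _) ⟩
      H * (cnt hits J + miss c) ≡⟨ *-distribˡ-+ H _ _ ⟩
      H * cnt hits J + H * miss c ≤⟨ +-monoʳ-≤ (H * cnt hits J) (s≤s⁻¹ (≤-trans (proj₂ (proj₂ seed)) lem)) ⟩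
      H * cnt hits J + J ∎
      where
      lem : suc J * 𝟙 (B c) ≤ suc J
      lem = ≤-trans (*-monoʳ-≤ (suc J) (𝟙≤1 (B c))) (≤-reflexive (*-identityʳ (suc J)))
      split : ∀ a b → a ≡ true → 𝟙 b + 𝟙 (a ∧ not b) ≡ 1
      split _ true  refl = refl
      split _ false refl = refl

  -- The outcome in which the smaller set has fallen below H v: D is the larger one, and the
  -- inequality is what Φ then says about its size.
  Dense : (ℕ → Set) → ℕ → ℕ → Set
  Dense P Φ₀ U = ∃ λ D → ∃ λ c → Supp U D × 1 ≤ size D × (∀ i → D i ≡ true → P (i + c)) ×
    Φ₀ ≤ L * (size D + H * v) + (W * W + W * W)

  module _ (P : ℕ → Set) (Φ₀ U : ℕ) (U≤W : U ≤ W) where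

    -- Recursion on the number n of moves left. Each move raises Φ by at least v², and n moves would
    -- lift it above its maximum for sets of size at most `W`, so the process stops in time. Each
    -- move widens the supports by at most J R, which is budgeted in `U`.
    improve : ∀ n A B {u} → Supp u A → Supp u B → u + n * (J * R) ≤ U →
      1 ≤ size A → 1 ≤ size B → (∀ x → (⟦ A ⟧ ⊕ B) x → P x) →
      Φ₀ ≤ Φ (size A) (size B) →
      L * (W + W) + (W * W + W * W) < Φ (size A) (size B) + n * (v * v) →
      Dense P Φ₀ U ⊎ MostlyAP P

    improve-ordered : ∀ n A B {u} → Supp u A → Supp u B → u + n * (J * R) ≤ U →
      1 ≤ size A → 1 ≤ size B → (∀ x → (⟦ A ⟧ ⊕ B) x → P x) →
      Φ₀ ≤ Φ (size A) (size B) →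
      L * (W + W) + (W * W + W * W) < Φ (size A) (size B) + n * (v * v) →
      size B ≤ size A → Dense P Φ₀ U ⊎ MostlyAP P

    improve n A B hA hB le 1≤A 1≤B incl Φ≤ fuel with ≤-total (size B) (size A)
    ... | inj₁ b≤a = improve-ordered n A B hA hB le 1≤A 1≤B incl Φ≤ fuel b≤a
    ... | inj₂ a≤b = improve-ordered n B A hB hA le 1≤B 1≤A (λ x → incl x ∘ ⊕-swap x)
          (subst (Φ₀ ≤_) (Φ-sym (size A) (size B)) Φ≤)
          (subst (λ z → L * (W + W) + (W * W + W * W) < z + n * (v * v)) (Φ-sym (size A) (size B)) fuel) a≤b

    improve-ordered zero A B _ _ _ _ _ _ _ fuel _ = ⊥-elim (<⇒≱ fuel
      (≤-trans (≤-reflexive (+-identityʳ _))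
        (+-mono-≤ (*-monoʳ-≤ L (+-mono-≤ (cnt≤ A W) (cnt≤ B W)))
                  (+-mono-≤ (*-mono-≤ (cnt≤ A W) (cnt≤ A W)) (*-mono-≤ (cnt≤ B W) (cnt≤ B W))))))
    improve-ordered (suc n) A B {u} hA hB le 1≤A 1≤B incl Φ≤ fuel b≤a with H * v ≤? size B
    ... | no small = inj₁ (A , b , Supp-mono (≤-trans (m≤m+n u _) le) hA , 1≤A
            , (λ i Ai → incl (i + b) (i , b , Ai , Bb , refl))
            , ≤-trans Φ≤ (+-mono-≤ (*-monoʳ-≤ L (+-monoʳ-≤ (size A) (<⇒≤ (≰⇒> small))))
                (+-mono-≤ (*-mono-≤ (cnt≤ A W) (cnt≤ A W)) (*-mono-≤ (cnt≤ B W) (cnt≤ B W)))))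
      where
      bMem = cnt-member W 1≤B
      b = proj₁ bMem
      Bb = proj₂ (proj₂ bMem)
    ... | yes big with bounded-search (suc (J * R)) {λ s → 1 ≤ s × 1 ≤ size (kept s B) × v ≤ size (lost s B)}
                        (λ s → (1 ≤? s) ×-dec ((1 ≤? size (kept s B)) ×-dec (v ≤? size (lost s B))))
    ...   | inj₂ none = inj₂ (translate (stuck B hB (≤-trans (+-monoʳ-≤ u (m≤m+n (J * R) _)) (≤-trans le U≤W)) big none))
      where
      aMem = cnt-member W 1≤A
      a = proj₁ aMem
      translate : MostlyAP ⟦ B ⟧ → MostlyAP P
      translate (t , c , h , p , q , hit , few) = t , a + c , h , p , q
        , (λ j hj → incl _ (a , c + t * j , proj₂ (proj₂ aMem) , hit j hj , sym (+-assoc a c (t * j)))) , few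
    ...   | inj₁ (s , s<C , 1≤s , 1≤fB , v≤gB) = choose (1 ≤? size (kept s A))
      where
      s≤C : s ≤ J * R
      s≤C = s≤s⁻¹ s<C
      u+s≤W : u + s ≤ W
      u+s≤W = ≤-trans (+-monoʳ-≤ u (≤-trans s≤C (m≤m+n (J * R) _))) (≤-trans le U≤W)
      le' : u + s + n * (J * R) ≤ U
      le' = ≤-trans (≤-reflexive (+-assoc u s _)) (≤-trans (+-monoʳ-≤ u (+-monoˡ-≤ _ s≤C)) le)
      u≤u+s = m≤m+n u s
      Φ' : ∀ {x} → Φ (size A) (size B) + v * v ≤ x → Φ₀ ≤ x
      Φ' p = ≤-trans Φ≤ (≤-trans (m≤m+n _ _) p)
      fuel' : ∀ {x} → Φ (size A) (size B) + v * v ≤ x → L * (W + W) + (W * W + W * W) < x + n * (v * v)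
      fuel' p = <-≤-trans fuel (≤-trans (≤-reflexive (sym (+-assoc (Φ (size A) (size B)) (v * v) _))) (+-monoˡ-≤ _ p))
      spread≥ : ∀ X → 1 ≤ size X → 1 ≤ size (spread s X)
      spread≥ X 1≤X = ≤-trans 1≤X (cnt-mono W {X} {spread s X} λ i _ p → cong (_∨ shift s X i) p)
      eqA = kept+lost s A W
      eqB = kept+lost s B W
      grow-A : Φ (size A) (size B) + v * v ≤ Φ (size (spread s A)) (size (kept s B)) → Dense P Φ₀ U ⊎ MostlyAP P
      grow-A p = improve n (spread s A) (kept s B) (spread-Supp s hA) (Supp-mono u≤u+s (kept-Supp s hB)) le'
        (spread≥ A 1≤A) 1≤fB (λ x → incl x ∘ spread⊕kept s {A} {B} x) (Φ' p) (fuel' p)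
      grow-B : 1 ≤ size (kept s A) → Φ (size A) (size B) + v * v ≤ Φ (size (kept s A)) (size (spread s B)) →
        Dense P Φ₀ U ⊎ MostlyAP P
      grow-B 1≤fA p = improve n (kept s A) (spread s B) (Supp-mono u≤u+s (kept-Supp s hA)) (spread-Supp s hB) le'
        1≤fA (spread≥ B 1≤B) (λ x q → incl x (⊕-swap {B} {A} x (spread⊕kept s {B} {A} x (⊕-swap {kept s A} {spread s B} x q)))) (Φ' p) (fuel' p)
      choose : Dec (1 ≤ size (kept s A)) → Dense P Φ₀ U ⊎ MostlyAP P
      choose (yes 1≤fA) with Φ-gain (size (kept s A)) (size (lost s A)) (size (kept s B)) (size (lost s B)) v≤gB
      ... | inj₁ p = grow-A (subst₂ (λ x y → x + v * v ≤ y) (cong₂ Φ eqA eqB)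
                       (cong (λ z → Φ z (size (kept s B))) (sym (spread-size s A hA u+s≤W))) p)
      ... | inj₂ p = grow-B 1≤fA (subst₂ (λ x y → x + v * v ≤ y) (cong₂ Φ eqA eqB)
                       (cong (Φ (size (kept s A))) (sym (spread-size s B hB u+s≤W))) p)
      choose (no fA<1) = grow-A (subst₂ (λ x y → x + v * v ≤ y) (cong (Φ (size A)) eqB)
          (cong (λ z → Φ z (size (kept s B))) (sym double))
          (Φ-gain₀ (size A) (size (kept s B)) (size (lost s B)) v≤gB (subst (_≤ size A) (sym eqB) b≤a)))
        where
        fA≡0 : size (kept s A) ≡ 0
        fA≡0 = n<1⇒n≡0 (≰⇒> fA<1)
        double : size (spread s A) ≡ size A + size A
        double = trans (sym (trans (cong (size (spread s A) +_) fA≡0) (+-identityʳ _))) (spread+kept s A hA u+s≤W)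

  module _ (S loss : ℕ) (1≤L : 1 ≤ L)
           (fuel : L * (W + W) + (W * W + W * W) < S * (v * v))
           (absorb : W * W + W * W ≤ L * loss) where

    -- The final bound on Φ divided by `L`: the small set costs H v, and the squares, at most 2W²,
    -- cost `loss`.
    pair-growth : ∀ A B {u} → Supp u A → Supp u B → u + S * (J * R) ≤ W → 1 ≤ size A → 1 ≤ size B →
      (∃ λ D → ∃ λ c → Supp (u + S * (J * R)) D × 1 ≤ size D ×
         (∀ i → D i ≡ true → (⟦ A ⟧ ⊕ B) (i + c)) ×
         size A + size B ≤ size D + (H * v + loss))
      ⊎ MostlyAP (⟦ A ⟧ ⊕ B)
    pair-growth A B {u} hA hB le 1≤A 1≤B
      with improve (⟦ A ⟧ ⊕ B) (Φ (size A) (size B)) (u + S * (J * R)) le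
             S A B hA hB ≤-refl 1≤A 1≤B (λ _ p → p) ≤-refl (<-≤-trans fuel (m≤n+m _ _))
    ... | inj₂ ap = inj₂ ap
    ... | inj₁ (D , c , hD , 1≤D , incl , Φ≤) = inj₁ (D , c , hD , 1≤D , incl
          , *-cancelˡ-≤ L {{>-nonZero 1≤L}} (begin
              L * (size A + size B) ≤⟨ m≤m+n _ _ ⟩
              Φ (size A) (size B) ≤⟨ Φ≤ ⟩
              L * (size D + H * v) + (W * W + W * W) ≤⟨ +-monoʳ-≤ (L * (size D + H * v)) absorb ⟩
              L * (size D + H * v) + L * loss ≡⟨ *-distribˡ-+ L (size D + H * v) loss ⟨
              L * (size D + H * v + loss) ≡⟨ cong (L *_) (+-assoc (size D) (H * v) loss) ⟩
              L * (size D + (H * v + loss)) ∎))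
      where open ≤-Reasoning

    totalSize : List Subset → ℕ
    totalSize []       = 0
    totalSize (X ∷ Xs) = size X + totalSize Xs

    -- The sets are added one at a time, each at a bounded loss. Once a partial sum contains most of
    -- a progression, so does the whole sum, because fixed elements of the remaining sets merely
    -- translate it.
    sumset-growth : ∀ Xs A {u} → Supp u A → All (Supp u) Xs → u + length Xs * (S * (J * R)) ≤ W →
      1 ≤ size A → All (λ X → 1 ≤ size X) Xs →
      (∃ λ D → ∃ λ c → Supp (u + length Xs * (S * (J * R))) D × 1 ≤ size D ×
         (∀ i → D i ≡ true → Sums ⟦ A ⟧ Xs (i + c)) ×
         size A + totalSize Xs ≤ size D + length Xs * (H * v + loss))
      ⊎ MostlyAP (Sums ⟦ A ⟧ Xs)
    sumset-growth [] A hA _ le 1≤A _ = inj₁ (A , 0 , Supp-mono (m≤m+n _ _) hA , 1≤A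
      , (λ i p → subst (λ z → A z ≡ true) (sym (+-identityʳ i)) p) , ≤-refl)
    sumset-growth (X ∷ Xs) A {u} hA (hX ∷ hXs) le 1≤A (1≤X ∷ 1≤Xs)
      with pair-growth A X hA hX (≤-trans (+-monoʳ-≤ u (m≤m+n _ _)) le) 1≤A 1≤X
    ... | inj₂ (t , c , h , p , q , hit , few) with Sums-shift {W} Xs 1≤Xs
    ...   | c' , into = inj₂ (t , c + c' , h , p , q
            , (λ j hj → subst (Sums (⟦ A ⟧ ⊕ X) Xs) (rearrange c t j c') (into (c + t * j) (hit j hj))) , few)
      where
      rearrange : ∀ c t j c' → c + t * j + c' ≡ c + c' + t * j
      rearrange = solve-∀
    sumset-growth (X ∷ Xs) A {u} hA (hX ∷ hXs) le 1≤A (1≤X ∷ 1≤Xs)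
        | inj₁ (D , c , hD , 1≤D , incl , bound)
      with sumset-growth Xs D hD (All.map (Supp-mono (m≤m+n u _)) hXs)
             (≤-trans (≤-reflexive (+-assoc u _ _)) le) 1≤D 1≤Xs
    ... | inj₂ (t , c' , h , p , q , hit , few) = inj₂ (t , c' + c , h , p , q
            , (λ j hj → subst (Sums (⟦ A ⟧ ⊕ X) Xs) (rearrange c' t j c) (Sums-mono Xs c incl _ (hit j hj))) , few)
      where
      rearrange : ∀ c t j c' → c + t * j + c' ≡ c + c' + t * j
      rearrange = solve-∀
    ... | inj₁ (D' , c' , hD' , 1≤D' , incl' , bound') = inj₁ (D' , c' + c
            , subst (λ z → Supp z D') (+-assoc u _ _) hD' , 1≤D'
            , (λ i p → subst (Sums (⟦ A ⟧ ⊕ X) Xs) (+-assoc i c' c) (Sums-mono Xs c incl _ (incl' i p)))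
            , (begin
               size A + (size X + totalSize Xs) ≡⟨ +-assoc (size A) (size X) _ ⟨
               size A + size X + totalSize Xs ≤⟨ +-monoˡ-≤ (totalSize Xs) bound ⟩
               size D + (H * v + loss) + totalSize Xs ≡⟨ swap₂ (size D) (H * v + loss) (totalSize Xs) ⟩
               size D + totalSize Xs + (H * v + loss) ≤⟨ +-monoˡ-≤ (H * v + loss) bound' ⟩
               size D' + length Xs * (H * v + loss) + (H * v + loss) ≡⟨ swap₃ (size D') (length Xs * (H * v + loss)) (H * v + loss) ⟩
               size D' + (H * v + loss + length Xs * (H * v + loss)) ∎))
      where
      open ≤-Reasoning
      swap₂ : ∀ a b c → a + b + c ≡ a + c + b
      swap₂ = solve-∀
      swap₃ : ∀ a b c → a + b + c ≡ a + (c + b)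
      swap₃ = solve-∀
 

-- The choice of scales

-- w is the length of a block, J that of a progression; P v = w / P bounds every loss in the
-- density count, and E bounds the growth of the window in one application of the sumset dichotomy.
record Scales (P J K : ℕ) : Set where
  field
    S R v L : ℕ
  w : ℕ
  w = P * (P * v)
  E : ℕ
  E = S * (J * R)
  W : ℕ
  W = w + K * E
  field
    v-def  : v ≡ P * (P * P * P * P * P) * J
    R-def  : R ≡ 4 * P
    1≤P    : 1 ≤ P
    2≤P    : 2 ≤ P
    2≤R    : 2 ≤ R
    1≤J    : 1 ≤ J
    1≤v    : 1 ≤ v
    1≤w    : 1 ≤ w
    1≤L    : 1 ≤ L
    KE≤Pv  : K * E ≤ P * v
    W≤2w   : W ≤ w + w
    RJ≤w   : R * J ≤ w
    6J≤Pv  : 6 * J ≤ P * v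
    room   : 4 * (2 + K) ≤ P
    gap    : W + R < R * (P * v)
    absorb : W * W + W * W ≤ L * (P * v)
    fuel   : L * (W + W) + (W * W + W * W) < S * (v * v)

module ScaleFacts (P J K : ℕ) (1≤J : 1 ≤ J) (K≤P : 164 * (2 + K) ≤ P) where
  open ≤-Reasoning

  abstract
    S R v L : ℕ
    -- With W ≤ 2w, Φ stays below 40 w² P, while S v² = 41 w² P. `R` makes R · P v = 4w, which
    -- exceeds W + R. `L` gives L · P v = 8w² ≥ 2W². `v` makes K E = 4 · 41 · K v, whence the
    -- requirement P ≥ 164 (2 + K).
    S = 41 * (P * P * P * P * P)
    R = 4 * P
    v = P * (P * P * P * P * P) * J
    L = 8 * (P * (P * v) * P)

    v-def : v ≡ P * (P * P * P * P * P) * J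
    v-def = refl

    R-def : R ≡ 4 * P
    R-def = refl

  w E W : ℕ
  w = P * (P * v)
  E = S * (J * R)
  W = w + K * E

  abstract
    328≤P : 328 ≤ P
    328≤P = ≤-trans (*-monoʳ-≤ 164 (m≤m+n 2 K)) K≤P

    1≤P : 1 ≤ P
    1≤P = ≤-trans (s≤s z≤n) 328≤P

    2≤P : 2 ≤ P
    2≤P = ≤-trans (s≤s (s≤s z≤n)) 328≤P

    1≤v : 1 ≤ v
    1≤v = *-mono-≤ (*-mono-≤ 1≤P (*-mono-≤ (*-mono-≤ (*-mono-≤ (*-mono-≤ 1≤P 1≤P) 1≤P) 1≤P) 1≤P)) 1≤J

    1≤w : 1 ≤ w
    1≤w = *-mono-≤ 1≤P (*-mono-≤ 1≤P 1≤v)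

    1≤L : 1 ≤ L
    1≤L = *-mono-≤ {1} {8} (s≤s z≤n) (*-mono-≤ 1≤w 1≤P)

    KE≤Pv : K * E ≤ P * v
    KE≤Pv = begin
      K * E ≡⟨ eq K P J ⟩
      164 * K * v ≤⟨ *-monoˡ-≤ v (≤-trans (*-monoʳ-≤ 164 (m≤n+m K 2)) K≤P) ⟩
      P * v ∎
      where
      eq : ∀ K P J → K * (41 * (P * P * P * P * P) * (J * (4 * P))) ≡ 164 * K * (P * (P * P * P * P * P) * J)
      eq = solve-∀

    Pv≤w : P * v ≤ w
    Pv≤w = ≤-trans (≤-reflexive (sym (+-identityʳ _))) (*-monoˡ-≤ (P * v) 1≤P)

    W≤2w : W ≤ w + w
    W≤2w = +-monoʳ-≤ w (≤-trans KE≤Pv Pv≤w)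

    gap : W + R < R * (P * v)
    gap = begin-strict
      W + R ≤⟨ +-monoˡ-≤ R W≤2w ⟩
      w + w + R <⟨ +-monoʳ-< (w + w) R<w ⟩
      w + w + w ≤⟨ m≤m+n _ w ⟩
      w + w + w + w ≡⟨ eq P v ⟩
      R * (P * v) ∎
      where
      R<w : R < w
      R<w = begin-strict
        4 * P <⟨ *-monoˡ-< P {{>-nonZero 1≤P}} (≤-trans (s≤s (s≤s (s≤s (s≤s (s≤s z≤n))))) 328≤P) ⟩
        P * P ≡⟨ cong (P *_) (sym (*-identityʳ P)) ⟩
        P * (P * 1) ≤⟨ *-monoʳ-≤ P (*-monoʳ-≤ P 1≤v) ⟩
        w ∎
      eq : ∀ P v → P * (P * v) + P * (P * v) + P * (P * v) + P * (P * v) ≡ 4 * P * (P * v)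
      eq = solve-∀

    squares : W * W + W * W ≤ 8 * (w * w)
    squares = begin
      W * W + W * W ≤⟨ +-mono-≤ (*-mono-≤ W≤2w W≤2w) (*-mono-≤ W≤2w W≤2w) ⟩
      (w + w) * (w + w) + (w + w) * (w + w) ≡⟨ eq w ⟩
      8 * (w * w) ∎
      where
      eq : ∀ w → (w + w) * (w + w) + (w + w) * (w + w) ≡ 8 * (w * w)
      eq = solve-∀

    absorb : W * W + W * W ≤ L * (P * v)
    absorb = ≤-trans squares (≤-reflexive (eq w P v))
      where
      eq : ∀ w P v → 8 * (w * (P * (P * v))) ≡ 8 * (w * P) * (P * v)
      eq = solve-∀

    fuel : L * (W + W) + (W * W + W * W) < S * (v * v)
    fuel = begin-strict
      L * (W + W) + (W * W + W * W)
        ≤⟨ +-mono-≤ (*-monoʳ-≤ L (+-mono-≤ W≤2w W≤2w)) squares ⟩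
      L * (w + w + (w + w)) + 8 * (w * w)
        ≤⟨ +-monoʳ-≤ (L * (w + w + (w + w))) (*-monoʳ-≤ 8 (≤-trans (≤-reflexive (sym (*-identityʳ (w * w)))) (*-monoʳ-≤ (w * w) 1≤P))) ⟩
      L * (w + w + (w + w)) + 8 * (w * w * P)
        ≡⟨ eq w P ⟩
      40 * (w * w * P)
        <⟨ m<n+m (40 * (w * w * P)) (*-mono-≤ (*-mono-≤ 1≤w 1≤w) 1≤P) ⟩
      w * w * P + 40 * (w * w * P)
        ≡⟨ eq' P v ⟩
      S * (v * v) ∎
      where
      eq : ∀ w P → 8 * (w * P) * (w + w + (w + w)) + 8 * (w * w * P) ≡ 40 * (w * w * P)
      eq = solve-∀
      eq' : ∀ P v → P * (P * v) * (P * (P * v)) * P + 40 * (P * (P * v) * (P * (P * v)) * P)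
        ≡ 41 * (P * P * P * P * P) * (v * v)
      eq' = solve-∀

    J≤v : J ≤ v
    J≤v = m≤n*m J (P * (P * P * P * P * P)) {{>-nonZero (*-mono-≤ 1≤P (*-mono-≤ (*-mono-≤ (*-mono-≤ (*-mono-≤ 1≤P 1≤P) 1≤P) 1≤P) 1≤P))}}

    6J≤Pv : 6 * J ≤ P * v
    6J≤Pv = *-mono-≤ (≤-trans (s≤s (s≤s (s≤s (s≤s (s≤s (s≤s z≤n)))))) 328≤P) J≤v

    RJ≤w : R * J ≤ w
    RJ≤w = begin
      4 * P * J ≤⟨ *-mono-≤ (*-monoˡ-≤ P (≤-trans (s≤s (s≤s (s≤s (s≤s z≤n)))) 328≤P)) J≤v ⟩
      P * P * v ≡⟨ *-assoc P P v ⟩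
      w ∎

    2≤R : 2 ≤ R
    2≤R = ≤-trans 2≤P (m≤n*m P 4)

    room : 4 * (2 + K) ≤ P
    room = ≤-trans (*-monoˡ-≤ (2 + K) {4} {164} (s≤s (s≤s (s≤s (s≤s z≤n))))) K≤P

scales : ∀ P J K → 1 ≤ J → 164 * (2 + K) ≤ P → Scales P J K
scales P J K 1≤J K≤P = record
  { S = S ; R = R ; v = v ; L = L ; v-def = v-def ; R-def = R-def ; 1≤P = 1≤P ; 2≤P = 2≤P ; 2≤R = 2≤R
  ; 1≤J = 1≤J ; 1≤v = 1≤v ; 1≤w = 1≤w ; 1≤L = 1≤L ; KE≤Pv = KE≤Pv ; W≤2w = W≤2w ; RJ≤w = RJ≤w
  ; 6J≤Pv = 6J≤Pv ; room = room ; gap = gap ; absorb = absorb ; fuel = fuel }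
  where open ScaleFacts P J K 1≤J K≤P

-- Blocks, cells and uniformity

sumTo-reverse : ∀ n (f : ℕ → ℕ) → sumTo n (λ i → f (n ∸ suc i)) ≡ sumTo n f
sumTo-reverse zero    f = refl
sumTo-reverse (suc n) f = trans (sumTo-split 1 n (λ i → f (suc n ∸ suc i)))
  (trans (cong (f n +_) (sumTo-reverse n f)) (+-comm (f n) _))

block-injective : ∀ {w j j'} β β' → j < w → j' < w → w * β + j ≡ w * β' + j' → β ≡ β'
block-injective {suc w'} {j} {j'} β β' j<w j'<w eq = *-cancelˡ-≡ β β' w (+-cancelʳ-≡ j _ _
    (trans eq (cong (w * β' +_) (sym j≡j'))))
  where
  w = suc w'
  residue : ∀ β j → j < w → (w * β + j) % w ≡ j
  residue β j j<w = trans (cong (_% w) (trans (+-comm (w * β) j) (cong (j +_) (*-comm w β))))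
    (trans ([m+kn]%n≡m%n j β w) (m<n⇒m%n≡m j<w))
  j≡j' : j ≡ j'
  j≡j' = trans (sym (residue β j j<w)) (trans (cong (_% w) eq) (residue β' j' j'<w))

SumFree : ℕ → ℕ → Subset → Set
SumFree k ℓ B = ∀ as bs →
  Unique as → All ⟦ B ⟧ as → length as ≡ k →
  Unique bs → All ⟦ B ⟧ bs → length bs ≡ ℓ → sum as ≢ sum bs

-- Indices start at 0, points at M, so that 0 is never a point.
point : ℕ → ℕ → ℕ → ℕ → ℕ
point M w β j = M * suc (w * β + j)

GoodBlock : Subset → (M w P ρ : ℕ) → ℕ → Set
GoodBlock B M w P ρ β = ρ * w ≤ P * cnt (λ j → B (point M w β j)) w

module Slots (B : Subset) (M w : ℕ) (1≤M : 1 ≤ M) where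

  InBlock : ℕ → ℕ → Set
  InBlock β z = B z ≡ true × ∃ λ j → j < w × z ≡ point M w β j

  -- X⁻ runs through a block backwards: negated summands become summands after translation.
  X⁺ X⁻ : ℕ → Subset
  X⁺ β j = (j <ᵇ w) ∧ B (point M w β j)
  X⁻ β j = (j <ᵇ w) ∧ B (point M w β (w ∸ suc j))

  <ᵇ-true : ∀ {i n} → (i <ᵇ n) ≡ true → i < n
  <ᵇ-true {i} {n} p = <ᵇ⇒< i n (subst Bool.T (sym p) _)

  true-<ᵇ : ∀ {i n} → i < n → (i <ᵇ n) ≡ true
  true-<ᵇ {i} {n} p with i <ᵇ n | <⇒<ᵇ p
  ... | true | _ = refl

  restrict-Supp : ∀ (A : Subset) → Supp w (λ j → (j <ᵇ w) ∧ A j)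
  restrict-Supp A i p = <ᵇ-true (proj₁ (∧-true p))

  restrict-cnt : ∀ (A : Subset) {W} → w ≤ W → cnt (λ j → (j <ᵇ w) ∧ A j) W ≡ cnt A w
  restrict-cnt A w≤W = trans (cnt-Supp (restrict-Supp A) w≤W)
    (sumTo-cong w λ i i<w → cong (λ b → 𝟙 (b ∧ A i)) (true-<ᵇ i<w))

  X⁻-cnt : ∀ β {W} → w ≤ W → cnt (X⁻ β) W ≡ cnt (λ j → B (point M w β j)) w
  X⁻-cnt β w≤W = trans (restrict-cnt (λ j → B (point M w β (w ∸ suc j))) w≤W)
    (sumTo-reverse w (λ j → 𝟙 (B (point M w β j))))

  -- Index j of `X⁺ β` stands for M (wβ + 1 + j), and index j of `X⁻ β` for -M (w(β + 1) - j). These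
  -- are the accumulated constants, the second with its sign reversed.
  origin⁺ origin⁻ : List ℕ → ℕ
  origin⁺ []       = 0
  origin⁺ (β ∷ βs) = suc (w * β) + origin⁺ βs
  origin⁻ []       = 0
  origin⁻ (β ∷ βs) = w * suc β + origin⁻ βs

  extract⁺ : ∀ βs {P : ℕ → Set} x → Sums P (map X⁺ βs) x →
    ∃ λ y → ∃ λ zs → P y × Pointwise InBlock βs zs × M * (x + origin⁺ βs) ≡ M * y + sum zs
  extract⁺ [] x p = x , [] , p , [] , trans (cong (M *_) (+-identityʳ x)) (sym (+-identityʳ _))
  extract⁺ (β ∷ βs) x p with extract⁺ βs x p
  ... | y' , zs , (y , j , py , Xj , refl) , pw , eq with ∧-true {j <ᵇ w} Xj
  ... | j<w , Bz = y , point M w β j ∷ zs , py , ((Bz , j , <ᵇ-true j<w , refl) ∷ pw)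
      , trans (lhs M x (w * β) (origin⁺ βs)) (trans (cong (M * suc (w * β) +_) eq) (rhs M y j (w * β) (sum zs)))
    where
    lhs : ∀ M x a o → M * (x + (suc a + o)) ≡ M * suc a + M * (x + o)
    lhs = solve-∀
    rhs : ∀ M y j a s → M * suc a + (M * (y + j) + s) ≡ M * y + (M * suc (a + j) + s)
    rhs = solve-∀

  extract⁻ : ∀ βs {P : ℕ → Set} x → Sums P (map X⁻ βs) x →
    ∃ λ y → ∃ λ zs → P y × Pointwise InBlock βs zs × M * x + sum zs ≡ M * (y + origin⁻ βs)
  extract⁻ [] x p = x , [] , p , [] , trans (+-identityʳ _) (cong (M *_) (sym (+-identityʳ x)))
  extract⁻ (β ∷ βs) x p with extract⁻ βs x p
  ... | y' , zs , (y , j , py , Xj , refl) , pw , eq with ∧-true {j <ᵇ w} Xj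
  ... | j<ᵇw , Bz with m≤n⇒∃[o]m+o≡n (<ᵇ-true {j} {w} j<ᵇw)
  ... | d , refl = y , z ∷ zs , py , ((Bz , suc j + d ∸ suc j , m∸n<w , refl) ∷ pw)
      , (begin
         M * x + (z + sum zs)          ≡⟨ lhs (M * x) z (sum zs) ⟩
         M * x + sum zs + z            ≡⟨ cong₂ _+_ eq (cong (λ e → M * suc ((suc j + d) * β + e)) (m+n∸m≡n (suc j) d)) ⟩
         M * (y + j + origin⁻ βs) + M * suc ((suc j + d) * β + d)
           ≡⟨ rhs M y j (origin⁻ βs) d ((suc j + d) * β) ⟩
         M * (y + ((suc j + d) + (suc j + d) * β + origin⁻ βs))
           ≡⟨ cong (λ e → M * (y + (e + origin⁻ βs))) (sym (*-suc (suc j + d) β)) ⟩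
         M * (y + ((suc j + d) * suc β + origin⁻ βs)) ∎)
    where
    open ≡-Reasoning
    z = point M (suc j + d) β (suc j + d ∸ suc j)
    m∸n<w : suc j + d ∸ suc j < suc j + d
    m∸n<w = subst (_< suc j + d) (sym (m+n∸m≡n (suc j) d)) (s≤s (m≤n+m d j))
    lhs : ∀ a z s → a + (z + s) ≡ a + s + z
    lhs = solve-∀
    rhs : ∀ M y j o d a → M * (y + j + o) + M * suc (a + d) ≡ M * (y + ((suc j + d) + a + o))
    rhs = solve-∀

  InBlock-injective : ∀ {β β' z z'} → InBlock β z → InBlock β' z' → z ≡ z' → β ≡ β'
  InBlock-injective {β} {β'} (_ , j , j<w , refl) (_ , j' , j'<w , refl) eq =
    block-injective β β' j<w j'<w (suc-injective (*-cancelˡ-≡ _ _ M {{>-nonZero 1≤M}} eq))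

  Pointwise-unique : ∀ {βs zs} → Unique βs → Pointwise InBlock βs zs → Unique zs
  Pointwise-unique [] [] = []
  Pointwise-unique {β ∷ _} {z ∷ _} (β∉ ∷ uβs) (p ∷ ps) = fresh β∉ ps ∷ Pointwise-unique uβs ps
    where
    fresh : ∀ {βs zs} → All (β ≢_) βs → Pointwise InBlock βs zs → All (z ≢_) zs
    fresh [] [] = []
    fresh (β≢ ∷ β∉) (q ∷ qs) = (λ eq → β≢ (InBlock-injective p q eq)) ∷ fresh β∉ qs

  Pointwise-B : ∀ {βs zs} → Pointwise InBlock βs zs → All ⟦ B ⟧ zs
  Pointwise-B [] = []
  Pointwise-B (p ∷ ps) = proj₁ p ∷ Pointwise-B ps

  point-bound : ∀ {P β j} → β < P → j < w → point M w β j ≤ M * (P * w)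
  point-bound {P} {β} {j} β<P j<w = *-monoʳ-≤ M (begin
    suc (w * β + j) ≡⟨ +-suc (w * β) j ⟨
    w * β + suc j ≤⟨ +-monoʳ-≤ (w * β) j<w ⟩
    w * β + w ≡⟨ +-comm (w * β) w ⟩
    w + w * β ≡⟨ *-suc w β ⟨
    w * suc β ≤⟨ *-monoʳ-≤ w β<P ⟩
    w * P ≡⟨ *-comm w P ⟩
    P * w ∎)
    where open ≤-Reasoning

  Pointwise-bound : ∀ {P y βs zs} → M * (P * w) < y → All (_< P) βs → Pointwise InBlock βs zs → All (y ≢_) zs
  Pointwise-bound lt [] [] = []
  Pointwise-bound lt (β<P ∷ h) ((_ , j , j<w , refl) ∷ ps) =
    (λ eq → <⇒≢ (≤-<-trans (point-bound β<P j<w) lt) (sym eq)) ∷ Pointwise-bound lt h ps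

  origin⁺-bound : ∀ {P} → 1 ≤ w → ∀ βs → All (_< P) βs → origin⁺ βs ≤ length βs * (P * w)
  origin⁺-bound 1≤w [] [] = z≤n
  origin⁺-bound {P} 1≤w (β ∷ βs) (β<P ∷ h) = +-mono-≤ (begin
      suc (w * β) ≤⟨ +-monoˡ-≤ (w * β) 1≤w ⟩
      w + w * β ≡⟨ *-suc w β ⟨
      w * suc β ≤⟨ *-monoʳ-≤ w β<P ⟩
      w * P ≡⟨ *-comm w P ⟩
      P * w ∎) (origin⁺-bound 1≤w βs h)
    where open ≤-Reasoning

  origin⁻-bound : ∀ {P} βs → All (_< P) βs → origin⁻ βs ≤ length βs * (P * w)
  origin⁻-bound [] [] = z≤n
  origin⁻-bound {P} (β ∷ βs) (β<P ∷ h) =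
    +-mono-≤ (≤-trans (*-monoʳ-≤ w β<P) (≤-reflexive (*-comm w P))) (origin⁻-bound βs h)

-- Even distribution in a cell without density increment

module Uniformity (Y : Subset) (u Q δ : ℕ) (1≤u : 1 ≤ u) where
  open ≤-Reasoning

  -- The cell has density δ/Q; the progression of length u has at least one step of 1/Q more.
  Increment : ℕ → ℕ → Set
  Increment t p = p + t * u ≤ Q * u × suc δ * u ≤ Q * cnt (λ j → Y (p + t * j)) u

  module _ (R : ℕ) (2≤R : 2 ≤ R)
           (mass : δ * u ≤ cnt Y (Q * u))
           (none : ∀ t p → 1 ≤ t → t < R → ¬ Increment t p) where

    segment : ℕ → ℕ → ℕ
    segment p n = cnt (λ i → Y (p + i)) n

    cell : ∀ t p → 1 ≤ t → t < R → p + t * u ≤ Q * u → Q * cnt (λ j → Y (p + t * j)) u ≤ suc δ * u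
    cell t p 1≤t t<R le = <⇒≤ (≰⇒> λ q → none t p 1≤t t<R (le , q))

    progression : ∀ t p m → 1 ≤ t → t < R → p + t * (m * u) ≤ Q * u →
      Q * cnt (λ j → Y (p + t * j)) (m * u) ≤ m * (suc δ * u)
    progression t p m 1≤t t<R le = begin
      Q * cnt (λ j → Y (p + t * j)) (m * u)
        ≡⟨ cong (Q *_) (sumTo-blocks m u _) ⟩
      Q * sumTo m (λ i → sumTo u (λ j → 𝟙 (Y (p + t * (i * u + j)))))
        ≡⟨ sumTo-*ˡ m Q _ ⟨
      sumTo m (λ i → Q * sumTo u (λ j → 𝟙 (Y (p + t * (i * u + j)))))
        ≤⟨ sumTo-≤const m (suc δ * u) each ⟩
      m * (suc δ * u) ∎
      where
      shuffle : ∀ p t i j → p + t * (i * u + j) ≡ p + t * (i * u) + t * j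
      shuffle p t i j = trans (cong (p +_) (*-distribˡ-+ t (i * u) j)) (sym (+-assoc p _ _))
      each : ∀ i → i < m → Q * sumTo u (λ j → 𝟙 (Y (p + t * (i * u + j)))) ≤ suc δ * u
      each i i<m = ≤-trans (≤-reflexive (cong (Q *_) (sumTo-cong u λ j _ → cong (𝟙 ∘ Y) (shuffle p t i j))))
        (cell t (p + t * (i * u)) 1≤t t<R (begin
          p + t * (i * u) + t * u ≡⟨ shuffle p t i u ⟨
          p + t * (i * u + u) ≡⟨ cong (λ z → p + t * z) (+-comm (i * u) u) ⟩
          p + t * (suc i * u) ≤⟨ +-monoʳ-≤ p (*-monoʳ-≤ t (*-monoˡ-≤ u i<m)) ⟩
          p + t * (m * u) ≤⟨ le ⟩
          Q * u ∎))

    -- Full stretches of length u are progressions of difference 1 and are capped by `none`; the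
    -- remainder of fewer than u terms is counted whole, at the cost u Q.
    segment-upper : ∀ p n → p + n ≤ Q * u → Q * segment p n ≤ n * suc δ + u * Q
    segment-upper p n le = begin
      Q * segment p n
        ≡⟨ cong (λ z → Q * segment p z) n≡ ⟩
      Q * segment p (a * u + b)
        ≡⟨ cong (Q *_) (sumTo-split (a * u) b _) ⟩
      Q * (segment p (a * u) + sumTo b (λ i → 𝟙 (Y (p + (a * u + i)))))
        ≡⟨ *-distribˡ-+ Q (segment p (a * u)) _ ⟩
      Q * segment p (a * u) + Q * sumTo b (λ i → 𝟙 (Y (p + (a * u + i))))
        ≤⟨ +-mono-≤ whole (*-monoʳ-≤ Q (≤-trans (cnt≤ (λ i → Y (p + (a * u + i))) b) (<⇒≤ b<u))) ⟩
      a * (suc δ * u) + Q * u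
        ≡⟨ cong₂ _+_ (shuffle a δ u) (*-comm Q u) ⟩
      a * u * suc δ + u * Q
        ≤⟨ +-monoˡ-≤ (u * Q) (*-monoˡ-≤ (suc δ) au≤n) ⟩
      n * suc δ + u * Q ∎
      where
      instance u≢0 = >-nonZero 1≤u
      a = n / u
      b = n % u
      b<u = m%n<n n u
      n≡ : n ≡ a * u + b
      n≡ = trans (m≡m%n+[m/n]*n n u) (+-comm b (a * u))
      au≤n : a * u ≤ n
      au≤n = subst (a * u ≤_) (sym n≡) (m≤m+n (a * u) b)
      shuffle : ∀ a δ u → a * (suc δ * u) ≡ a * u * suc δ
      shuffle = solve-∀
      whole : Q * segment p (a * u) ≤ a * (suc δ * u)
      whole = ≤-trans (≤-reflexive (cong (Q *_) (sumTo-cong (a * u) λ i _ → cong (λ z → 𝟙 (Y (p + z))) (sym (*-identityˡ i)))))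
        (progression 1 p a ≤-refl 2≤R
          (≤-trans (+-monoʳ-≤ p (≤-trans (≤-reflexive (*-identityˡ (a * u))) au≤n)) le))

    -- The rest of the cell cannot exceed the average by much, so no window falls far below it.
    segment-lower : ∀ p n → p + n ≤ Q * u → n * suc δ ≤ Q * segment p n + 3 * (u * Q)
    segment-lower p n le with m≤n⇒∃[o]m+o≡n le
    ... | d , eq = +-cancelˡ-≤ ((p + d) * suc δ) _ _ (begin
      (p + d) * suc δ + n * suc δ
        ≡⟨ collect p d n (suc δ) ⟩
      (p + n + d) * suc δ
        ≡⟨ cong (_* suc δ) eq ⟩
      Q * u * suc δ
        ≡⟨ expand Q u δ ⟩
      Q * (δ * u) + u * Q
        ≤⟨ +-monoˡ-≤ (u * Q) (*-monoʳ-≤ Q mass) ⟩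
      Q * cnt Y (Q * u) + u * Q
        ≡⟨ cong (λ z → Q * cnt Y z + u * Q) (sym eq) ⟩
      Q * cnt Y (p + n + d) + u * Q
        ≡⟨ cong (λ z → Q * z + u * Q) (trans (sumTo-split (p + n) d _) (cong (_+ segment (p + n) d) (sumTo-split p n _))) ⟩
      Q * (cnt Y p + segment p n + segment (p + n) d) + u * Q
        ≡⟨ distribute Q (cnt Y p) (segment p n) (segment (p + n) d) (u * Q) ⟩
      Q * segment 0 p + Q * segment (p + n) d + Q * segment p n + u * Q
        ≤⟨ +-monoˡ-≤ (u * Q) (+-monoˡ-≤ (Q * segment p n) (+-mono-≤
             (segment-upper 0 p (≤-trans (m≤m+n p n) le))
             (segment-upper (p + n) d (≤-reflexive eq)))) ⟩
      -- Three errors u Q: one from replacing δ by δ + 1, and one from each of the two outer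
      -- segments.
      p * suc δ + u * Q + (d * suc δ + u * Q) + Q * segment p n + u * Q
        ≡⟨ regroup p d (suc δ) (u * Q) (Q * segment p n) ⟩
      (p + d) * suc δ + (Q * segment p n + 3 * (u * Q)) ∎)
      where
      collect : ∀ p d n e → (p + d) * e + n * e ≡ (p + n + d) * e
      collect = solve-∀
      expand : ∀ Q u δ → Q * u * suc δ ≡ Q * (δ * u) + u * Q
      expand = solve-∀
      distribute : ∀ Q a b c e → Q * (a + b + c) + e ≡ Q * a + Q * c + Q * b + e
      distribute = solve-∀
      regroup : ∀ p d e f g → p * e + f + (d * e + f) + g + f ≡ (p + d) * e + (g + 3 * f)
      regroup = solve-∀
 

-- The density increment

-- `k` and `ℓ` are one less than in the theorem: y and y' come from the cell, the other k and ℓ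
-- summands from good blocks. `surplus` says that ρ/P ≥ 1/(k + ℓ + 2) + 2/P.
module LevelStep (k ℓ P ρ u Q : ℕ) (1≤u : 1 ≤ u)
  (sc : Scales P (P * u) (k + ℓ))
  (surplus : P + 2 * (2 + (k + ℓ)) ≤ (2 + (k + ℓ)) * ρ)
  (5≤ρ : 5 ≤ ρ) where

  K J : ℕ
  K = k + ℓ
  J = P * u

  open Scales sc
  open Pair W L v P R J 1≤v 2≤P 1≤J gap using (size; MostlyAP; sumset-growth; totalSize)

  w≤W : w ≤ W
  w≤W = m≤m+n w (K * E)

  totalSize-lower : ∀ Xs → All (λ X → ρ * w ≤ P * size X) Xs →
    length Xs * (ρ * w) ≤ P * totalSize S (P * v) 1≤L fuel absorb Xs
  totalSize-lower []       []       = z≤n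
  totalSize-lower (X ∷ Xs) (p ∷ ps) =
    ≤-trans (+-mono-≤ p (totalSize-lower Xs ps)) (≤-reflexive (sym (*-distribˡ-+ P (size X) _)))

  dense⇒nonempty : ∀ {n} → ρ * w ≤ P * n → 1 ≤ n
  dense⇒nonempty {zero} p = ⊥-elim (<⇒≱ (*-mono-≤ (≤-trans (s≤s z≤n) 5≤ρ) 1≤w) (≤-trans p (≤-reflexive (*-zeroʳ P))))
  dense⇒nonempty {suc n} p = s≤s z≤n

  module _ (Q-length : Q * u ≡ P * (P * w)) (B : Subset) (sumfree : SumFree (suc k) (suc ℓ) B)
    (M : ℕ) (1≤M : 1 ≤ M)
    (βs γs : List ℕ) (uβs : Unique βs) (uγs : Unique γs) (lβs : length βs ≡ k) (lγs : length γs ≡ ℓ)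
    (βs<P : All (_< P) βs) (γs<P : All (_< P) γs)
    (gβs : All (GoodBlock B M w P ρ) βs) (gγs : All (GoodBlock B M w P ρ) γs)
    (r : ℕ) (far : M * (P * w) < r)
    (δ : ℕ) (δ-large : ρ * Q ≤ P * δ) where

    open Slots B M w 1≤M

    Y : Subset
    Y i = B (r + M * i)

    module _ (mass : δ * u ≤ cnt Y (Q * u)) where
      open Uniformity Y u Q δ 1≤u
      open ≤-Reasoning

      -- The window for y starts at `origin⁻ γs`, exactly what the negated summands take away again,
      -- so that no truncated subtraction arises.
      Z : Subset
      Z j = (j <ᵇ w) ∧ Y (origin⁻ γs + j)

      Xs : List Subset
      Xs = map X⁺ βs ++ map X⁻ γs

      length-Xs : length Xs ≡ K
      length-Xs = trans (length-++ (map X⁺ βs))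
        (cong₂ _+_ (trans (length-map X⁺ βs) lβs) (trans (length-map X⁻ γs) lγs))

      -- The solution has y = r + M (origin⁻ + y₀) and y' = r + M (x + origin⁺). By `far` both lie
      -- beyond every block, hence differ from the block elements, and these are distinct because
      -- their blocks are.
      no-solution : ∀ x → Sums ⟦ Z ⟧ Xs x → Y (x + origin⁺ βs) ≡ true → ⊥
      no-solution x p Yx = minus (extract⁻ γs x (Sums-++ (map X⁺ βs) (map X⁻ γs) x p))
        where
        step₁ : ∀ r M x o s → r + M * (x + o) + s ≡ r + M * o + (M * x + s)
        step₁ = solve-∀
        step₂ : ∀ r M y o o' → r + M * o + M * (y + o') ≡ r + M * o' + M * (y + o)
        step₂ = solve-∀
        step₃ : ∀ r M y o s → r + M * o + (M * y + s) ≡ r + M * (o + y) + s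
        step₃ = solve-∀
        plus : ∀ y₁ bs → Pointwise InBlock γs bs → M * x + sum bs ≡ M * (y₁ + origin⁻ γs) →
          (∃ λ y → ∃ λ zs → Z y ≡ true × Pointwise InBlock βs zs × M * (y₁ + origin⁺ βs) ≡ M * y + sum zs) → ⊥
        plus y₁ bs pwb eqb (y₀ , as , Zy₀ , pwa , eqa) =
          sumfree (r + M * (origin⁻ γs + y₀) ∷ as) (r + M * (x + origin⁺ βs) ∷ bs)
          (Pointwise-bound (<-≤-trans far (m≤m+n r _)) βs<P pwa ∷ Pointwise-unique uβs pwa)
          (proj₂ (∧-true {y₀ <ᵇ w} Zy₀) ∷ Pointwise-B pwa)
          (cong suc (trans (sym (Pointwise-length pwa)) lβs))
          (Pointwise-bound (<-≤-trans far (m≤m+n r _)) γs<P pwb ∷ Pointwise-unique uγs pwb)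
          (Yx ∷ Pointwise-B pwb)
          (cong suc (trans (sym (Pointwise-length pwb)) lγs))
          (sym (begin-equality
            r + M * (x + origin⁺ βs) + sum bs ≡⟨ step₁ r M x (origin⁺ βs) (sum bs) ⟩
            r + M * origin⁺ βs + (M * x + sum bs) ≡⟨ cong (r + M * origin⁺ βs +_) eqb ⟩
            r + M * origin⁺ βs + M * (y₁ + origin⁻ γs) ≡⟨ step₂ r M y₁ (origin⁺ βs) (origin⁻ γs) ⟩
            r + M * origin⁻ γs + M * (y₁ + origin⁺ βs) ≡⟨ cong (r + M * origin⁻ γs +_) eqa ⟩
            r + M * origin⁻ γs + (M * y₀ + sum as) ≡⟨ step₃ r M y₀ (origin⁻ γs) (sum as) ⟩
            r + M * (origin⁻ γs + y₀) + sum as ∎))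
        minus : (∃ λ y → ∃ λ zs → Sums ⟦ Z ⟧ (map X⁺ βs) y × Pointwise InBlock γs zs ×
          M * x + sum zs ≡ M * (y + origin⁻ γs)) → ⊥
        minus (y₁ , bs , p₁ , pwb , eqb) = plus y₁ bs pwb eqb (extract⁺ βs y₁ p₁)

      Xs-Supp : All (Supp w) Xs
      Xs-Supp = Allₚ.++⁺ (Allₚ.map⁺ (All.universal (λ β → restrict-Supp (λ j → B (point M w β j))) βs))
                         (Allₚ.map⁺ (All.universal (λ β → restrict-Supp (λ j → B (point M w β (w ∸ suc j)))) γs))

      Xs-dense : All (λ X → ρ * w ≤ P * size X) Xs
      Xs-dense = Allₚ.++⁺
        (Allₚ.map⁺ (All.map (λ {β} g → subst (λ z → ρ * w ≤ P * z) (sym (restrict-cnt (λ j → B (point M w β j)) w≤W)) g) gβs))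
        (Allₚ.map⁺ (All.map (λ {β} g → subst (λ z → ρ * w ≤ P * z) (sym (X⁻-cnt β w≤W)) g) gγs))

      1≤Q : 1 ≤ Q
      1≤Q = positive Q (≤-trans (*-mono-≤ 1≤P (*-mono-≤ 1≤P 1≤w)) (≤-reflexive (sym Q-length)))
        where
        positive : ∀ Q → 1 ≤ Q * u → 1 ≤ Q
        positive (suc _) _ = s≤s z≤n

      -- The origin takes at most K · P w and the window at most another P w by `room`, while the
      -- cell has length P · P w.
      fits : ∀ o a → o ≤ k * (P * w) ⊎ o ≤ ℓ * (P * w) → a ≤ 4 * (2 + K) * w → o + a ≤ Q * u
      fits o a o≤ a≤ = begin
        o + a ≤⟨ +-mono-≤ (o≤K o≤) (≤-trans a≤ (*-monoˡ-≤ w room)) ⟩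
        K * (P * w) + P * w ≡⟨ +-comm (K * (P * w)) (P * w) ⟩
        suc K * (P * w) ≤⟨ *-monoˡ-≤ (P * w) (≤-trans (n≤1+n (suc K)) (≤-trans (m≤n*m (2 + K) 4) room)) ⟩
        P * (P * w) ≡⟨ Q-length ⟨
        Q * u ∎
        where
        o≤K : o ≤ k * (P * w) ⊎ o ≤ ℓ * (P * w) → o ≤ K * (P * w)
        o≤K (inj₁ p) = ≤-trans p (*-monoˡ-≤ (P * w) (m≤m+n k ℓ))
        o≤K (inj₂ p) = ≤-trans p (*-monoˡ-≤ (P * w) (m≤n+m ℓ k))

      origin⁺≤ : origin⁺ βs ≤ k * (P * w)
      origin⁺≤ = subst (λ z → origin⁺ βs ≤ z * (P * w)) lβs (origin⁺-bound 1≤w βs βs<P)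

      origin⁻≤ : origin⁻ γs ≤ ℓ * (P * w)
      origin⁻≤ = subst (λ z → origin⁻ γs ≤ z * (P * w)) lγs (origin⁻-bound γs γs<P)

      Sums<  : ∀ x → Sums ⟦ Z ⟧ Xs x → x < suc K * w
      Sums< x p = subst (λ z → x < w + z * w) length-Xs
        (Sums-bound Xs Xs-Supp w (restrict-Supp (λ j → Y (origin⁻ γs + j))) x p)

      3+K≤ : 3 + K ≤ 4 * (2 + K)
      3+K≤ = begin
        3 + K ≤⟨ +-monoˡ-≤ K {3} {8} (s≤s (s≤s (s≤s z≤n))) ⟩
        8 + K ≤⟨ +-monoʳ-≤ 8 (m≤n*m K 4) ⟩
        8 + 4 * K ≡⟨ *-distribˡ-+ 4 2 K ⟨
        4 * (2 + K) ∎

      module _ (none : ∀ t p → 1 ≤ t → t < R → ¬ Increment t p) where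

        window : ∀ p n → p + n ≤ Q * u → n * suc δ ≤ Q * cnt (λ i → Y (p + i)) n + 3 * (u * Q)
        window = segment-lower R 2≤R mass none

        window-dense : ∀ p n → w ≤ n → p + n ≤ Q * u → ρ * w ≤ P * cnt (λ i → Y (p + i)) n + P * (3 * u)
        window-dense p n w≤n le = *-cancelˡ-≤ Q {{>-nonZero 1≤Q}} (begin
          Q * (ρ * w) ≡⟨ shuffle₁ Q ρ w ⟩
          w * (ρ * Q) ≤⟨ *-mono-≤ w≤n (≤-trans δ-large (*-monoʳ-≤ P (n≤1+n δ))) ⟩
          n * (P * suc δ) ≡⟨ shuffle₂ n P (suc δ) ⟩
          P * (n * suc δ) ≤⟨ *-monoʳ-≤ P (window p n le) ⟩
          P * (Q * y + 3 * (u * Q)) ≡⟨ shuffle₃ P Q y u ⟩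
          Q * (P * y + P * (3 * u)) ∎)
          where
          y = cnt (λ i → Y (p + i)) n
          shuffle₁ : ∀ Q ρ w → Q * (ρ * w) ≡ w * (ρ * Q)
          shuffle₁ = solve-∀
          shuffle₂ : ∀ a b c → a * (b * c) ≡ b * (a * c)
          shuffle₂ = solve-∀
          shuffle₃ : ∀ P Q y u → P * (Q * y + 3 * (u * Q)) ≡ Q * (P * y + P * (3 * u))
          shuffle₃ = solve-∀

        -- Y nearly misses one class modulo the difference, and `none` caps the other classes at
        -- density (δ + 1)/Q. The lower bound for the whole stretch then cannot be met.
        full-progression : MostlyAP (Sums ⟦ Z ⟧ Xs) → ⊥
        full-progression (zero , _ , _ , () , _)
        full-progression (suc t , c , h , 1≤t , t<R , hit , few) = <⇒≱ contra₁ contra₂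
          where
          c' = c + origin⁺ βs
          y₀ = cnt (λ j → Y (c' + suc t * j)) J
          missing : P * y₀ ≤ J
          missing = +-cancelʳ-≤ (P * cnt h J) _ _ (begin
            P * y₀ + P * cnt h J ≡⟨ *-distribˡ-+ P y₀ (cnt h J) ⟨
            P * (y₀ + cnt h J) ≤⟨ *-monoʳ-≤ P (cnt-disjoint J λ j _ Yj hj → no-solution _ (hit j hj)
                (subst (λ z → Y z ≡ true) (swap c (origin⁺ βs) (suc t * j)) Yj)) ⟩
            P * J ≤⟨ few ⟩
            P * cnt h J + J ≡⟨ +-comm _ J ⟩
            J + P * cnt h J ∎)
            where
            swap : ∀ a b c → a + b + c ≡ a + c + b
            swap = solve-∀
          1≤hits : 1 ≤ cnt h J
          1≤hits = n≢0⇒n>0 λ z → <⇒≱ (m<m*n J P {{>-nonZero 1≤J}} 2≤P)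
            (subst₂ _≤_ (*-comm P J) (cong (_+ J) (trans (cong (P *_) z) (*-zeroʳ P))) few)
          c<  : c < suc K * w
          c< = let (j , _ , hj) = cnt-member J 1≤hits in ≤-<-trans (m≤m+n c (suc t * j)) (Sums< _ (hit j hj))
          range : c' + (R + suc t * J) ≤ Q * u
          range = begin
            c + origin⁺ βs + (R + suc t * J) ≡⟨ swap c (origin⁺ βs) (R + suc t * J) ⟩
            origin⁺ βs + (c + (R + suc t * J)) ≤⟨ fits (origin⁺ βs) _ (inj₁ origin⁺≤) (begin
                c + (R + suc t * J) ≤⟨ +-mono-≤ (<⇒≤ c<) (+-mono-≤ (≤-trans (m≤m*n R J {{>-nonZero 1≤J}}) RJ≤w) (≤-trans (*-monoˡ-≤ J (<⇒≤ t<R)) RJ≤w)) ⟩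
                suc K * w + (w + w) ≡⟨ e K w ⟩
                (3 + K) * w ≤⟨ *-monoˡ-≤ w 3+K≤ ⟩
                4 * (2 + K) * w ∎) ⟩
            Q * u ∎
            where
            swap : ∀ a b c → a + b + c ≡ b + (a + c)
            swap = solve-∀
            e : ∀ K w → suc K * w + (w + w) ≡ (3 + K) * w
            e = solve-∀
          class : ∀ i → i < t → Q * cnt (λ j → Y (c' + (suc i + suc t * j))) J ≤ P * (suc δ * u)
          class i i<t = ≤-trans (≤-reflexive (cong (Q *_) (sumTo-cong J λ j _ → cong (𝟙 ∘ Y) (sym (+-assoc c' (suc i) (suc t * j))))))
            (progression R 2≤R mass none (suc t) (c' + suc i) P 1≤t t<R (begin
              c' + suc i + suc t * J ≡⟨ +-assoc c' (suc i) _ ⟩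
              c' + (suc i + suc t * J) ≤⟨ +-monoʳ-≤ c' (+-monoˡ-≤ _ (≤-trans i<t (≤-trans (n≤1+n t) (<⇒≤ t<R)))) ⟩
              c' + (R + suc t * J) ≤⟨ range ⟩
              Q * u ∎))
          bound : Q * cnt (λ i → Y (c' + i)) (suc t * J) ≤ Q * y₀ + t * (P * (suc δ * u))
          bound = begin
            Q * cnt (λ i → Y (c' + i)) (suc t * J)
              ≡⟨ cong (Q *_) (sumTo-classes (suc t) J _) ⟩
            Q * sumTo (suc t) (λ i → sumTo J (λ j → 𝟙 (Y (c' + (i + suc t * j)))))
              ≡⟨ cong (Q *_) (sumTo-split 1 t _) ⟩
            Q * (y₀ + sumTo t (λ i → sumTo J (λ j → 𝟙 (Y (c' + (suc i + suc t * j))))))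
              ≡⟨ *-distribˡ-+ Q y₀ _ ⟩
            Q * y₀ + Q * sumTo t (λ i → sumTo J (λ j → 𝟙 (Y (c' + (suc i + suc t * j)))))
              ≡⟨ cong (Q * y₀ +_) (sumTo-*ˡ t Q _) ⟨
            Q * y₀ + sumTo t (λ i → Q * sumTo J (λ j → 𝟙 (Y (c' + (suc i + suc t * j)))))
              ≤⟨ +-monoʳ-≤ (Q * y₀) (sumTo-≤const t _ class) ⟩
            Q * y₀ + t * (P * (suc δ * u)) ∎
          -- 4 = 1 + 3: one from the points of Y left in the class (P y₀ ≤ J), three from
          -- `segment-lower`, using J = P u.
          contra₂ : P * suc δ ≤ 4 * Q
          contra₂ = *-cancelˡ-≤ J {{>-nonZero 1≤J}} (begin
            J * (P * suc δ) ≡⟨ e₁ J P (suc δ) ⟩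
            P * (J * suc δ) ≤⟨ *-monoʳ-≤ P core ⟩
            P * (Q * y₀ + 3 * (u * Q)) ≡⟨ e₂ P Q y₀ u ⟩
            Q * (P * y₀) + 3 * (P * u * Q) ≤⟨ +-monoˡ-≤ _ (*-monoʳ-≤ Q missing) ⟩
            Q * J + 3 * (J * Q) ≡⟨ e₃ Q J ⟩
            J * (4 * Q) ∎)
            where
            e₁ : ∀ J P d → J * (P * d) ≡ P * (J * d)
            e₁ = solve-∀
            e₂ : ∀ P Q y u → P * (Q * y + 3 * (u * Q)) ≡ Q * (P * y) + 3 * (P * u * Q)
            e₂ = solve-∀
            e₃ : ∀ Q J → Q * J + 3 * (J * Q) ≡ J * (4 * Q)
            e₃ = solve-∀
            e₄ : ∀ t P u d → t * (P * (d * u)) + P * u * d ≡ suc t * (P * u) * d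
            e₄ = solve-∀
            e₅ : ∀ a b c → a + b + c ≡ b + (a + c)
            e₅ = solve-∀
            core : J * suc δ ≤ Q * y₀ + 3 * (u * Q)
            core = +-cancelˡ-≤ (t * (P * (suc δ * u))) _ _ (begin
              t * (P * (suc δ * u)) + J * suc δ ≡⟨ e₄ t P u (suc δ) ⟩
              suc t * J * suc δ ≤⟨ window c' (suc t * J) (≤-trans (+-monoʳ-≤ c' (m≤n+m _ R)) range) ⟩
              Q * cnt (λ i → Y (c' + i)) (suc t * J) + 3 * (u * Q) ≤⟨ +-monoˡ-≤ _ bound ⟩
              Q * y₀ + t * (P * (suc δ * u)) + 3 * (u * Q) ≡⟨ e₅ (Q * y₀) _ _ ⟩
              t * (P * (suc δ * u)) + (Q * y₀ + 3 * (u * Q)) ∎)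
          contra₁ : 4 * Q < P * suc δ
          contra₁ = begin-strict
            4 * Q <⟨ *-monoˡ-< Q {{>-nonZero 1≤Q}} (n<1+n 4) ⟩
            5 * Q ≤⟨ *-monoˡ-≤ Q 5≤ρ ⟩
            ρ * Q ≤⟨ δ-large ⟩
            P * δ ≤⟨ *-monoʳ-≤ P (n≤1+n δ) ⟩
            P * suc δ ∎

        Z-dense : ρ * w ≤ P * size Z + P * (3 * u)
        Z-dense = subst (λ z → ρ * w ≤ P * z + P * (3 * u)) (sym (restrict-cnt (λ j → Y (origin⁻ γs + j)) w≤W))
          (window-dense (origin⁻ γs) w ≤-refl (fits (origin⁻ γs) w (inj₂ origin⁻≤) (begin
            w ≡⟨ +-identityʳ w ⟨
            1 * w ≤⟨ *-monoˡ-≤ w {1} {4 * (2 + K)} (s≤s z≤n) ⟩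
            4 * (2 + K) * w ∎)))

        6u≤Pv : 6 * u ≤ P * v
        6u≤Pv = ≤-trans (*-monoʳ-≤ 6 (m≤n*m u P {{>-nonZero 1≤P}})) 6J≤Pv

        P*6u≤w : P * (6 * u) ≤ w
        P*6u≤w = *-monoʳ-≤ P 6u≤Pv

        1≤Z : 1 ≤ size Z
        1≤Z = n≢0⇒n>0 λ z → <⇒≱ (begin-strict
            P * (3 * u) ≤⟨ *-monoʳ-≤ P (*-monoˡ-≤ u {3} {6} (s≤s (s≤s (s≤s z≤n)))) ⟩
            P * (6 * u) ≤⟨ P*6u≤w ⟩
            w <⟨ m<m*n w ρ {{>-nonZero 1≤w}} (≤-trans (s≤s (s≤s z≤n)) 5≤ρ) ⟩
            w * ρ ≡⟨ *-comm w ρ ⟩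
            ρ * w ∎)
          (≤-trans Z-dense (≤-reflexive (cong (_+ P * (3 * u)) (trans (cong (P *_) z) (*-zeroʳ P)))))

        -- The windows for y and y' and the K pieces, 2 + K sets of density about ρ/P, would have to
        -- share W. In units of w/P the errors are 1 from the two windows, 1 from the growth of W
        -- and 2 for each of the K additions; `surplus` offers 2 (2 + K).
        too-dense : (∃ λ D → ∃ λ c → Supp W D × 1 ≤ size D × (∀ i → D i ≡ true → Sums ⟦ Z ⟧ Xs (i + c)) ×
          size Z + totalSize S (P * v) 1≤L fuel absorb Xs ≤ size D + K * (P * v + P * v)) → ⊥
        too-dense (D , c , hD , 1≤D , incl , bound) = <⇒≱ lower upper
          where
          c' = c + origin⁺ βs
          y = cnt (λ i → Y (c' + i)) W
          TS = totalSize S (P * v) 1≤L fuel absorb Xs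
          disjoint : size D + y ≤ W
          disjoint = cnt-disjoint W λ i _ Di Yi → no-solution _ (incl i Di)
            (subst (λ z → Y z ≡ true) (swap c (origin⁺ βs) i) Yi)
            where
            swap : ∀ a b c → a + b + c ≡ c + a + b
            swap = solve-∀
          c< : c < suc K * w
          c< = let (i , _ , Di) = cnt-member W 1≤D in ≤-<-trans (m≤n+m c i) (Sums< _ (incl i Di))
          y-dense : ρ * w ≤ P * y + P * (3 * u)
          y-dense = window-dense c' W w≤W (begin
            c + origin⁺ βs + W ≡⟨ swap c (origin⁺ βs) W ⟩
            origin⁺ βs + (c + W) ≤⟨ fits (origin⁺ βs) _ (inj₁ origin⁺≤) (begin
                c + W ≤⟨ +-mono-≤ (<⇒≤ c<) W≤2w ⟩
                suc K * w + (w + w) ≡⟨ e K w ⟩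
                (3 + K) * w ≤⟨ *-monoˡ-≤ w 3+K≤ ⟩
                4 * (2 + K) * w ∎) ⟩
            Q * u ∎)
            where
            swap : ∀ a b c → a + b + c ≡ b + (a + c)
            swap = solve-∀
            e : ∀ K w → suc K * w + (w + w) ≡ (3 + K) * w
            e = solve-∀
          upper : (2 + K) * (ρ * w) ≤ P * w + (2 + (K + K)) * w
          upper = begin
            (2 + K) * (ρ * w) ≡⟨ e₁ K (ρ * w) ⟩
            ρ * w + ρ * w + K * (ρ * w)
              ≤⟨ +-mono-≤ (+-mono-≤ Z-dense y-dense) (subst (λ z → z * (ρ * w) ≤ P * TS) length-Xs (totalSize-lower Xs Xs-dense)) ⟩
            P * size Z + P * (3 * u) + (P * y + P * (3 * u)) + P * TS
              ≡⟨ e₂ P (size Z) u y TS ⟩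
            P * (size Z + TS + y) + P * (6 * u)
              ≤⟨ +-mono-≤ (*-monoʳ-≤ P (begin
                   size Z + TS + y ≤⟨ +-monoˡ-≤ y bound ⟩
                   size D + K * (P * v + P * v) + y ≡⟨ e₃ (size D) (K * (P * v + P * v)) y ⟩
                   size D + y + K * (P * v + P * v) ≤⟨ +-monoˡ-≤ _ disjoint ⟩
                   w + K * E + K * (P * v + P * v) ≤⟨ +-monoˡ-≤ _ (+-monoʳ-≤ w KE≤Pv) ⟩
                   w + P * v + K * (P * v + P * v) ∎)) P*6u≤w ⟩
            P * (w + P * v + K * (P * v + P * v)) + w
              ≡⟨ e₄ P v K ⟩
            P * w + (2 + (K + K)) * w ∎
            where
            e₁ : ∀ K x → (2 + K) * x ≡ x + x + K * x
            e₁ = solve-∀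
            e₂ : ∀ P z u y t → P * z + P * (3 * u) + (P * y + P * (3 * u)) + P * t ≡ P * (z + t + y) + P * (6 * u)
            e₂ = solve-∀
            e₃ : ∀ a b c → a + b + c ≡ a + c + b
            e₃ = solve-∀
            e₄ : ∀ P v K → P * (P * (P * v) + P * v + K * (P * v + P * v)) + P * (P * v)
               ≡ P * (P * (P * v)) + (2 + (K + K)) * (P * (P * v))
            e₄ = solve-∀
          lower : P * w + (2 + (K + K)) * w < (2 + K) * (ρ * w)
          lower = begin-strict
            P * w + (2 + (K + K)) * w <⟨ +-monoʳ-< (P * w) (*-monoˡ-< w {{>-nonZero 1≤w}} more) ⟩
            P * w + 2 * (2 + K) * w ≡⟨ *-distribʳ-+ w P (2 * (2 + K)) ⟨
            (P + 2 * (2 + K)) * w ≤⟨ *-monoˡ-≤ w surplus ⟩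
            (2 + K) * ρ * w ≡⟨ *-assoc (2 + K) ρ w ⟩
            (2 + K) * (ρ * w) ∎
            where
            more : 2 + (K + K) < 2 * (2 + K)
            more = ≤-trans (n≤1+n _) (≤-reflexive (e K))
              where
              e : ∀ K → 4 + (K + K) ≡ 2 * (2 + K)
              e = solve-∀

        contradiction-without-increment : ⊥
        contradiction-without-increment = conclude
          (sumset-growth S (P * v) 1≤L fuel absorb Xs Z (restrict-Supp (λ j → Y (origin⁻ γs + j))) Xs-Supp
            (≤-reflexive (cong (λ z → w + z * E) length-Xs)) 1≤Z (All.map dense⇒nonempty Xs-dense))
          where
          conclude : (∃ λ D → ∃ λ c → Supp (w + length Xs * E) D × 1 ≤ size D ×
              (∀ i → D i ≡ true → Sums ⟦ Z ⟧ Xs (i + c)) ×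
              size Z + totalSize S (P * v) 1≤L fuel absorb Xs ≤ size D + length Xs * (P * v + P * v))
            ⊎ MostlyAP (Sums ⟦ Z ⟧ Xs) → ⊥
          conclude (inj₂ ap) = full-progression ap
          conclude (inj₁ (D , c , hD , 1≤D , incl , bound)) = too-dense (D , c
              , subst (λ z → Supp (w + z * E) D) length-Xs hD , 1≤D , incl
              , subst (λ z → size Z + totalSize S (P * v) 1≤L fuel absorb Xs ≤ size D + z * (P * v + P * v)) length-Xs bound)

      -- Only finitely many t and p are candidates, so a search turns the contradiction into an
      -- actual increment.
      levelStep : ∃ λ t → ∃ λ p → 1 ≤ t × t < R × Increment t p
      levelStep = conclude (bounded-search R search)
        where
        Found : ℕ → Set
        Found t = ∃ λ p → p < suc (Q * u) × 1 ≤ t × Increment t p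
        search : ∀ t → Dec (Found t)
        search t = decide (bounded-search (suc (Q * u))
            (λ p → (1 ≤? t) ×-dec ((p + t * u ≤? Q * u) ×-dec (suc δ * u ≤? Q * cnt (λ j → Y (p + t * j)) u))))
          where
          decide : Found t ⊎ (∀ p → p < suc (Q * u) → ¬ (1 ≤ t × Increment t p)) → Dec (Found t)
          decide (inj₁ q) = yes q
          decide (inj₂ q) = no λ (p , p< , r) → q p p< r
        conclude : (∃ λ t → t < R × Found t) ⊎ (∀ t → t < R → ¬ Found t) →
          ∃ λ t → ∃ λ p → 1 ≤ t × t < R × Increment t p
        conclude (inj₁ (t , t<R , p , _ , 1≤t , inc)) = t , p , 1≤t , t<R , inc
        conclude (inj₂ none) = ⊥-elim (contradiction-without-increment λ t p 1≤t t<R inc →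
          none t t<R (p , s≤s (≤-trans (m≤m+n p _) (proj₁ inc)) , 1≤t , inc))

-- Iteration over the moduli

select : ∀ m {A : Subset} n → n ≤ cnt A m →
  ∃ λ xs → Unique xs × length xs ≡ n × All (_< m) xs × All ⟦ A ⟧ xs
select m zero _ = [] , [] , refl , [] , []
select (suc m) {A} (suc n) le with A m in eq
... | false with select m {A} (suc n) (≤-trans le (≤-reflexive (+-identityʳ _)))
...   | xs , u , l , b , a = xs , u , l , All.map m<n⇒m<1+n b , a
select (suc m) {A} (suc n) le | true with select m {A} n (s≤s⁻¹ (≤-trans le (≤-reflexive (+-comm _ 1))))
...   | xs , u , l , b , a = m ∷ xs , (All.map (λ x<m eq → <⇒≢ x<m (sym eq)) b ∷ u) , cong suc l
        , (≤-refl ∷ All.map m<n⇒m<1+n b) , (eq ∷ a)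

-- Two averagings: over the h classes modulo h, then over the t consecutive stretches of length n in
-- the chosen class.
refine : ∀ h t n c (f : ℕ → ℕ) → 1 ≤ h → 1 ≤ t → h * t * c ≤ sumTo (h * (t * n)) f →
  ∃ λ s → c ≤ sumTo n (λ i → f (s + h * i))
refine h t n c f 1≤h 1≤t le
  with sumTo-average h {λ a → sumTo (t * n) (λ i → f (a + h * i))} (t * c) 1≤h
         (≤-trans (≤-reflexive (sym (*-assoc h t c))) (≤-trans le (≤-reflexive (sumTo-classes h (t * n) f))))
... | a , _ , le₁
  with sumTo-average t {λ b → sumTo n (λ j → f (a + h * (b * n + j)))} c 1≤t
         (≤-trans le₁ (≤-reflexive (sumTo-blocks t n (λ i → f (a + h * i)))))
... | b , _ , le₂ = a + h * (b * n) , ≤-trans le₂ (≤-reflexive (sumTo-cong n λ j _ →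
        cong f (trans (cong (a +_) (*-distribˡ-+ h (b * n) j)) (sym (+-assoc a _ _)))))

does-true : ∀ {a} {A : Set a} (d : Dec A) → does d ≡ true → A
does-true (yes p) _ = p

module Levels (k P ρ F c₉ Q : ℕ) (B : Subset) where

  good : (M w β : ℕ) → Bool
  good M w β = does (ρ * w ≤? P * cnt (λ j → B (point M w β j)) w)

  -- For one increment k good blocks suffice, since both sides of the equation may use the same
  -- blocks. One more guarantees, for k ≥ 1, a good block other than block 0, from which the chain
  -- starts.
  goodLevel : (M w : ℕ) → Bool
  goodLevel M w = does (suc k ≤? cnt (good M w) P)

  -- The scale shrinks as the modulus grows: passing from M and `unit (suc i)` to `M * F` and
  -- `unit i` divides modulus times length by exactly Q.
  unit : ℕ → ℕ
  unit i = (Q * F) ^ i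

  goodLevels : ℕ → ℕ → ℕ
  goodLevels zero    M = 0
  goodLevels (suc i) M = 𝟙 (goodLevel M (c₉ * unit i)) + goodLevels i (M * F)

  goodLevels-suc : ∀ i M → goodLevels (suc i) M ≤ suc (goodLevels i (M * F))
  goodLevels-suc i M = +-monoˡ-≤ (goodLevels i (M * F)) (𝟙≤1 (goodLevel M (c₉ * unit i)))

  goodLevels-bad : ∀ i M → ¬ (suc k ≤ cnt (good M (c₉ * unit i)) P) →
    goodLevels (suc i) M ≡ goodLevels i (M * F)
  goodLevels-bad i M few = cong (λ b → 𝟙 b + goodLevels i (M * F)) (dec-false (suc k ≤? _) few)

  levelCount : (M w : ℕ) → ℕ
  levelCount M w = sumTo P (λ β → cnt (λ j → B (point M w β j)) w)

  -- The factor `Q * F` compensates for the shorter blocks of the next level, so that all levels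
  -- carry equal weight.
  total : ℕ → ℕ → ℕ
  total zero    M = 0
  total (suc i) M = levelCount M (c₉ * unit i) + Q * F * total i (M * F)

  module _ (1≤P : 1 ≤ P) where
    open ≤-Reasoning

    -- On a bad level at most k blocks are good and counted in full, and the others contribute at
    -- most ρ w / P each. A good level is counted in full.
    levelCount-upper : ∀ M w → levelCount M w ≤ w * (ρ + k + P * 𝟙 (goodLevel M w))
    levelCount-upper M w with suc k ≤? cnt (good M w) P
    ... | yes many = begin
      levelCount M w ≤⟨ sumTo-≤const P w (λ β _ → cnt≤ (λ j → B (point M w β j)) w) ⟩
      P * w ≡⟨ *-comm P w ⟩
      w * P ≤⟨ *-monoʳ-≤ w (≤-trans (≤-reflexive (trans (sym (*-identityʳ P)) (cong (λ b → P * 𝟙 b) (sym (dec-true (suc k ≤? cnt (good M w) P) many))))) (m≤n+m _ (ρ + k))) ⟩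
      w * (ρ + k + P * 𝟙 (goodLevel M w)) ∎
    ... | no few = ≤-trans (*-cancelˡ-≤ P {{>-nonZero 1≤P}} (begin
      P * levelCount M w
        ≡⟨ sumTo-*ˡ P P _ ⟨
      sumTo P (λ β → P * cnt (λ j → B (point M w β j)) w)
        ≤⟨ sumTo-mono P (λ β _ → each β) ⟩
      sumTo P (λ β → P * w * 𝟙 (good M w β) + ρ * w)
        ≡⟨ trans (sumTo-+ P _ _) (cong₂ _+_ (sumTo-*ˡ P (P * w) _) (sumTo-const P (ρ * w))) ⟩
      P * w * cnt (good M w) P + P * (ρ * w)
        ≤⟨ +-monoˡ-≤ (P * (ρ * w)) (*-monoʳ-≤ (P * w) (s≤s⁻¹ (≰⇒> few))) ⟩
      P * w * k + P * (ρ * w)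
        ≡⟨ eq P w k ρ ⟩
      P * (w * (ρ + k)) ∎)) (*-monoʳ-≤ w (m≤m+n (ρ + k) _))
      where
      eq : ∀ P w k ρ → P * w * k + P * (ρ * w) ≡ P * (w * (ρ + k))
      eq = solve-∀
      each : ∀ β → P * cnt (λ j → B (point M w β j)) w ≤ P * w * 𝟙 (good M w β) + ρ * w
      each β = by (ρ * w ≤? P * cnt (λ j → B (point M w β j)) w)
        where
        by : (d : Dec (ρ * w ≤ P * cnt (λ j → B (point M w β j)) w)) →
          P * cnt (λ j → B (point M w β j)) w ≤ P * w * 𝟙 (does d) + ρ * w
        by (yes _) = ≤-trans (*-monoʳ-≤ P (cnt≤ (λ j → B (point M w β j)) w))
          (≤-trans (≤-reflexive (sym (*-identityʳ (P * w)))) (m≤m+n _ _))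
        by (no ¬p) = ≤-trans (<⇒≤ (≰⇒> ¬p)) (m≤n+m _ _)

    total-upper : ∀ i M → Q * F * total i M ≤ c₉ * unit i * ((ρ + k) * i + P * goodLevels i M)
    total-upper zero    M = ≤-trans (≤-reflexive (*-zeroʳ (Q * F))) z≤n
    total-upper (suc i) M = begin
      Q * F * (levelCount M w + Q * F * total i (M * F))
        ≤⟨ *-monoʳ-≤ (Q * F) (+-mono-≤ (levelCount-upper M w) (total-upper i (M * F))) ⟩
      Q * F * (w * (ρ + k + P * 𝟙 (goodLevel M w)) + w * ((ρ + k) * i + P * goodLevels i (M * F)))
        ≡⟨ eq (Q * F) c₉ (unit i) (ρ + k) P (𝟙 (goodLevel M w)) i (goodLevels i (M * F)) ⟩
      c₉ * (Q * F * unit i) * ((ρ + k) * suc i + P * (𝟙 (goodLevel M w) + goodLevels i (M * F))) ∎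
      where
      w = c₉ * unit i
      eq : ∀ X c u a P g i G → X * (c * u * (a + P * g) + c * u * (a * i + P * G))
        ≡ c * (X * u) * (a * suc i + P * (g + G))
      eq = solve-∀

-- At scale u, blocks have length c₉ u = P⁹ u and cells length Q u = P¹¹ u; δ / Q is the density of
-- the current cell.
module Chain (k ℓ P ρ F c₉ Q : ℕ)
  (1≤k : 1 ≤ k) (ℓ≤k : ℓ ≤ k)
  (sc : ∀ u → 1 ≤ u → Scales P (P * u) (k + ℓ))
  (c₉-def : c₉ ≡ P * (P * (P * (P * P * P * P * P) * P))) (Q-def : Q ≡ P * (P * c₉))
  (1≤P : 1 ≤ P) (1≤c₉ : 1 ≤ c₉) (P≤Q : P ≤ Q)
  (surplus : P + 2 * (2 + (k + ℓ)) ≤ (2 + (k + ℓ)) * ρ)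
  (5≤ρ : 5 ≤ ρ) (4P : ℕ) (4P-def : 4P ≡ 4 * P)
  (1≤F : 1 ≤ F) (F-divisible : ∀ t → 1 ≤ t → t < 4P → t ∣ F)
  (B : Subset) (sumfree : SumFree (suc k) (suc ℓ) B) where

  open ≤-Reasoning

  1≤Q : 1 ≤ Q
  1≤Q = ≤-trans 1≤P P≤Q

  1<4P : 1 < 4P
  1<4P = subst (1 <_) (sym 4P-def) (*-mono-≤ {2} {4} (s≤s (s≤s z≤n)) 1≤P)

  open Levels k P ρ F c₉ Q B public

  1≤unit : ∀ i → 1 ≤ unit i
  1≤unit i = m^n>0 (Q * F) {{>-nonZero (*-mono-≤ 1≤Q 1≤F)}} i

  Cell : (M r n c : ℕ) → Set
  Cell M r n c = c ≤ cnt (λ j → B (r + M * j)) n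

  step : ∀ u → 1 ≤ u → ∀ M r δ → 1 ≤ M → M * (P * (c₉ * u)) < r → ρ * Q ≤ P * δ →
    Cell M r (Q * u) (δ * u) → suc k ≤ cnt (good M (c₉ * u)) P →
    ∃ λ t → ∃ λ p → 1 ≤ t × t < 4P × suc δ * u ≤ Q * cnt (λ j → B (r + M * (p + t * j))) u
  step u 1≤u M r δ 1≤M far δ-large mass many =
    finish _ w-eq far (All.map (good⇒ _) gβ) (All.map (good⇒ _) gγ)
    where
    su = sc u 1≤u
    w-eq : Scales.w su ≡ c₉ * u
    w-eq = trans (cong (λ z → P * (P * z)) (Scales.v-def su))
      (trans (eq P (P * P * P * P * P) u) (cong (_* u) (sym c₉-def)))
      where
      eq : ∀ P q u → P * (P * (P * q * (P * u))) ≡ P * (P * (P * q * P)) * u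
      eq = solve-∀
    good⇒ : ∀ β → good M (c₉ * u) β ≡ true → GoodBlock B M (c₉ * u) P ρ β
    good⇒ β = does-true (ρ * (c₉ * u) ≤? _)
    selβ = select P {good M (c₉ * u)} k (≤-trans (n≤1+n k) many)
    selγ = select P {good M (c₉ * u)} ℓ (≤-trans ℓ≤k (≤-trans (n≤1+n k) many))
    βs = proj₁ selβ
    γs = proj₁ selγ
    gβ = proj₂ (proj₂ (proj₂ (proj₂ selβ)))
    gγ = proj₂ (proj₂ (proj₂ (proj₂ selγ)))
    finish : ∀ w → Scales.w su ≡ w → M * (P * w) < r →
      All (GoodBlock B M w P ρ) βs → All (GoodBlock B M w P ρ) γs →
      ∃ λ t → ∃ λ p → 1 ≤ t × t < 4P × suc δ * u ≤ Q * cnt (λ j → B (r + M * (p + t * j))) u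
    finish _ refl far gβ gγ = let (t , p , 1≤t , t<R , _ , inc) = result in
        t , p , 1≤t , subst (t <_) (trans (Scales.R-def su) (sym 4P-def)) t<R , inc
      where
      reassoc : ∀ P c u → P * (P * c) * u ≡ P * (P * (c * u))
      reassoc = solve-∀
      result = LevelStep.levelStep k ℓ P ρ u Q 1≤u su surplus 5≤ρ
        (trans (cong (_* u) Q-def) (trans (reassoc P c₉ u) (cong (λ z → P * (P * z)) (sym w-eq))))
        B sumfree M 1≤M βs γs (proj₁ (proj₂ selβ)) (proj₁ (proj₂ selγ))
        (proj₁ (proj₂ (proj₂ selβ))) (proj₁ (proj₂ (proj₂ selγ)))
        (proj₁ (proj₂ (proj₂ (proj₂ selβ)))) (proj₁ (proj₂ (proj₂ (proj₂ selγ))))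
        gβ gγ r far δ δ-large mass

  cell-bound : ∀ {u δ} (A : Subset) → 1 ≤ u → δ * u ≤ Q * cnt A u → δ ≤ Q
  cell-bound {u} {δ} A 1≤u le =
    *-cancelʳ-≤ δ Q u {{>-nonZero 1≤u}} (≤-trans le (*-monoʳ-≤ Q (cnt≤ A u)))

  next-far : ∀ i M r → M * (P * (c₉ * unit (suc i))) < r → M * F * (P * (c₉ * unit i)) < r
  next-far i M r = ≤-<-trans (begin
    M * F * (P * (c₉ * unit i)) ≤⟨ m≤n*m _ Q {{>-nonZero 1≤Q}} ⟩
    Q * (M * F * (P * (c₉ * unit i))) ≡⟨ eq Q M F P c₉ (unit i) ⟩
    M * (P * (c₉ * (Q * F * unit i))) ∎)
    where
    eq : ∀ Q M F P c u → Q * (M * F * (P * (c * u))) ≡ M * (P * (c * (Q * F * u)))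
    eq = solve-∀

  -- The invariant is δ plus the number of good levels to come ≤ Q: each of these levels adds 1/Q to
  -- the density of the current cell, which cannot exceed 1.
  ChainAt : ℕ → Set
  ChainAt i = ∀ M r δ → 1 ≤ M → M * (P * (c₉ * unit i)) < r → ρ * Q ≤ P * δ →
    Cell M r (Q * unit i) (δ * unit i) → suc Q ≤ δ + goodLevels (suc i) M → ⊥

  -- The situation between two levels: the cell has been replaced by a progression of difference M t
  -- and length `unit i`, not yet cut down to the modulus `M * F`.
  Continue : ℕ → Set
  Continue i = ∀ M r t δ → 1 ≤ M → 1 ≤ t → t < 4P → M * (P * (c₉ * unit i)) < r → ρ * Q ≤ P * δ →
    δ * unit i ≤ Q * cnt (λ j → B (r + M * (t * j))) (unit i) →
    suc Q ≤ δ + goodLevels i (M * F) → ⊥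

  -- With F = h t, the progression of difference M t splits into h classes of difference M F and
  -- length t Q `unit i`; by `refine` some stretch of length Q `unit i` is at least as dense.
  advance : ∀ i → ChainAt i → ∀ M r t δ → 1 ≤ M → 1 ≤ t → t < 4P → M * F * (P * (c₉ * unit i)) < r → ρ * Q ≤ P * δ →
    δ * unit (suc i) ≤ Q * cnt (λ j → B (r + M * (t * j))) (unit (suc i)) →
    suc Q ≤ δ + goodLevels (suc i) (M * F) → ⊥
  advance i next M r t δ 1≤M 1≤t t<R far δ-large mass enough = split (F-divisible t 1≤t t<R)
    where
    f : Subset
    f j = B (r + M * (t * j))
    positive : ∀ h → 1 ≤ h * t → 1 ≤ h
    positive (suc _) _ = s≤s z≤n
    e₁ : ∀ Q x δ u → Q * (x * (δ * u)) ≡ δ * (Q * x * u)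
    e₁ = solve-∀
    e₂ : ∀ Q h t u → Q * (h * t) * u ≡ h * (t * (Q * u))
    e₂ = solve-∀
    e₃ : ∀ r M t s h j → r + M * (t * (s + h * j)) ≡ r + M * (t * s) + M * (h * t) * j
    e₃ = solve-∀
    average : ∀ h → F ≡ h * t → h * t * (δ * unit i) ≤ cnt f (h * (t * (Q * unit i)))
    average h F≡ht = *-cancelˡ-≤ Q {{>-nonZero 1≤Q}} (begin
      Q * (h * t * (δ * unit i)) ≡⟨ e₁ Q (h * t) δ (unit i) ⟩
      δ * (Q * (h * t) * unit i) ≡⟨ cong (λ z → δ * (Q * z * unit i)) F≡ht ⟨
      δ * unit (suc i) ≤⟨ mass ⟩
      Q * cnt f (unit (suc i))
        ≡⟨ cong (λ z → Q * cnt f z) (trans (cong (λ z → Q * z * unit i) F≡ht) (e₂ Q h t (unit i))) ⟩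
      Q * cnt f (h * (t * (Q * unit i))) ∎)
    subcell : ∀ h → F ≡ h * t → (∃ λ s → δ * unit i ≤ cnt (λ j → f (s + h * j)) (Q * unit i)) → ⊥
    subcell h F≡ht (s , le) = next (M * F) (r + M * (t * s)) δ (*-mono-≤ 1≤M 1≤F)
      (<-≤-trans far (m≤m+n r _)) δ-large
      (≤-trans le (≤-reflexive (sumTo-cong (Q * unit i) λ j _ → cong (𝟙 ∘ B)
        (trans (e₃ r M t s h j) (cong (λ z → r + M * (t * s) + M * z * j) (sym F≡ht)))))) enough
    split : t ∣ F → ⊥
    split (divides h F≡ht) = subcell h F≡ht
      (refine h t (Q * unit i) (δ * unit i) (λ j → 𝟙 (f j)) (positive h (subst (1 ≤_) F≡ht 1≤F)) 1≤t (average h F≡ht))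

  continue-zero : Continue zero
  continue-zero M r t δ 1≤M 1≤t t<R far δ-large mass enough =
    <⇒≱ (subst (Q <_) (+-identityʳ δ) enough)
        (cell-bound (λ j → B (r + M * (t * j))) (1≤unit zero) mass)

  continue-suc : ∀ i → ChainAt i → Continue (suc i)
  continue-suc i next M r t δ 1≤M 1≤t t<R far δ-large mass enough =
    advance i next M r t δ 1≤M 1≤t t<R (next-far i M r far) δ-large mass enough

  level : ∀ i → Continue i → ChainAt i
  level i continue M r δ 1≤M far δ-large mass enough with suc k ≤? cnt (good M (c₉ * unit i)) P
  ... | yes many with step (unit i) (1≤unit i) M r δ 1≤M far δ-large mass many
  ...   | t , p , 1≤t , t<R , inc = continue M (r + M * p) t (suc δ) 1≤M 1≤t t<R
          (<-≤-trans far (m≤m+n r _)) (≤-trans δ-large (*-monoʳ-≤ P (n≤1+n δ)))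
          (≤-trans inc (≤-reflexive (cong (Q *_) (sumTo-cong (unit i) λ j _ → cong (𝟙 ∘ B) (eq r M p (t * j))))))
          (≤-trans enough (≤-trans (+-monoʳ-≤ δ (goodLevels-suc i M)) (≤-reflexive (+-suc δ _))))
    where
    eq : ∀ r M p x → r + M * (p + x) ≡ r + M * p + M * x
    eq = solve-∀
  -- A bad level gives no increment; one of the Q stretches of the cell keeps its density, and t =
  -- 1.
  level i continue M r δ 1≤M far δ-large mass enough | no few
    with sumTo-average Q {λ b → Q * sumTo (unit i) (λ j → 𝟙 (B (r + M * (b * unit i + j))))} (δ * unit i) 1≤Q
           (≤-trans (*-monoʳ-≤ Q mass) (≤-reflexive (trans (cong (Q *_) (sumTo-blocks Q (unit i) _)) (sym (sumTo-*ˡ Q Q _)))))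
  ... | b , _ , le = continue M (r + M * (b * unit i)) 1 δ 1≤M ≤-refl
          1<4P (<-≤-trans far (m≤m+n r _)) δ-large
          (≤-trans le (≤-reflexive (cong (Q *_) (sumTo-cong (unit i) λ j _ → cong (𝟙 ∘ B) (eq r M (b * unit i) j)))))
          (subst (λ z → suc Q ≤ δ + z) (goodLevels-bad i M few) enough)
    where
    eq : ∀ r M p x → r + M * (p + x) ≡ r + M * p + M * (x + 0)
    eq = solve-∀

  chain : ∀ i → ChainAt i
  chain zero    = level zero continue-zero
  chain (suc i) = level (suc i) (continue-suc i (chain i))

  -- The first good level is spent on starting the chain, since one of its good blocks provides a
  -- cell of density ρ/P. At most Q good levels can follow.
  few-good-levels : ∀ i M → 1 ≤ M → goodLevels i M ≤ suc Q
  few-good-levels zero    M 1≤M = z≤n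
  few-good-levels (suc i) M 1≤M with suc k ≤? cnt (good M (c₉ * unit i)) P
  ... | no  few  = subst (_≤ suc Q) (sym (goodLevels-bad i M few)) (few-good-levels i (M * F) (*-mono-≤ 1≤M 1≤F))
  ... | yes many = ≮⇒≥ λ enough → conclude i (s≤s⁻¹ (≤-trans enough (goodLevels-suc i M))) (nonzeroBlock (select P {good M w} 2 (≤-trans (s≤s 1≤k) many)))
    where
    u = unit i
    w = c₉ * u
    -- Block 0 begins at M itself, too early for `far`; any later block begins beyond M w.
    nonzeroBlock : (∃ λ xs → Unique xs × length xs ≡ 2 × All (_< P) xs × All ⟦ good M w ⟧ xs) →
      ∃ λ β → good M w (suc β) ≡ true
    nonzeroBlock (zero ∷ zero ∷ [] , ((0≢0 ∷ _) ∷ _) , _) = ⊥-elim (0≢0 refl)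
    nonzeroBlock (zero ∷ suc b ∷ [] , _ , _ , _ , (_ ∷ g ∷ _)) = b , g
    nonzeroBlock (suc a ∷ _ ∷ [] , _ , _ , _ , (g ∷ _)) = a , g
    -- As Q = P · P · c₉, this is δ/Q = ρ/P.
    δ = ρ * (P * c₉)
    conclude : ∀ i → suc Q ≤ goodLevels i (M * F) →
      (∃ λ β → good M (c₉ * unit i) (suc β) ≡ true) → ⊥
    conclude (suc i') enough (β , g)
      with sumTo-average c₉ {λ b → P * sumTo u' (λ j → 𝟙 (B (point M w' (suc β) (b * u' + j))))} (ρ * u') 1≤c₉
             (≤-trans (≤-reflexive (e₁ c₉ ρ u')) (≤-trans (does-true (ρ * w' ≤? _) g)
               (≤-reflexive (trans (cong (P *_) (sumTo-blocks c₉ u' _)) (sym (sumTo-*ˡ c₉ P _))))))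
      where
      u' = unit (suc i')
      w' = c₉ * u'
      e₁ : ∀ c ρ u → c * (ρ * u) ≡ ρ * (c * u)
      e₁ = solve-∀
    ... | b , _ , le = advance i' (chain i') M (M * suc (w' * suc β + b * u')) 1 δ 1≤M ≤-refl
            1<4P far (≤-reflexive (trans (cong (ρ *_) Q-def) (e₂ ρ P c₉)))
            (begin
              ρ * (P * c₉) * u' ≡⟨ e₃ ρ (P * c₉) u' ⟩
              P * c₉ * (ρ * u') ≤⟨ *-monoʳ-≤ (P * c₉) le ⟩
              P * c₉ * (P * sumTo u' (λ j → 𝟙 (B (point M w' (suc β) (b * u' + j)))))
                ≡⟨ trans (e₄ P c₉ _) (cong (_* sumTo u' (λ j → 𝟙 (B (point M w' (suc β) (b * u' + j))))) (sym Q-def)) ⟩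
              Q * sumTo u' (λ j → 𝟙 (B (point M w' (suc β) (b * u' + j))))
                ≡⟨ cong (Q *_) (sumTo-cong u' λ j _ → cong (𝟙 ∘ B) (e₅ M (w' * suc β) (b * u') j)) ⟩
              Q * cnt (λ j → B (M * suc (w' * suc β + b * u') + M * (1 * j))) u' ∎)
            (≤-trans enough (m≤n+m _ δ))
      where
      u' = unit (suc i')
      w' = c₉ * u'
      e₂ : ∀ ρ P c → ρ * (P * (P * c)) ≡ P * (ρ * (P * c))
      e₂ = solve-∀
      e₃ : ∀ ρ x u → ρ * x * u ≡ x * (ρ * u)
      e₃ = solve-∀
      e₄ : ∀ P c s → P * c * (P * s) ≡ P * (P * c) * s
      e₄ = solve-∀
      e₅ : ∀ M a b j → M * suc (a + (b + j)) ≡ M * suc (a + b) + M * (1 * j)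
      e₅ = solve-∀
      e₆ : ∀ M F Q c u → M * F * (Q * (c * u)) ≡ M * (c * (Q * F * u))
      e₆ = solve-∀
      far : M * F * (P * (c₉ * unit i')) < M * suc (w' * suc β + b * u')
      far = begin-strict
        M * F * (P * (c₉ * unit i')) ≤⟨ *-monoʳ-≤ (M * F) (*-monoˡ-≤ _ P≤Q) ⟩
        M * F * (Q * (c₉ * unit i')) ≡⟨ e₆ M F Q c₉ (unit i') ⟩
        M * w' <⟨ *-monoʳ-< M {{>-nonZero 1≤M}} (s≤s (≤-trans (m≤m*n w' (suc β)) (m≤m+n _ (b * u')))) ⟩
        M * suc (w' * suc β + b * u') ∎

-- Averaging over dilations

sumOver : List ℕ → (ℕ → ℕ) → ℕ
sumOver []       f = 0
sumOver (x ∷ xs) f = f x + sumOver xs f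

sumOver-mono : ∀ {xs} {f g : ℕ → ℕ} → All (λ x → f x ≤ g x) xs → sumOver xs f ≤ sumOver xs g
sumOver-mono []       = z≤n
sumOver-mono (p ∷ ps) = +-mono-≤ p (sumOver-mono ps)

sumOver-const : ∀ xs c → sumOver xs (λ _ → c) ≡ length xs * c
sumOver-const []       c = refl
sumOver-const (x ∷ xs) c = cong (c +_) (sumOver-const xs c)

sumOver-*ˡ : ∀ xs c (f : ℕ → ℕ) → sumOver xs (λ x → c * f x) ≡ c * sumOver xs f
sumOver-*ˡ []       c f = sym (*-zeroʳ c)
sumOver-*ˡ (x ∷ xs) c f = trans (cong (c * f x +_) (sumOver-*ˡ xs c f)) (sym (*-distribˡ-+ c (f x) _))

sumOver-+ : ∀ xs (f g : ℕ → ℕ) → sumOver xs (λ x → f x + g x) ≡ sumOver xs f + sumOver xs g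
sumOver-+ []       f g = refl
sumOver-+ (x ∷ xs) f g = trans (cong (f x + g x +_) (sumOver-+ xs f g))
  (interchange (f x) (g x) (sumOver xs f) (sumOver xs g))
  where
  interchange : ∀ a b c d → a + b + (c + d) ≡ a + c + (b + d)
  interchange = solve-∀

sumOver-sumTo : ∀ xs n (f : ℕ → ℕ → ℕ) →
  sumOver xs (λ x → sumTo n (f x)) ≡ sumTo n (λ i → sumOver xs (λ x → f x i))
sumOver-sumTo []       n f = sym (trans (sumTo-const n 0) (*-zeroʳ n))
sumOver-sumTo (x ∷ xs) n f = trans (cong (sumTo n (f x) +_) (sumOver-sumTo xs n f))
  (sym (sumTo-+ n (f x) _))

module Averaging (k P ρ F c₉ Q : ℕ) (1≤P : 1 ≤ P) (1≤c₉ : 1 ≤ c₉) (1≤Q : 1 ≤ Q) (1≤F : 1 ≤ F)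
  (base : List ℕ) (B : ℕ → Subset) (s Jmax : ℕ)
  (hits : ∀ j → 1 ≤ j → j ≤ Jmax → s ≤ sumOver base (λ x → 𝟙 (B x j))) where

  open ≤-Reasoning
  module Lv x = Levels k P ρ F c₉ Q (B x)

  unit : ℕ → ℕ
  unit i = (Q * F) ^ i

  levelCount-lower : ∀ M w → 1 ≤ M → M * (P * w) ≤ Jmax →
    w * (P * s) ≤ sumOver base (λ x → Lv.levelCount x M w)
  levelCount-lower M w 1≤M le = begin
    w * (P * s) ≡⟨ eq w P s ⟩
    P * (w * s)
      ≤⟨ sumTo-≥const P (w * s) (λ β β<P → sumTo-≥const w s (λ j j<w →
           hits (point M w β j) (*-mono-≤ 1≤M (s≤s z≤n))
             (≤-trans (Slots.point-bound (λ _ → true) M w 1≤M β<P j<w) le))) ⟩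
    sumTo P (λ β → sumTo w (λ j → sumOver base (λ x → 𝟙 (B x (point M w β j)))))
      ≡⟨ sumTo-cong P (λ β _ → sym (sumOver-sumTo base w (λ x j → 𝟙 (B x (point M w β j))))) ⟩
    sumTo P (λ β → sumOver base (λ x → cnt (λ j → B x (point M w β j)) w))
      ≡⟨ sumOver-sumTo base P (λ x β → cnt (λ j → B x (point M w β j)) w) ⟨
    sumOver base (λ x → Lv.levelCount x M w) ∎
    where
    eq : ∀ w P s → w * (P * s) ≡ P * (w * s)
    eq = solve-∀

  total-lower : ∀ i M → 1 ≤ M → M * (P * (c₉ * unit i)) ≤ Jmax →
    c₉ * unit i * (i * (P * s)) ≤ Q * F * sumOver base (λ x → Lv.total x i M)
  total-lower zero    M 1≤M le = ≤-trans (≤-reflexive (*-zeroʳ (c₉ * unit 0))) z≤n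
  total-lower (suc i) M 1≤M le = begin
    c₉ * (Q * F * unit i) * (suc i * (P * s))
      ≡⟨ e₁ c₉ (Q * F) (unit i) i (P * s) ⟩
    Q * F * (c₉ * unit i * (P * s) + c₉ * unit i * (i * (P * s)))
      ≤⟨ *-monoʳ-≤ (Q * F) (+-mono-≤
           (levelCount-lower M (c₉ * unit i) 1≤M (≤-trans (*-monoʳ-≤ M (*-monoʳ-≤ P (*-monoʳ-≤ c₉ (m≤n*m (unit i) (Q * F) {{>-nonZero (*-mono-≤ 1≤Q 1≤F)}})))) le))
           (total-lower i (M * F) (*-mono-≤ 1≤M 1≤F) (≤-trans (≤-trans (m≤n*m _ Q {{>-nonZero 1≤Q}}) (≤-reflexive (e₂ Q M F P c₉ (unit i)))) le))) ⟩
    Q * F * (sumOver base (λ x → Lv.levelCount x M (c₉ * unit i)) + Q * F * sumOver base (λ x → Lv.total x i (M * F)))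
      ≡⟨ cong (λ z → Q * F * (sumOver base (λ x → Lv.levelCount x M (c₉ * unit i)) + z)) (sym (sumOver-*ˡ base (Q * F) _)) ⟩
    Q * F * (sumOver base (λ x → Lv.levelCount x M (c₉ * unit i)) + sumOver base (λ x → Q * F * Lv.total x i (M * F)))
      ≡⟨ cong (Q * F *_) (sym (sumOver-+ base _ _)) ⟩
    Q * F * sumOver base (λ x → Lv.total x (suc i) M) ∎
    where
    e₁ : ∀ c X u i y → c * (X * u) * (suc i * y) ≡ X * (c * u * y + c * u * (i * y))
    e₁ = solve-∀
    e₂ : ∀ Q M F P c u → Q * (M * F * (P * (c * u))) ≡ M * (P * (c * (Q * F * u)))
    e₂ = solve-∀

  module _ (T : ℕ) (T-def : T ≡ P * suc Q) (in-range : 1 * (P * (c₉ * unit T)) ≤ Jmax)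
    (few : All (λ x → Lv.goodLevels x T 1 ≤ suc Q) base) where

    -- A good level adds at most P to the bound, and at most Q + 1 of the T = P (Q + 1) levels are
    -- good, so on average they add 1.
    average-bound : P * s ≤ length base * (ρ + k + 1)
    average-bound = *-cancelˡ-≤ T {{>-nonZero 1≤T}} (*-cancelˡ-≤ (c₉ * unit T) {{>-nonZero 1≤cu}} (begin
      c₉ * unit T * (T * (P * s)) ≤⟨ total-lower T 1 ≤-refl in-range ⟩
      Q * F * sumOver base (λ x → Lv.total x T 1) ≡⟨ sumOver-*ˡ base (Q * F) _ ⟨
      sumOver base (λ x → Q * F * Lv.total x T 1)
        ≤⟨ sumOver-mono (All.map (λ {x} few-x → ≤-trans (Lv.total-upper x 1≤P T 1)
             (*-monoʳ-≤ (c₉ * unit T) (+-monoʳ-≤ ((ρ + k) * T) (≤-trans (*-monoʳ-≤ P few-x) (≤-reflexive (sym T-def)))))) few) ⟩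
      sumOver base (λ _ → c₉ * unit T * ((ρ + k) * T + T)) ≡⟨ sumOver-const base _ ⟩
      length base * (c₉ * unit T * ((ρ + k) * T + T)) ≡⟨ eq (length base) (c₉ * unit T) (ρ + k) T ⟩
      c₉ * unit T * (T * (length base * (ρ + k + 1))) ∎))
      where
      1≤T : 1 ≤ T
      1≤T = subst (1 ≤_) (sym T-def) (*-mono-≤ 1≤P (s≤s z≤n))
      1≤cu : 1 ≤ c₉ * unit T
      1≤cu = *-mono-≤ 1≤c₉ (m^n>0 (Q * F) {{>-nonZero (*-mono-≤ 1≤Q 1≤F)}} T)
      eq : ∀ n x a T → n * (x * (a * T + T)) ≡ x * (T * (n * (a + 1)))
      eq = solve-∀

-- An almost multiplicatively invariant set

Unique-⊆-length : ∀ {xs ys : List ℕ} → Unique xs → (∀ {z} → z ∈ xs → z ∈ ys) → length xs ≤ length ys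
Unique-⊆-length {[]}     {ys} _ _ = z≤n
Unique-⊆-length {x ∷ xs} {ys} (x∉xs ∷ uxs) sub with ∈-∃++ (sub (here refl))
... | as , bs , refl = ≤-trans (s≤s (Unique-⊆-length uxs sub'))
        (≤-reflexive (trans (cong suc (length-++ as)) (trans (sym (+-suc (length as) (length bs))) (sym (length-++ as)))))
  where
  sub' : ∀ {z} → z ∈ xs → z ∈ as ++ bs
  sub' z∈xs with ∈-++⁻ as (sub (there z∈xs))
  ... | inj₁ z∈as = ∈-++⁺ˡ z∈as
  ... | inj₂ (here refl) = ⊥-elim (All.lookup x∉xs z∈xs refl)
  ... | inj₂ (there z∈bs) = ∈-++⁺ʳ as z∈bs

sum-map-* : ∀ c xs → sum (map (c *_) xs) ≡ c * sum xs
sum-map-* c []       = sym (*-zeroʳ c)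
sum-map-* c (x ∷ xs) = trans (cong (c * x +_) (sum-map-* c xs)) (sym (*-distribˡ-+ c x (sum xs)))

-- Taking i to be a power of two reduces the claim to a comparison of exponents.
exponential-beats-polynomial : ∀ c r → 1 ≤ c → ∃ λ i → suc (c * i) ^ r < 2 ^ i
exponential-beats-polynomial c r 1≤c = i , (begin-strict
  suc (c * i) ^ r ≤⟨ ^-monoˡ-≤ r base ⟩
  (2 ^ (1 + c + j)) ^ r ≡⟨ ^-*-assoc 2 (1 + c + j) r ⟩
  2 ^ ((1 + c + j) * r) <⟨ ^-monoʳ-< 2 (s≤s (s≤s z≤n)) exponent ⟩
  2 ^ i ∎)
  where
  open ≤-Reasoning
  m j i : ℕ
  m = suc (r * (c + 3))
  j = m + m
  i = 2 ^ j
  n≤2^n : ∀ n → suc n ≤ 2 ^ n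
  n≤2^n zero    = ≤-refl
  n≤2^n (suc n) = ≤-trans (+-mono-≤ (m^n>0 2 n) (n≤2^n n)) (≤-reflexive (cong (2 ^ n +_) (sym (+-identityʳ _))))
  base : suc (c * i) ≤ 2 ^ (1 + c + j)
  base = begin
    suc (c * i) ≤⟨ +-monoˡ-≤ (c * i) (*-mono-≤ 1≤c (m^n>0 2 j)) ⟩
    c * i + c * i ≡⟨ cong (c * i +_) (sym (+-identityʳ _)) ⟩
    2 * (c * i) ≤⟨ *-monoʳ-≤ 2 (*-monoˡ-≤ i (<⇒≤ (n≤2^n c))) ⟩
    2 * (2 ^ c * 2 ^ j) ≡⟨ cong (2 *_) (sym (^-distribˡ-+-* 2 c j)) ⟩
    2 ^ (1 + c + j) ∎
  exponent : (1 + c + j) * r < i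
  exponent = begin-strict
    (1 + c + (m + m)) * r ≡⟨ e₁ c m r ⟩
    (1 + c) * r + 2 * m * r ≤⟨ +-monoˡ-≤ (2 * m * r) (m≤n*m ((1 + c) * r) m) ⟩
    m * ((1 + c) * r) + 2 * m * r ≡⟨ e₂ m c r ⟩
    m * (r * (c + 3)) <⟨ *-monoʳ-< m (n<1+n _) ⟩
    m * m ≤⟨ *-mono-≤ (<⇒≤ (n≤2^n m)) (<⇒≤ (n≤2^n m)) ⟩
    2 ^ m * 2 ^ m ≡⟨ ^-distribˡ-+-* 2 m m ⟨
    i ∎
    where
    e₁ : ∀ c m r → (1 + c + (m + m)) * r ≡ (1 + c) * r + 2 * m * r
    e₁ = solve-∀
    e₂ : ∀ m c r → m * ((1 + c) * r) + 2 * m * r ≡ m * (r * (c + 3))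
    e₂ = solve-∀

-- Growth by a factor 1 + 1/c at every step would double g within c steps (Bernoulli), so that g (i
-- c) ≥ 2^i, against the polynomial bound.
slow-step : ∀ (g : ℕ → ℕ) c r → 1 ≤ c → (∀ n → g n ≤ g (suc n)) → 1 ≤ g 0 → (∀ n → g n ≤ suc n ^ r) →
  ∃ λ n → c * g (suc n) ≤ suc c * g n
slow-step g c r 1≤c mono 1≤g₀ poly with exponential-beats-polynomial c r 1≤c
... | i , big with bounded-search (i * c) {λ n → c * g (suc n) ≤ suc c * g n} (λ n → c * g (suc n) ≤? suc c * g n)
...   | inj₁ (n , _ , p) = n , p
...   | inj₂ none = ⊥-elim (<⇒≱ big (≤-trans (doubling i ≤-refl)
          (≤-trans (poly (i * c)) (≤-reflexive (cong (λ z → suc z ^ r) (*-comm i c))))))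
  where
  open ≤-Reasoning
  fast : ∀ n → n < i * c → suc c * g n ≤ c * g (suc n)
  fast n n< = <⇒≤ (≰⇒> (none n n<))
  mono* : ∀ n a → g n ≤ g (n + a)
  mono* n zero    = ≤-reflexive (cong g (sym (+-identityʳ n)))
  mono* n (suc a) = ≤-trans (mono* n a) (≤-trans (mono (n + a)) (≤-reflexive (cong g (sym (+-suc n a)))))
  linear : ∀ n a → n + a ≤ i * c → (c + a) * g n ≤ c * g (n + a)
  linear n zero    _ = ≤-reflexive (cong₂ _*_ (+-identityʳ c) (cong g (sym (+-identityʳ n))))
  linear n (suc a) le = begin
    (c + suc a) * g n ≡⟨ cong (_* g n) (+-suc c a) ⟩
    g n + (c + a) * g n ≤⟨ +-mono-≤ (mono* n a) (linear n a (<⇒≤ le')) ⟩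
    suc c * g (n + a) ≤⟨ fast (n + a) le' ⟩
    c * g (suc (n + a)) ≡⟨ cong (λ z → c * g z) (+-suc n a) ⟨
    c * g (n + suc a) ∎
    where
    le' : n + a < i * c
    le' = ≤-trans (≤-reflexive (sym (+-suc n a))) le
  doubling : ∀ a → a ≤ i → 2 ^ a ≤ g (a * c)
  doubling zero    _ = 1≤g₀
  doubling (suc a) a<i = *-cancelˡ-≤ c {{>-nonZero 1≤c}} (begin
    c * (2 * 2 ^ a) ≡⟨ eq c (2 ^ a) ⟩
    (c + c) * 2 ^ a ≤⟨ *-monoʳ-≤ (c + c) (doubling a (<⇒≤ a<i)) ⟩
    (c + c) * g (a * c) ≤⟨ linear (a * c) c (≤-trans (≤-reflexive (+-comm (a * c) c)) (*-monoˡ-≤ c a<i)) ⟩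
    c * g (a * c + c) ≡⟨ cong (λ z → c * g z) (+-comm (a * c) c) ⟩
    c * g (suc a * c) ∎)
    where
    eq : ∀ c x → c * (2 * x) ≡ (c + c) * x
    eq = solve-∀

-- One entry per exponent vector, so that the length is exactly (n + 1) to the power |js|;
-- coinciding products are merged in `box`.
products : List ℕ → ℕ → List ℕ
products []       n = 1 ∷ []
products (j ∷ js) n = cartesianProductWith (λ e z → j ^ e * z) (upTo (suc n)) (products js n)

length-cartesianProductWith : ∀ {A B C : Set} (f : A → B → C) xs ys →
  length (cartesianProductWith f xs ys) ≡ length xs * length ys
length-cartesianProductWith f []       ys = refl
length-cartesianProductWith f (x ∷ xs) ys = trans (length-++ (map (f x) ys))
  (cong₂ _+_ (length-map (f x) ys) (length-cartesianProductWith f xs ys))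

length-products : ∀ js n → length (products js n) ≡ suc n ^ length js
length-products []       n = refl
length-products (j ∷ js) n = trans (length-cartesianProductWith _ (upTo (suc n)) (products js n))
  (cong₂ _*_ (length-upTo (suc n)) (length-products js n))

products-mono : ∀ js n {z} → z ∈ products js n → z ∈ products js (suc n)
products-mono []       n z∈ = z∈
products-mono (j ∷ js) n z∈ with ∈-cartesianProductWith⁻ _ (upTo (suc n)) (products js n) z∈
... | e , y , e∈ , y∈ , refl =
  ∈-cartesianProductWith⁺ _ (∈-upTo⁺ (m<n⇒m<1+n (∈-upTo⁻ e∈))) (products-mono js n y∈)

products-* : ∀ js n {j z} → j ∈ js → z ∈ products js n → j * z ∈ products js (suc n)
products-* (j ∷ js) n j∈ z∈ with ∈-cartesianProductWith⁻ _ (upTo (suc n)) (products js n) z∈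
products-* (j ∷ js) n (here refl) z∈ | e , y , e∈ , y∈ , refl =
  subst (_∈ products (j ∷ js) (suc n)) (*-assoc j (j ^ e) y)
    (∈-cartesianProductWith⁺ _ (∈-upTo⁺ (s≤s (∈-upTo⁻ e∈))) (products-mono js n y∈))
products-* (j ∷ js) n {j'} (there j'∈) z∈ | e , y , e∈ , y∈ , refl =
  subst (_∈ products (j ∷ js) (suc n)) (swap (j ^ e) j' y)
    (∈-cartesianProductWith⁺ _ (∈-upTo⁺ (m<n⇒m<1+n (∈-upTo⁻ e∈))) (products-* js n j'∈ y∈))
  where
  swap : ∀ a b c → a * (b * c) ≡ b * (a * c)
  swap = solve-∀

products-positive : ∀ js n → All (1 ≤_) js → ∀ {z} → z ∈ products js n → 1 ≤ z
products-positive []       n [] (here refl) = ≤-refl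
products-positive (j ∷ js) n (1≤j ∷ 1≤js) z∈ with ∈-cartesianProductWith⁻ _ (upTo (suc n)) (products js n) z∈
... | e , y , _ , y∈ , refl = *-mono-≤ (m^n>0 j {{>-nonZero 1≤j}} e) (products-positive js n 1≤js y∈)

hitCount : List ℕ → List ℕ → ℕ → ℕ
hitCount S base j = sumOver base (λ x → 𝟙 (does (x * j ∈? S)))

filter-hits : ∀ S base j →
  length (filter (λ x → ¬? (x * j ∈? S)) base) + hitCount S base j ≡ length base
filter-hits S []         j = refl
filter-hits S (x ∷ base) j with x * j ∈? S
... | yes _ = trans (+-suc _ _) (cong suc (filter-hits S base j))
... | no  _ = cong suc (filter-hits S base j)

-- The products x j that miss S, together with S itself, are distinct elements of `full`.
many-hits : ∀ {S base full j} → 1 ≤ j → Unique S → Unique base →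
  (∀ {z} → z ∈ S → z ∈ full) → (∀ {z} → z ∈ base → z * j ∈ full) →
  length S + length base ≤ length full + hitCount S base j
many-hits {S} {base} {full} {j} 1≤j uS ub S⊆ closed = begin
  length S + length base
    ≡⟨ cong (length S +_) (sym (filter-hits S base j)) ⟩
  length S + (length missed + hitCount S base j)
    ≡⟨ rearrange (length S) (length missed) (hitCount S base j) ⟩
  length missed + length S + hitCount S base j
    ≤⟨ +-monoˡ-≤ (hitCount S base j) bound ⟩
  length full + hitCount S base j ∎
  where
  open ≤-Reasoning
  missed = filter (λ x → ¬? (x * j ∈? S)) base
  rearrange : ∀ a b c → a + (b + c) ≡ b + a + c
  rearrange = solve-∀
  disjoint : ∀ {z} → z ∈ map (_* j) missed × z ∈ S → ⊥
  disjoint (p , q) with ∈-map⁻ (_* j) p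
  ... | x , x∈ , refl = proj₂ (∈-filter⁻ (λ x → ¬? (x * j ∈? S)) {xs = base} x∈) q
  sub : ∀ {z} → z ∈ map (_* j) missed ++ S → z ∈ full
  sub z∈ with ∈-++⁻ (map (_* j) missed) z∈
  ... | inj₂ q = S⊆ q
  ... | inj₁ p with ∈-map⁻ (_* j) p
  ...   | x , x∈ , refl = closed (proj₁ (∈-filter⁻ (λ x → ¬? (x * j ∈? S)) {xs = base} x∈))
  bound : length missed + length S ≤ length full
  bound = begin
    length missed + length S ≡⟨ cong (_+ length S) (length-map (_* j) missed) ⟨
    length (map (_* j) missed) + length S ≡⟨ length-++ (map (_* j) missed) ⟨
    length (map (_* j) missed ++ S)
      ≤⟨ Unique-⊆-length (Unique.++⁺ (Unique.map⁺ (*-cancelʳ-≡ _ _ j {{>-nonZero 1≤j}}) (Unique.filter⁺ _ ub)) uS disjoint) sub ⟩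
    length full ∎

dilation-SumFree : ∀ {k ℓ S x} → 1 ≤ x → RestrictedSumFree k ℓ S → SumFree k ℓ (λ j → does (x * j ∈? S))
dilation-SumFree {S = S} {x} 1≤x sf as bs uas as∈ las ubs bs∈ lbs eq = sf (map (x *_) as) (map (x *_) bs)
  (distinct uas as∈ las) (distinct ubs bs∈ lbs)
  (trans (sum-map-* x as) (trans (cong (x *_) eq) (sym (sum-map-* x bs))))
  where
  distinct : ∀ {m as} → Unique as → All ⟦ (λ j → does (x * j ∈? S)) ⟧ as → length as ≡ m →
    DistinctElems m S (map (x *_) as)
  distinct {as = as} uas as∈ las = Unique.map⁺ (*-cancelˡ-≡ _ _ x {{>-nonZero 1≤x}}) uas
    , Allₚ.map⁺ (All.map (λ {a} → does-true (x * a ∈? S)) as∈) , trans (length-map (x *_) as) las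

∣-factorial : ∀ n t → 1 ≤ t → t < n → t ∣ n !
∣-factorial n (suc t) _ t<n = ∣-trans (m∣m*n (t !)) (m≤n⇒m!∣n! (<⇒≤ t<n))

-- Here k and ℓ stand for the paper's k − 1 and ℓ − 1.
module Extremal (k ℓ p₀ : ℕ) (1≤k : 1 ≤ k) (ℓ≤k : ℓ ≤ k) (164≤p₀ : 164 ≤ p₀) where

  P ρ c₉ Q F T Jmax : ℕ
  P = (2 + (k + ℓ)) * p₀
  -- Chosen so that ρ/P = 1/(k + ℓ + 2) + 2/P, which is `surplus` with equality.
  ρ = p₀ + 2
  c₉ = P * (P * (P * (P * P * P * P * P) * P))
  Q = P * (P * c₉)
  F = (4 * P) !
  T = P * suc Q
  Jmax = 1 * (P * (c₉ * (Q * F) ^ T))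

  abstract
    P-large : 164 * (2 + (k + ℓ)) ≤ P
    P-large = ≤-trans (≤-reflexive (*-comm 164 (2 + (k + ℓ)))) (*-monoʳ-≤ (2 + (k + ℓ)) 164≤p₀)

    1≤P : 1 ≤ P
    1≤P = *-mono-≤ {1} {2 + (k + ℓ)} (s≤s z≤n) (≤-trans (s≤s z≤n) 164≤p₀)

    1≤c₉ : 1 ≤ c₉
    1≤c₉ = *-mono-≤ 1≤P (*-mono-≤ 1≤P (*-mono-≤ (*-mono-≤ 1≤P (*-mono-≤ (*-mono-≤ (*-mono-≤ (*-mono-≤ 1≤P 1≤P) 1≤P) 1≤P) 1≤P)) 1≤P))

    P≤Q : P ≤ Q
    P≤Q = m≤m*n P (P * c₉) {{>-nonZero (*-mono-≤ 1≤P 1≤c₉)}}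

    1≤F : 1 ≤ F
    1≤F = 1≤n! (4 * P)

    surplus : P + 2 * (2 + (k + ℓ)) ≤ (2 + (k + ℓ)) * ρ
    surplus = ≤-reflexive (eq (2 + (k + ℓ)) p₀)
      where
      eq : ∀ K p → K * p + 2 * K ≡ K * (p + 2)
      eq = solve-∀

    5≤ρ : 5 ≤ ρ
    5≤ρ = ≤-trans (≤-trans (s≤s (s≤s (s≤s (s≤s (s≤s z≤n))))) 164≤p₀) (m≤m+n p₀ 2)

  js : List ℕ
  js = map suc (upTo Jmax)

  js-positive : All (1 ≤_) js
  js-positive = Allₚ.map⁺ (All.universal (λ _ → s≤s z≤n) (upTo Jmax))

  box : ℕ → List ℕ
  box n = deduplicate _≟_ (products js n)

  box-mono : ∀ n {z} → z ∈ box n → z ∈ box (suc n)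
  box-mono n z∈ = ∈-deduplicate⁺ _≟_ (products-mono js n (∈-deduplicate⁻ _≟_ (products js n) z∈))

  box-* : ∀ n j → 1 ≤ j → j ≤ Jmax → ∀ {z} → z ∈ box n → z * j ∈ box (suc n)
  box-* n (suc j) _ j≤ {z} z∈ = subst (_∈ box (suc n)) (*-comm (suc j) z)
    (∈-deduplicate⁺ _≟_ (products-* js n (∈-map⁺ suc (∈-upTo⁺ j≤)) (∈-deduplicate⁻ _≟_ (products js n) z∈)))

  box-unique : ∀ n → Unique (box n)
  box-unique n = deduplicate-! (products js n)

  box-positive : ∀ n → All (1 ≤_) (box n)
  box-positive n = All.tabulate λ z∈ → products-positive js n js-positive (∈-deduplicate⁻ _≟_ (products js n) z∈)

  1∈products : ∀ js n → 1 ∈ products js n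
  1∈products []       n = here refl
  1∈products (j ∷ js) n = ∈-cartesianProductWith⁺ (λ e z → j ^ e * z) {a = 0} {b = 1} (∈-upTo⁺ {suc n} (s≤s z≤n)) (1∈products js n)

  1≤length-box : ∀ n → 1 ≤ length (box n)
  1≤length-box n = ∈-length (∈-deduplicate⁺ _≟_ (1∈products js n))

  -- Polynomial growth of the boxes yields one which is almost invariant under all j ≤ Jmax.
  thin : ∃ λ n → P * length (box (suc n)) ≤ suc P * length (box n)
  thin = slow-step (length ∘ box) P (length js) 1≤P
    (λ n → Unique-⊆-length (box-unique n) (box-mono n)) (1≤length-box 0)
    (λ n → ≤-trans (length-deduplicate _≟_ (products js n)) (≤-reflexive (length-products js n)))

  L : ℕ
  L = proj₁ thin

  base full : List ℕ
  base = box L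
  full = box (suc L)

  module _ (S : List ℕ) (uS : Unique S) (S⊆ : All (_∈ full) S)
    (sf : RestrictedSumFree (suc k) (suc ℓ) S) where

    B : ℕ → Subset
    B x j = does (x * j ∈? S)

    s : ℕ
    s = length S + length base ∸ length full

    hits : ∀ j → 1 ≤ j → j ≤ Jmax → s ≤ sumOver base (λ x → 𝟙 (B x j))
    hits j 1≤j j≤ = m≤n+o⇒m∸n≤o (length S + length base) (length full)
      (many-hits 1≤j uS (box-unique L) (All.lookup S⊆) (box-* L j 1≤j j≤))

    few : All (λ x → Levels.goodLevels k P ρ F c₉ Q (B x) T 1 ≤ suc Q) base
    few = All.map (λ {x} 1≤x → Chain.few-good-levels k ℓ P ρ F c₉ Q 1≤k ℓ≤k
        (λ u 1≤u → scales P (P * u) (k + ℓ) (*-mono-≤ 1≤P 1≤u) P-large) refl refl 1≤P 1≤c₉ P≤Q surplus 5≤ρ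
        (4 * P) refl 1≤F (∣-factorial (4 * P)) (B x) (dilation-SumFree 1≤x sf) T 1 ≤-refl)
      (box-positive L)

    -- p₀ + k + 4 = (ρ + k + 1) + 1: the average over the levels, and one more for the growth from
    -- `base` to `full`.
    extremal-bound : P * length S ≤ length full * (p₀ + k + 4)
    extremal-bound = begin
      P * length S ≤⟨ +-cancelʳ-≤ (P * length base) _ _ main ⟩
      length base * (ρ + k + 1) + length base ≡⟨ e₂ (length base) p₀ k ⟩
      length base * (p₀ + k + 4) ≤⟨ *-monoˡ-≤ (p₀ + k + 4) (Unique-⊆-length (box-unique L) (box-mono L)) ⟩
      length full * (p₀ + k + 4) ∎
      where
      open ≤-Reasoning
      e₁ : ∀ x P b → x + (b + P * b) ≡ x + b + P * b
      e₁ = solve-∀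
      e₂ : ∀ b p k → b * (p + 2 + k + 1) + b ≡ b * (p + k + 4)
      e₂ = solve-∀
      main : P * length S + P * length base ≤ length base * (ρ + k + 1) + length base + P * length base
      main = begin
        P * length S + P * length base ≡⟨ *-distribˡ-+ P (length S) (length base) ⟨
        P * (length S + length base) ≤⟨ *-monoʳ-≤ P (m≤n+m∸n (length S + length base) (length full)) ⟩
        P * (length full + s) ≡⟨ trans (*-distribˡ-+ P (length full) s) (+-comm (P * length full) (P * s)) ⟩
        P * s + P * length full
          ≤⟨ +-mono-≤ (Averaging.average-bound k P ρ F c₉ Q 1≤P 1≤c₉ (≤-trans 1≤P P≤Q) 1≤F base B s Jmax hits
                         T refl ≤-refl few) (proj₂ thin) ⟩
        length base * (ρ + k + 1) + suc P * length base ≡⟨ e₁ (length base * (ρ + k + 1)) P (length base) ⟩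
        length base * (ρ + k + 1) + length base + P * length base ∎

almost-invariant-set : ∀ k ℓ p₀ → 1 ≤ k → ℓ ≤ k → 164 ≤ p₀ →
  ∃ λ F → Unique F × All (1 ≤_) F × 1 ≤ length F ×
  (∀ S → Unique S → All (_∈ F) S → RestrictedSumFree (suc k) (suc ℓ) S →
    (2 + (k + ℓ)) * p₀ * length S ≤ length F * (p₀ + k + 4))
almost-invariant-set k ℓ p₀ 1≤k ℓ≤k 164≤p₀ =
  full , box-unique (suc L) , box-positive (suc L) , 1≤length-box (suc L) , extremal-bound
  where open Extremal k ℓ p₀ 1≤k ℓ≤k 164≤p₀

-- Sets of every size

filter-complement : ∀ {P : ℕ → Set} (P? : Decidable P) xs →
  length (filter P? xs) + length (filter (¬? ∘ P?) xs) ≡ length xs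
filter-complement P? []       = refl
filter-complement P? (x ∷ xs) with P? x
... | yes _ = cong suc (filter-complement P? xs)
... | no  _ = trans (+-suc _ _) (cong suc (filter-complement P? xs))

RestrictedSumFree-⊆ : ∀ {k ℓ S S'} → (∀ {z} → z ∈ S' → z ∈ S) → RestrictedSumFree k ℓ S → RestrictedSumFree k ℓ S'
RestrictedSumFree-⊆ sub sf as bs (ua , as∈ , la) (ub , bs∈ , lb) =
  sf as bs (ua , All.map sub as∈ , la) (ub , All.map sub bs∈ , lb)

∈⇒≤sum : ∀ {z xs} → z ∈ xs → z ≤ sum xs
∈⇒≤sum {xs = x ∷ xs} (here refl) = m≤m+n x (sum xs)
∈⇒≤sum {xs = x ∷ xs} (there z∈)  = ≤-trans (∈⇒≤sum z∈) (m≤n+m (sum xs) x)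

∈-take : ∀ n {z} {xs : List ℕ} → z ∈ take n xs → z ∈ xs
∈-take (suc n) {xs = x ∷ xs} (here refl) = here refl
∈-take (suc n) {xs = x ∷ xs} (there z∈)  = there (∈-take n z∈)

module BlowUp (k ℓ a b : ℕ) (F : List ℕ) (uF : Unique F) (F-positive : All (1 ≤_) F)
  (F-bound : ∀ S → Unique S → All (_∈ F) S → RestrictedSumFree k ℓ S → length S * a ≤ length F * b) where

  open ≤-Reasoning

  -- Larger than every element of F, so the dilate by c^s lies in [c^s, c^(s+1)) and distinct
  -- dilates are disjoint.
  c : ℕ
  c = suc (sum F)

  1≤c^ : ∀ s → 1 ≤ c ^ s
  1≤c^ s = m^n>0 c s

  dilate : ℕ → List ℕ
  dilate s = map (c ^ s *_) F

  blocks : ℕ → List ℕ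
  blocks zero    = []
  blocks (suc s) = dilate s ++ blocks s

  dilate-low : ∀ s {z} → z ∈ dilate s → c ^ s ≤ z
  dilate-low s z∈ with ∈-map⁻ (c ^ s *_) z∈
  ... | x , x∈ , refl = m≤m*n (c ^ s) x {{>-nonZero (All.lookup F-positive x∈)}}

  dilate-high : ∀ s {z} → z ∈ dilate s → z < c ^ suc s
  dilate-high s z∈ with ∈-map⁻ (c ^ s *_) z∈
  ... | x , x∈ , refl = <-≤-trans (*-monoʳ-< (c ^ s) {{>-nonZero (1≤c^ s)}} (s≤s (∈⇒≤sum x∈))) (≤-reflexive (*-comm (c ^ s) c))

  blocks-high : ∀ s {z} → z ∈ blocks s → z < c ^ s
  blocks-high (suc s) z∈ with ∈-++⁻ (dilate s) z∈
  ... | inj₁ p = dilate-high s p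
  ... | inj₂ p = <-≤-trans (blocks-high s p) (m≤n*m (c ^ s) c)

  dilate-unique : ∀ s → Unique (dilate s)
  dilate-unique s = Unique.map⁺ (*-cancelˡ-≡ _ _ (c ^ s) {{>-nonZero (1≤c^ s)}}) uF

  blocks-unique : ∀ s → Unique (blocks s)
  blocks-unique zero    = []
  blocks-unique (suc s) = Unique.++⁺ (dilate-unique s) (blocks-unique s)
    λ (p , q) → <⇒≱ (blocks-high s q) (dilate-low s p)

  length-blocks : ∀ s → length (blocks s) ≡ s * length F
  length-blocks zero    = refl
  length-blocks (suc s) = trans (length-++ (dilate s)) (cong₂ _+_ (length-map _ F) (length-blocks s))

  blocks-positive : ∀ s {z} → z ∈ blocks s → 1 ≤ z
  blocks-positive (suc s) z∈ with ∈-++⁻ (dilate s) z∈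
  ... | inj₁ p = ≤-trans (1≤c^ s) (dilate-low s p)
  ... | inj₂ p = blocks-positive s p

  dilate-bound : ∀ s S → Unique S → All (_∈ dilate s) S → RestrictedSumFree k ℓ S → length S * a ≤ length F * b
  dilate-bound s S uS S⊆ sf = ≤-trans (*-monoˡ-≤ a smaller)
    (F-bound T (Unique.filter⁺ _ uF) (All.tabulate λ z∈ → proj₁ (∈-filter⁻ T? {xs = F} z∈)) T-sf)
    where
    T? : Decidable (λ z → c ^ s * z ∈ S)
    T? z = c ^ s * z ∈? S
    T = filter T? F
    smaller : length S ≤ length T
    smaller = ≤-trans (Unique-⊆-length uS into) (≤-reflexive (length-map (c ^ s *_) T))
      where
      into : ∀ {z} → z ∈ S → z ∈ map (c ^ s *_) T
      into z∈ with ∈-map⁻ (c ^ s *_) (All.lookup S⊆ z∈)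
      ... | x , x∈ , refl = ∈-map⁺ _ (∈-filter⁺ T? x∈ z∈)
    lift : ∀ {m as} → DistinctElems m T as → DistinctElems m S (map (c ^ s *_) as)
    lift {as = as} (u , as∈ , l) = Unique.map⁺ (*-cancelˡ-≡ _ _ (c ^ s) {{>-nonZero (1≤c^ s)}}) u
      , Allₚ.map⁺ (All.map (λ z∈ → proj₂ (∈-filter⁻ T? {xs = F} z∈)) as∈) , trans (length-map _ as) l
    T-sf : RestrictedSumFree k ℓ T
    T-sf as bs da db eq = sf _ _ (lift da) (lift db)
      (trans (sum-map-* (c ^ s) as) (trans (cong (c ^ s *_) eq) (sym (sum-map-* (c ^ s) bs))))

  module _ (s : ℕ) (S : List ℕ) (uS : Unique S) (sf : RestrictedSumFree k ℓ S) where

    low high : List ℕ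
    low  = filter (_<? c ^ s) S
    high = filter (¬? ∘ (_<? c ^ s)) S

    low-sf : RestrictedSumFree k ℓ low
    low-sf = RestrictedSumFree-⊆ (λ z∈ → proj₁ (∈-filter⁻ (_<? c ^ s) {xs = S} z∈)) sf

    high-sf : RestrictedSumFree k ℓ high
    high-sf = RestrictedSumFree-⊆ (λ z∈ → proj₁ (∈-filter⁻ (¬? ∘ (_<? c ^ s)) {xs = S} z∈)) sf

    low+high : length S ≡ length low + length high
    low+high = sym (filter-complement (_<? c ^ s) S)

    module _ {D : List ℕ} (D⊆ : ∀ {z} → z ∈ D → z ∈ dilate s) (S⊆ : All (_∈ D ++ blocks s) S) where

      low⊆ : All (_∈ blocks s) low
      low⊆ = All.tabulate λ z∈ → let (z∈S , z<) = ∈-filter⁻ (_<? c ^ s) {xs = S} z∈ in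
        in-blocks z< (∈-++⁻ D (All.lookup S⊆ z∈S))
        where
        in-blocks : ∀ {z} → z < c ^ s → z ∈ D ⊎ z ∈ blocks s → z ∈ blocks s
        in-blocks z< (inj₁ p) = ⊥-elim (<⇒≱ z< (dilate-low s (D⊆ p)))
        in-blocks z< (inj₂ p) = p

      high⊆ : All (_∈ dilate s) high
      high⊆ = All.tabulate λ z∈ → let (z∈S , z≮) = ∈-filter⁻ (¬? ∘ (_<? c ^ s)) {xs = S} z∈ in
        in-dilate z≮ (∈-++⁻ D (All.lookup S⊆ z∈S))
        where
        in-dilate : ∀ {z} → ¬ (z < c ^ s) → z ∈ D ⊎ z ∈ blocks s → z ∈ dilate s
        in-dilate z≮ (inj₁ p) = D⊆ p
        in-dilate z≮ (inj₂ p) = ⊥-elim (z≮ (blocks-high s p))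

  blocks-bound : ∀ s S → Unique S → All (_∈ blocks s) S → RestrictedSumFree k ℓ S → length S * a ≤ s * (length F * b)
  blocks-bound zero    []      _  _          _  = z≤n
  blocks-bound zero    (x ∷ S) _  (() ∷ _)   _
  blocks-bound (suc s) S uS S⊆ sf = begin
    length S * a ≡⟨ trans (cong (_* a) (low+high s S uS sf)) (*-distribʳ-+ a (length (low s S uS sf)) _) ⟩
    length (low s S uS sf) * a + length (high s S uS sf) * a
      ≤⟨ +-mono-≤ (blocks-bound s _ (Unique.filter⁺ _ uS) (low⊆ s S uS sf (λ z∈ → z∈) S⊆) (low-sf s S uS sf))
                  (dilate-bound s _ (Unique.filter⁺ _ uS) (high⊆ s S uS sf (λ z∈ → z∈) S⊆) (high-sf s S uS sf)) ⟩
    s * (length F * b) + length F * b ≡⟨ +-comm (s * (length F * b)) _ ⟩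
    suc s * (length F * b) ∎

  module _ (s r : ℕ) (r≤ : r ≤ length F) where

    ambient : List ℕ
    ambient = take r (dilate s) ++ blocks s

    ambient-set : NSetOfPositives (r + s * length F) ambient
    ambient-set = Unique.++⁺ (Unique.take⁺ r (dilate-unique s)) (blocks-unique s)
        (λ (p , q) → <⇒≱ (blocks-high s q) (dilate-low s (∈-take r p)))
      , All.tabulate positive
      , trans (length-++ (take r (dilate s))) (cong₂ _+_
          (trans (length-take r (dilate s)) (m≤n⇒m⊓n≡m (≤-trans r≤ (≤-reflexive (sym (length-map _ F)))))) (length-blocks s))
      where
      positive : ∀ {z} → z ∈ ambient → 1 ≤ z
      positive z∈ with ∈-++⁻ (take r (dilate s)) z∈
      ... | inj₁ p = ≤-trans (1≤c^ s) (dilate-low s (∈-take r p))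
      ... | inj₂ p = blocks-positive s p

    -- The truncated dilate inherits no density bound from F and is charged with |F| in full.
    ambient-bound : ∀ S → SubsetOf S ambient → RestrictedSumFree k ℓ S →
      length S * a ≤ s * (length F * b) + length F * a
    ambient-bound S (uS , S⊆) sf = begin
      length S * a ≡⟨ trans (cong (_* a) (low+high s S uS sf)) (*-distribʳ-+ a (length (low s S uS sf)) _) ⟩
      length (low s S uS sf) * a + length (high s S uS sf) * a
        ≤⟨ +-mono-≤ (blocks-bound s _ (Unique.filter⁺ _ uS) (low⊆ s S uS sf (∈-take r) S⊆) (low-sf s S uS sf))
             (*-monoˡ-≤ a (≤-trans (Unique-⊆-length (Unique.filter⁺ _ uS) (All.lookup (high⊆ s S uS sf (∈-take r) S⊆)))
                                   (≤-reflexive (length-map _ F)))) ⟩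
      s * (length F * b) + length F * a ∎

-- Half of the error 1/q is used up by F; the other half pays for the truncated dilate, as |F| ≤
-- N/(2q).
mhatUpper : ∀ k ℓ q → 1 ≤ q → ∀ F → Unique F → All (1 ≤_) F → 1 ≤ length F →
  (∀ S → Unique S → All (_∈ F) S → RestrictedSumFree k ℓ S →
    length S * ((k + ℓ) * (2 * q)) ≤ length F * (2 * q + (k + ℓ))) →
  ∀ N → 2 * q * length F ≤ N → MhatUpper k ℓ q N
mhatUpper k ℓ q 1≤q F uF F⁺ 1≤m bound N N≥ =
    ambient s r (<⇒≤ r<m) , subst (λ z → NSetOfPositives z (ambient s r (<⇒≤ r<m))) (sym N≡) (ambient-set s r (<⇒≤ r<m))
  , λ S S⊆ sf → *-cancelˡ-≤ 2 (begin
      2 * (length S * (k + ℓ) * q) ≡⟨ e₁ (length S) (k + ℓ) q ⟩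
      length S * ((k + ℓ) * (2 * q)) ≤⟨ ambient-bound s r (<⇒≤ r<m) S S⊆ sf ⟩
      s * (m * (2 * q + (k + ℓ))) + m * ((k + ℓ) * (2 * q)) ≡⟨ e₂ s m (2 * q) (k + ℓ) ⟩
      s * m * (2 * q + (k + ℓ)) + 2 * q * m * (k + ℓ)
        ≤⟨ +-mono-≤ (*-monoˡ-≤ (2 * q + (k + ℓ)) (subst (s * m ≤_) (sym N≡) (m≤n+m (s * m) r))) (*-monoˡ-≤ (k + ℓ) N≥) ⟩
      N * (2 * q + (k + ℓ)) + N * (k + ℓ) ≡⟨ e₃ N q (k + ℓ) ⟩
      2 * (N * q + N * (k + ℓ)) ∎)
  where
  open ≤-Reasoning
  open BlowUp k ℓ ((k + ℓ) * (2 * q)) (2 * q + (k + ℓ)) F uF F⁺ bound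
  m = length F
  instance m≢0 = >-nonZero 1≤m
  s = N / m
  r = N % m
  r<m = m%n<n N m
  N≡ : N ≡ r + s * m
  N≡ = m≡m%n+[m/n]*n N m
  e₁ : ∀ x y q → 2 * (x * y * q) ≡ x * (y * (2 * q))
  e₁ = solve-∀
  e₂ : ∀ s m q K → s * (m * (q + K)) + m * (K * q) ≡ s * m * (q + K) + q * m * K
  e₂ = solve-∀
  e₃ : ∀ N q K → N * (2 * q + K) + N * K ≡ 2 * (N * q + N * K)
  e₃ = solve-∀
 

-- The lower bound

length-filter-sumOver : ∀ {P : ℕ → Set} (P? : Decidable P) xs →
  length (filter P? xs) ≡ sumOver xs (λ x → 𝟙 (does (P? x)))
length-filter-sumOver P? []       = refl
length-filter-sumOver P? (x ∷ xs) with P? x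
... | yes _ = cong suc (length-filter-sumOver P? xs)
... | no  _ = length-filter-sumOver P? xs

module Lower (ℓ d : ℕ) (1≤ℓ : 1 ≤ ℓ) (1≤d : 1 ≤ d) (A : List ℕ) (A-positive : All (1 ≤_) A) where

  open ≤-Reasoning

  k P M : ℕ
  k = ℓ + d
  P = product A
  M = P * (d * (k + ℓ))

  1≤P : 1 ≤ P
  1≤P = >-nonZero⁻¹ P {{product≢0 (All.map >-nonZero A-positive)}}

  1≤k+ℓ : 1 ≤ k + ℓ
  1≤k+ℓ = ≤-trans 1≤ℓ (m≤n+m ℓ k)

  1≤M : 1 ≤ M
  1≤M = *-mono-≤ 1≤P (*-mono-≤ 1≤d 1≤k+ℓ)

  instance
    M≢0 : NonZero M
    M≢0 = >-nonZero 1≤M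

  InWindow : ℕ → ℕ → Set
  InWindow x a = ℓ * P ≤ (a * x) % M × (a * x) % M < k * P

  inWindow? : ∀ x → Decidable (InWindow x)
  inWindow? x a = (ℓ * P ≤? (a * x) % M) ×-dec ((a * x) % M <? k * P)

  -- Since a divides P, the map x ↦ a x modulo M has period M/a = c d (k + ℓ), and no reduction
  -- occurs within the first period.
  residue : ∀ a c i y → P ≡ a * c → 1 ≤ a → y < c * (d * (k + ℓ)) → (a * (i * (c * (d * (k + ℓ))) + y)) % M ≡ a * y
  residue a c i y P≡ 1≤a y< = trans (cong (_% M) (trans (expand a i (c * (d * (k + ℓ))) y) (cong (λ z → a * y + i * z) M≡)))
    (trans ([m+kn]%n≡m%n (a * y) i M)
           (m<n⇒m%n≡m (<-≤-trans (*-monoʳ-< a {{>-nonZero 1≤a}} y<) (≤-reflexive M≡))))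
    where
    expand : ∀ a i m y → a * (i * m + y) ≡ a * y + i * (a * m)
    expand = solve-∀
    M≡ : a * (c * (d * (k + ℓ))) ≡ M
    M≡ = trans (sym (*-assoc a c _)) (cong (_* (d * (k + ℓ))) (sym P≡))

  -- The window's ends ℓP and kP are multiples of a, so each of the a periods catches all y in [ℓc,
  -- kc) with c = P/a. This gives a · d c = d P values of x.
  count-lower : ∀ a → 1 ≤ a → a ∣ P → d * P ≤ sumTo M (λ x → 𝟙 (does (inWindow? x a)))
  count-lower a 1≤a (divides c P≡c*a) = begin
    d * P ≡⟨ trans (cong (d *_) P≡) (swap d a c) ⟩
    a * (d * c) ≤⟨ sumTo-≥const a (d * c) (λ i _ → each i) ⟩
    sumTo a (λ i → sumTo m (λ y → g (i * m + y))) ≡⟨ sumTo-blocks a m g ⟨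
    sumTo (a * m) g ≡⟨ cong (λ z → sumTo z g) M≡ ⟨
    sumTo M g ∎
    where
    P≡ : P ≡ a * c
    P≡ = trans P≡c*a (*-comm c a)
    m = c * (d * (k + ℓ))
    g : ℕ → ℕ
    g x = 𝟙 (does (inWindow? x a))
    M≡ : M ≡ a * m
    M≡ = trans (cong (_* (d * (k + ℓ))) P≡) (*-assoc a c _)
    swap : ∀ d a c → d * (a * c) ≡ a * (d * c)
    swap = solve-∀
    kc≤m : ℓ * c + d * c ≤ m
    kc≤m = begin
      ℓ * c + d * c ≡⟨ *-distribʳ-+ c ℓ d ⟨
      k * c ≡⟨ *-comm k c ⟩
      c * k ≤⟨ *-monoʳ-≤ c (≤-trans (m≤m+n k ℓ) (m≤n*m (k + ℓ) d {{>-nonZero 1≤d}})) ⟩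
      m ∎
    inside : ∀ i z → z < d * c → 1 ≤ g (i * m + (ℓ * c + z))
    inside i z z< = ≤-reflexive (sym (cong 𝟙 (dec-true (inWindow? (i * m + (ℓ * c + z)) a)
      (subst (ℓ * P ≤_) (sym res) (begin
        ℓ * P ≡⟨ trans (cong (ℓ *_) P≡) (swap ℓ a c) ⟩
        a * (ℓ * c) ≤⟨ *-monoʳ-≤ a (m≤m+n (ℓ * c) z) ⟩
        a * (ℓ * c + z) ∎)
      , subst (_< k * P) (sym res) (begin-strict
        a * (ℓ * c + z) <⟨ *-monoʳ-< a {{>-nonZero 1≤a}} (+-monoʳ-< (ℓ * c) z<) ⟩
        a * (ℓ * c + d * c) ≡⟨ cong (a *_) (sym (*-distribʳ-+ c ℓ d)) ⟩
        a * (k * c) ≡⟨ swap k a c ⟨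
        k * (a * c) ≡⟨ cong (k *_) P≡ ⟨
        k * P ∎)))))
      where
      res = residue a c i (ℓ * c + z) P≡ 1≤a (<-≤-trans (+-monoʳ-< (ℓ * c) z<) kc≤m)
    each : ∀ i → d * c ≤ sumTo m (λ y → g (i * m + y))
    each i = begin
      d * c ≡⟨ *-identityʳ (d * c) ⟨
      d * c * 1 ≤⟨ sumTo-≥const (d * c) 1 (inside i) ⟩
      sumTo (d * c) (λ z → g (i * m + (ℓ * c + z))) ≤⟨ m≤n+m _ _ ⟩
      sumTo (ℓ * c) (λ y → g (i * m + y)) + sumTo (d * c) (λ z → g (i * m + (ℓ * c + z)))
        ≡⟨ sumTo-split (ℓ * c) (d * c) (λ y → g (i * m + y)) ⟨
      sumTo (ℓ * c + d * c) (λ y → g (i * m + y)) ≤⟨ sumTo-≤-length (λ y → g (i * m + y)) kc≤m ⟩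
      sumTo m (λ y → g (i * m + y)) ∎

  large-window : ∃ λ x → x < M × length A ≤ (k + ℓ) * length (filter (inWindow? x) A)
  large-window = sumTo-average M (length A) 1≤M (begin
    M * length A ≡⟨ rearrange P d (k + ℓ) (length A) ⟩
    (k + ℓ) * (length A * (d * P)) ≤⟨ *-monoʳ-≤ (k + ℓ) count ⟩
    (k + ℓ) * sumTo M (λ x → length (filter (inWindow? x) A)) ≡⟨ sumTo-*ˡ M (k + ℓ) _ ⟨
    sumTo M (λ x → (k + ℓ) * length (filter (inWindow? x) A)) ∎)
    where
    rearrange : ∀ P d K n → P * (d * K) * n ≡ K * (n * (d * P))
    rearrange = solve-∀
    count : length A * (d * P) ≤ sumTo M (λ x → length (filter (inWindow? x) A))
    count = begin
      length A * (d * P) ≡⟨ sumOver-const A (d * P) ⟨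
      sumOver A (λ _ → d * P)
        ≤⟨ sumOver-mono (All.tabulate λ {a} a∈ → count-lower a (All.lookup A-positive a∈) (∈⇒∣product a∈)) ⟩
      sumOver A (λ a → sumTo M (λ x → 𝟙 (does (inWindow? x a)))) ≡⟨ sumOver-sumTo A M _ ⟩
      sumTo M (λ x → sumOver A (λ a → 𝟙 (does (inWindow? x a))))
        ≡⟨ sumTo-cong M (λ x _ → length-filter-sumOver (inWindow? x) A) ⟨
      sumTo M (λ x → length (filter (inWindow? x) A)) ∎

  -- The strict upper bounds add up to `Y + length as`, a form that also covers the empty list.
  residues : ∀ x as → All (InWindow x) as → ∃ λ Y → ∃ λ q →
    sum as * x ≡ Y + q * M × length as * (ℓ * P) ≤ Y × Y + length as ≤ length as * (k * P)
  residues x []       []             = 0 , 0 , refl , z≤n , z≤n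
  residues x (a ∷ as) ((lo , hi) ∷ h) with residues x as h
  ... | Y , q , eq , Y≥ , Y≤ = y + Y , (a * x) / M + q
      , (begin-equality
        (a + sum as) * x ≡⟨ *-distribʳ-+ x a (sum as) ⟩
        a * x + sum as * x ≡⟨ cong₂ _+_ (m≡m%n+[m/n]*n (a * x) M) eq ⟩
        y + (a * x) / M * M + (Y + q * M) ≡⟨ e₁ y ((a * x) / M) M Y q ⟩
        y + Y + ((a * x) / M + q) * M ∎)
      , +-mono-≤ lo Y≥
      , (begin
        y + Y + suc (length as) ≡⟨ e₂ y Y (length as) ⟩
        suc y + (Y + length as) ≤⟨ +-mono-≤ hi Y≤ ⟩
        k * P + length as * (k * P) ∎)
    where
    y = (a * x) % M
    e₁ : ∀ y p M Y q → y + p * M + (Y + q * M) ≡ y + Y + (p + q) * M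
    e₁ = solve-∀
    e₂ : ∀ y Y n → y + Y + suc n ≡ suc y + (Y + n)
    e₂ = solve-∀

  not-congruent : ∀ {Y Z p q} → Z < Y → Y < Z + M → Y + p * M ≢ Z + q * M
  not-congruent {Y} {Z} {p} {q} Z<Y Y<Z+M eq with p <? q
  ... | no  p≮q = <⇒≢ (+-mono-<-≤ Z<Y (*-monoˡ-≤ M (≮⇒≥ p≮q))) (sym eq)
  ... | yes p<q = <⇒≢ (<-≤-trans (+-monoˡ-< (p * M) Y<Z+M) (begin
        Z + M + p * M ≡⟨ +-assoc Z M (p * M) ⟩
        Z + suc p * M ≤⟨ +-monoʳ-≤ Z (*-monoˡ-≤ M p<q) ⟩
        Z + q * M ∎)) eq

  -- The k-fold sums of residues lie in [kℓP, k²P) and the ℓ-fold ones in [ℓ²P, kℓP). The former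
  -- exceed the latter, but by less than k²P - ℓ²P = M.
  window-sumFree : ∀ x → RestrictedSumFree k ℓ (filter (inWindow? x) A)
  window-sumFree x as bs (_ , as∈ , las) (_ , bs∈ , lbs) eq = clash (residues x as (window as∈)) (residues x bs (window bs∈))
    where
    window : ∀ {as} → All (_∈ filter (inWindow? x) A) as → All (InWindow x) as
    window = All.map λ z∈ → proj₂ (∈-filter⁻ (inWindow? x) {xs = A} z∈)
    clash : (∃ λ Y → ∃ λ q → sum as * x ≡ Y + q * M × length as * (ℓ * P) ≤ Y × Y + length as ≤ length as * (k * P)) →
            (∃ λ Z → ∃ λ q → sum bs * x ≡ Z + q * M × length bs * (ℓ * P) ≤ Z × Z + length bs ≤ length bs * (k * P)) → ⊥
    clash (Y , p , eqY , Y≥ , Y≤) (Z , q , eqZ , Z≥ , Z≤) rewrite las | lbs = not-congruent {Y} {Z} {p} {q}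
      (begin-strict
        Z <⟨ m<m+n Z 1≤ℓ ⟩
        Z + ℓ ≤⟨ Z≤ ⟩
        ℓ * (k * P) ≡⟨ e₁ ℓ k P ⟩
        k * (ℓ * P) ≤⟨ Y≥ ⟩
        Y ∎)
      (begin-strict
        Y <⟨ m<m+n Y (≤-trans 1≤ℓ (m≤m+n ℓ d)) ⟩
        Y + k ≤⟨ Y≤ ⟩
        k * (k * P) ≡⟨ e₂ ℓ d P ⟩
        ℓ * (ℓ * P) + M ≤⟨ +-monoˡ-≤ M Z≥ ⟩
        Z + M ∎)
      (trans (sym eqY) (trans (cong (_* x) eq) eqZ))
      where
      e₁ : ∀ ℓ k P → ℓ * (k * P) ≡ k * (ℓ * P)
      e₁ = solve-∀
      e₂ : ∀ ℓ d P → (ℓ + d) * ((ℓ + d) * P) ≡ ℓ * (ℓ * P) + P * (d * (ℓ + d + ℓ))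
      e₂ = solve-∀

mhatLower : ∀ ℓ d → 1 ≤ ℓ → 1 ≤ d → ∀ q N → MhatLower (ℓ + d) ℓ q N
mhatLower ℓ d 1≤ℓ 1≤d q N A (uA , A⁺ , refl) = conclude large-window
  where
  open Lower ℓ d 1≤ℓ 1≤d A A⁺
  open ≤-Reasoning
  conclude : (∃ λ x → x < M × length A ≤ (k + ℓ) * length (filter (inWindow? x) A)) →
    Σ (List ℕ) λ S → SubsetOf S A × RestrictedSumFree k ℓ S × length A * q ≤ length S * (k + ℓ) * q + length A * (k + ℓ)
  conclude (x , _ , le) = filter (inWindow? x) A
    , (Unique.filter⁺ _ uA , All.tabulate λ z∈ → proj₁ (∈-filter⁻ (inWindow? x) {xs = A} z∈))
    , window-sumFree x
    , ≤-trans (*-monoˡ-≤ q (≤-trans le (≤-reflexive (*-comm (k + ℓ) _)))) (m≤m+n _ _)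

-- Combining the two bounds

extremal-set : ∀ k ℓ q → 1 ≤ k → ℓ ≤ k → 1 ≤ q → ∃ λ F → Unique F × All (1 ≤_) F × 1 ≤ length F ×
  (∀ S → Unique S → All (_∈ F) S → RestrictedSumFree (suc k) (suc ℓ) S →
    length S * ((suc k + suc ℓ) * (2 * q)) ≤ length F * (2 * q + (suc k + suc ℓ)))
extremal-set k ℓ q 1≤k ℓ≤k 1≤q =
  simplify (164 * e) (≤-trans 1≤e (m≤n*m e 164)) (m≤n*m e 164)
    (almost-invariant-set k ℓ (164 * e) 1≤k ℓ≤k (m≤m*n 164 e {{>-nonZero 1≤e}}))
  where
  open ≤-Reasoning
  e : ℕ
  -- The excess density (k + 4)/((k + ℓ + 2) p₀) is at most 1/(2q) as soon as p₀ ≥ e; the factor 164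
  -- in p₀ = 164 e meets the condition on the scales.
  e = 2 * q * (k + 4)
  1≤e : 1 ≤ e
  1≤e = *-mono-≤ {1} {2 * q} (*-mono-≤ {1} {2} (s≤s z≤n) 1≤q) (≤-trans (s≤s z≤n) (m≤n+m 4 k))
  e₁ : ∀ p s k ℓ r → p * (s * ((suc k + suc ℓ) * r)) ≡ r * ((2 + (k + ℓ)) * p * s)
  e₁ = solve-∀
  e₂ : ∀ r f p k → r * (f * (p + k + 4)) ≡ f * (p * r) + f * (r * (k + 4))
  e₂ = solve-∀
  e₃ : ∀ f p r K → f * (p * r) + f * (p * K) ≡ p * (f * (r + K))
  e₃ = solve-∀
  simplify : ∀ p → 1 ≤ p → e ≤ p →
    (∃ λ F → Unique F × All (1 ≤_) F × 1 ≤ length F ×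
      (∀ S → Unique S → All (_∈ F) S → RestrictedSumFree (suc k) (suc ℓ) S →
        (2 + (k + ℓ)) * p * length S ≤ length F * (p + k + 4))) →
    ∃ λ F → Unique F × All (1 ≤_) F × 1 ≤ length F ×
      (∀ S → Unique S → All (_∈ F) S → RestrictedSumFree (suc k) (suc ℓ) S →
        length S * ((suc k + suc ℓ) * (2 * q)) ≤ length F * (2 * q + (suc k + suc ℓ)))
  simplify p 1≤p e≤p (F , uF , F⁺ , 1≤F , bound) = F , uF , F⁺ , 1≤F , λ S uS S⊆ sf →
    *-cancelˡ-≤ p {{>-nonZero 1≤p}} (begin
      p * (length S * ((suc k + suc ℓ) * (2 * q))) ≡⟨ e₁ p (length S) k ℓ (2 * q) ⟩
      2 * q * ((2 + (k + ℓ)) * p * length S) ≤⟨ *-monoʳ-≤ (2 * q) (bound S uS S⊆ sf) ⟩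
      2 * q * (length F * (p + k + 4)) ≡⟨ e₂ (2 * q) (length F) p k ⟩
      length F * (p * (2 * q)) + length F * e
        ≤⟨ +-monoʳ-≤ _ (*-monoʳ-≤ (length F) (≤-trans e≤p (m≤m*n p (suc k + suc ℓ)))) ⟩
      length F * (p * (2 * q)) + length F * (p * (suc k + suc ℓ)) ≡⟨ e₃ (length F) p (2 * q) (suc k + suc ℓ) ⟩
      p * (length F * (2 * q + (suc k + suc ℓ))) ∎)

theorem1p2 : (k ℓ : ℕ) → 1 ≤ ℓ → ℓ < k → k ≤ 2 * ℓ + 1 →
    (q : ℕ) → 1 ≤ q →
    Σ ℕ λ N₀ → (N : ℕ) → N₀ ≤ N → MhatLower k ℓ q N × MhatUpper k ℓ q N
theorem1p2 (suc k) (suc ℓ) 1≤ℓ (s≤s ℓ<k) _ q 1≤q = from (extremal-set k ℓ q (≤-trans (s≤s z≤n) ℓ<k) (<⇒≤ ℓ<k) 1≤q)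
                                                       (m≤n⇒∃[o]m+o≡n ℓ<k)
  where
  from : (∃ λ F → Unique F × All (1 ≤_) F × 1 ≤ length F ×
      (∀ S → Unique S → All (_∈ F) S → RestrictedSumFree (suc k) (suc ℓ) S →
        length S * ((suc k + suc ℓ) * (2 * q)) ≤ length F * (2 * q + (suc k + suc ℓ)))) →
    (∃ λ o → suc ℓ + o ≡ k) →
    Σ ℕ λ N₀ → (N : ℕ) → N₀ ≤ N → MhatLower (suc k) (suc ℓ) q N × MhatUpper (suc k) (suc ℓ) q N
  from (F , uF , F⁺ , 1≤F , bound) (o , refl) = 2 * q * length F , λ N N≥ →
      subst (λ z → MhatLower z (suc ℓ) q N) (+-suc (suc ℓ) o) (mhatLower (suc ℓ) (suc o) 1≤ℓ (s≤s z≤n) q N)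
    , mhatUpper (suc (suc ℓ + o)) (suc ℓ) q 1≤q F uF F⁺ 1≤F bound N N≥
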